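{- Let $G$ be a finite abelian group of order $n$ (written additively) and let $S$ be a sequence over $G$ with $|S|=n$. Suppose there is a unique integer $r\in[1,n]$ such that $0\in\Sigma_r(S)$. Then $|\mathrm{supp}(S)|\le 2$. Moreover: (A) If $G$ is non-cyclic, then there are $g,h\in G$ and an integer $m\geq 1$ with $\mathrm{ord}(g)=\frac n2=2m$, $\mathrm{ord}(h)=2$, $h\in G\setminus\langle g\rangle$, such that $G=\langle h\rangle\oplus\langle g\rangle\cong C_2\oplus C_{2m}$, $r=\frac n2=2m$, and one of the following holds: $$S=g^{n-1}g' \quad\text{for some } g'\in G\setminus\langle g\rangle;$$ $$S=g^{n/2+x}(h+g)^{n/2-x}\quad\text{for some odd integer } x\in[1,\tfrac n2-1];$$ $$S=g^{n/2+x}\left(h+\tfrac{n+4}{4}g\right)^{n/2-x}\quad\text{for some odd integer } x\in[1,\tfrac n2-1].$$ (B) If $G$ is cyclic (so $G\cong C_n$), then there exists a generator $g\in G$ such that one of the following holds: (1) $S=g^{n-1}g'$ for some $g'\in G$; (2) $S=(2g)^{n-1}g''$ for some $g''\in G\setminus\langle 2g\rangle$; (3) $n$ is odd, $r=\frac{n+1}{2}$ and $S=g^{n-2}\left(\frac{n+1}{2}g\right)^2$; (4) $n\equiv 2 \pmod 4$, $r=\frac n2$ and $S=(2g)^{n/2+x}\left(\frac{n+4}{2}g\right)^{n/2-x}$ for some even integer $x\in[0,\frac n2-1]$; (5) $n$ is even, $r=\frac n2$ and $S=g^{n/2+x}\left(\frac{n+2}{2}g\right)^{n/2-x}$ for some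 integer $x\in[0,\frac n2-1]$ with $\frac n2-x$ odd.
   Context: A sequence over an abelian group $G$ is a finite multiset of elements of $G$ (an element of the free abelian monoid with basis $G$), written multiplicatively: $S=s_1\cdots s_r=\prod_{g\in G}g^{v_g(S)}$, where $v_g(S)\ge 0$ is the multiplicity of $g$ in $S$. So $g^k$ means the element $g$ repeated $k$ times, juxtaposition means multiset union, and e.g. $(kg)^j$ means the group element $kg$ repeated $j$ times. The length is $|S|=\sum_{g}v_g(S)$ and the support is $\mathrm{supp}(S)=\{g\in G: v_g(S)>0\}$. A subsequence $T\mid S$ is a sub-multiset, i.e. $v_g(T)\le v_g(S)$ for all $g$. The sum is $\sigma(S)=\sum_{g\in G}v_g(S)g$. For an integer $k\geq 1$, $\Sigma_k(S)=\{\sigma(T): T\mid S,\ |T|=k\}$. $C_n$ is the cyclic group of order $n$, $\mathrm{ord}(g)$ is the order of $g$, $\langle g\rangle$ is the subgroup generated by $g$, and $[a,b]$ denotes the set of integers $x$ with $a\le x\le b$. -}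

module Defs where

open import Algebra.Bundles using (AbelianGroup)
open import Algebra.Construct.DirectProduct using () renaming (abelianGroup to _×ᴳ_) public
open import Algebra.Definitions.RawMonoid using () renaming (_×_ to multiple)
open import Algebra.Morphism.Structures using (module GroupMorphisms)
open import Data.Fin.Base using (Fin)
import Data.Fin.Properties as Fin
open import Data.Integer.Base as ℤ using (ℤ; +_; -[1+_])
open import Data.Integer.Divisibility.Signed as ℤ using ()
import Data.Integer.Properties as ℤ
open import Data.Integer.Solver using (module +-*-Solver)
open import Data.List.Base using (List; filter; foldr; length; deduplicate)
open import Data.Nat.Base as ℕ using (ℕ; _≤_; _<_; _%_)
open import Data.Product.Base using (∃-syntax; _×_; _,_)
open import Function.Bundles using (Inverse)
open import Function.Properties.Inverse using (Inverse⇒Injection)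
open import Level using (Level; _⊔_; 0ℓ)
open import Relation.Binary.Definitions using (Decidable)
open import Relation.Binary.PropositionalEquality as ≡ using (_≡_; refl)
open import Relation.Nullary.Decidable using (via-injection)
open import Relation.Unary using (Pred; _∈_)

private
  variable
    a b ℓ₁ ℓ₂ : Level

Even Odd : ℕ → Set
Even x = x % 2 ≡ 0
Odd  x = x % 2 ≡ 1

-- The cyclic group of order k (for k ≥ 1), as ℤ with equality taken modulo k.

C : ℕ → AbelianGroup 0ℓ 0ℓ
C k = record
  { Carrier = ℤ
  ; _≈_ = λ x y → + k ℤ.∣ x ℤ.- y
  ; _∙_ = ℤ._+_
  ; ε = ℤ.0ℤ
  ; _⁻¹ = ℤ.-_
  ; isAbelianGroup = record
    { isGroup = record
      { isMonoid = record
        { isSemigroup = record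
          { isMagma = record
            { isEquivalence = record
              { refl = λ {x} → reflexive {x} refl
              ; sym = λ {x} {y} p →
                  ≡.subst (+ k ℤ.∣_) (sym-eq x y) (ℤ.∣m⇒∣-m p)
              ; trans = λ {x} {y} {z} p q →
                  ≡.subst (+ k ℤ.∣_) (trans-eq x y z) (ℤ.∣m∣n⇒∣m+n p q)
              }
            ; ∙-cong = λ {x} {y} {u} {v} p q →
                ≡.subst (+ k ℤ.∣_) (cong-eq x y u v) (ℤ.∣m∣n⇒∣m+n p q)
            }
          ; assoc = λ x y z → reflexive (ℤ.+-assoc x y z)
          }
        ; identity = (λ x → reflexive (ℤ.+-identityˡ x))
                   , (λ x → reflexive (ℤ.+-identityʳ x))
        }
      ; inverse = (λ x → reflexive (ℤ.+-inverseˡ x))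
                , (λ x → reflexive (ℤ.+-inverseʳ x))
      ; ⁻¹-cong = λ {x} {y} p →
          ≡.subst (+ k ℤ.∣_) (neg-eq x y) (ℤ.∣m⇒∣-m p)
      }
    ; comm = λ x y → reflexive (ℤ.+-comm x y)
    }
  }
  where
  open +-*-Solver

  reflexive : ∀ {x y} → x ≡ y → + k ℤ.∣ x ℤ.- y
  reflexive {x} refl = ℤ.divides ℤ.0ℤ (ℤ.+-inverseʳ x)

  sym-eq : ∀ x y → ℤ.- (x ℤ.- y) ≡ y ℤ.- x
  sym-eq = solve 2 (λ x y → :- (x :- y) := y :- x) refl

  trans-eq : ∀ x y z → (x ℤ.- y) ℤ.+ (y ℤ.- z) ≡ x ℤ.- z
  trans-eq = solve 3 (λ x y z → (x :- y) :+ (y :- z) := x :- z) refl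

  cong-eq : ∀ x y u v →
            (x ℤ.- y) ℤ.+ (u ℤ.- v) ≡ (x ℤ.+ u) ℤ.- (y ℤ.+ v)
  cong-eq = solve 4 (λ x y u v →
    (x :- y) :+ (u :- v) := (x :+ u) :- (y :+ v)) refl

  neg-eq : ∀ x y → ℤ.- (x ℤ.- y) ≡ (ℤ.- x) ℤ.- (ℤ.- y)
  neg-eq = solve 2 (λ x y → :- (x :- y) := (:- x) :- (:- y)) refl

infix 4 _≅_

_≅_ : AbelianGroup a ℓ₁ → AbelianGroup b ℓ₂ → Set (a ⊔ b ⊔ ℓ₁ ⊔ ℓ₂)
G ≅ H = ∃[ f ] IsGroupIsomorphism f
  where
  open GroupMorphisms (AbelianGroup.rawGroup G) (AbelianGroup.rawGroup H)

-- The order of G is counted up to its own equality _≈_.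

HasCardinality : AbelianGroup a ℓ₁ → ℕ → Set (a ⊔ ℓ₁)
HasCardinality G n = Inverse (AbelianGroup.setoid G) (≡.setoid (Fin n))

module GroupNotions {c ℓ : Level} (G : AbelianGroup c ℓ) where

  open AbelianGroup G public using (Carrier; _≈_) renaming (_∙_ to _+ᴳ_; ε to 0ᴳ)
  open AbelianGroup G using (_⁻¹; rawMonoid)

  infixr 8 _·_ _·ᶻ_

  _·_ : ℕ → Carrier → Carrier
  _·_ = multiple rawMonoid

  _·ᶻ_ : ℤ → Carrier → Carrier
  (+ k)    ·ᶻ g = k · g
  -[1+ k ] ·ᶻ g = (ℕ.suc k · g) ⁻¹

  ⟨_⟩ : Carrier → Pred Carrier ℓ
  ⟨ g ⟩ x = ∃[ k ] k ·ᶻ g ≈ x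

  IsGenerator : Carrier → Set (c ⊔ ℓ)
  IsGenerator g = ∀ x → x ∈ ⟨ g ⟩

  IsCyclic : Set (c ⊔ ℓ)
  IsCyclic = ∃[ g ] IsGenerator g

  -- ord(g) = k
  HasOrder : Carrier → ℕ → Set ℓ
  HasOrder g k = 0 < k × k · g ≈ 0ᴳ × (∀ j → 0 < j → j · g ≈ 0ᴳ → k ≤ j)

  -- G = H ⊕ K, for subgroups H and K of G
  IsDirectSum : Pred Carrier ℓ → Pred Carrier ℓ → Set (c ⊔ ℓ)
  IsDirectSum H K =
    (∀ x → ∃[ y ] ∃[ z ] y ∈ H × z ∈ K × y +ᴳ z ≈ x) ×
    (∀ x → x ∈ H → x ∈ K → x ≈ 0ᴳ)

-- A sequence (finite multiset) over G is represented by a list; two lists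
-- represent the same sequence when they are permutations of each other up to _≈_.

module Sequences {c ℓ : Level} (G : AbelianGroup c ℓ)
                 {n : ℕ} (|G|≡n : HasCardinality G n) where

  open GroupNotions G
  open import Data.List.Relation.Binary.Permutation.Setoid
    (AbelianGroup.setoid G) public using (_↭_)

  _≟_ : Decidable _≈_
  _≟_ = via-injection (Inverse⇒Injection |G|≡n) Fin._≟_

  v : Carrier → List Carrier → ℕ
  v g S = length (filter (g ≟_) S)

  -- The elements of positive multiplicity, each listed once.
  supp : List Carrier → List Carrier
  supp = deduplicate _≟_

  infix 4 _∣_

  _∣_ : List Carrier → List Carrier → Set c
  T ∣ S = ∀ g → v g T ≤ v g S

  σ : List Carrier → Carrier
  σ = foldr _+ᴳ_ 0ᴳ

  Σₖ : ℕ → List Carrier → Pred Carrier (c ⊔ ℓ)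
  Σₖ k S x = ∃[ T ] T ∣ S × length T ≡ k × σ T ≈ x

{-# OPTIONS --safe #-}
module Submission where

-- If all nonempty zero-sum subsequences T of S have the same length r, then replacing
-- T′ | T by a subsequence R′ of R = S T⁻¹ with the same sum shows |T′| = |R′|.  Moreover R
-- and every proper subsequence of T are zero-sum free.
--
-- A zero-sum free sequence γ with fewer than 2|γ| subset sums (the empty sum included)
-- consists of multiples x g whose coefficients x ≥ 1 have a sum below ord(g), and every
-- number up to that sum is a partial sum of the coefficients.  Indeed, if a ≠ b lie in γ, then
-- removing a or removing b loses at least two subset sums: otherwise both removals leave the
-- same set, which is symmetric about two centres and so has the period a − b, although its
-- translate by a exceeds it by σ(γ) alone.
--
-- Thus S can be read off the coefficients of R when 2r ≤ n + 1, and of T when 2r ≥ n + 2,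
-- because an element x g can be exchanged for x copies of g only if x = 1.  The one
-- exception is n = 2r with every complement R attaining all of G as subset sums.  Then
-- exchanges of single elements give T ⊆ R, T + μ ⊆ R and R ⊆ T ∪ {t + μ} for t ∈ T and
-- μ = σ(S), which forces some T to be constant and S to consist of t and t + μ.

open import Defs
open import Algebra.Bundles using (AbelianGroup)
open import Algebra.Structures using (IsAbelianGroup)
import Algebra.Properties.CommutativeMonoid.Mult as Mult
import Algebra.Properties.Group as GroupProperties
import Algebra.Solver.CommutativeMonoid as CommutativeMonoidSolver
open import Data.Empty using (⊥; ⊥-elim)
open import Data.Fin.Base using (Fin)
import Data.Fin.Properties as Fin
open import Data.List.Base using
  (List; []; _∷_; [_]; _++_; length; map; replicate; filter; foldr; allFin; applyUpTo)
open import Data.List.Membership.DecPropositional as DecMembership using ()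
open import Data.List.Membership.Propositional using (lose; find) renaming (_∈_ to _∈ˡ_)
open import Data.List.Membership.Propositional.Properties using
  ( ∈-++⁺ˡ; ∈-++⁺ʳ; ∈-++⁻; ∈-map⁺; ∈-map⁻; ∈-filter⁺; ∈-filter⁻; ∈-allFin
  ; ∈-applyUpTo⁺; ∈-applyUpTo⁻; ∈-∃++; ∈-deduplicate⁻ )
open import Data.List.Properties using
  ( length-++; length-map; length-replicate; length-applyUpTo; length-tabulate
  ; map-++; map-replicate
  ; filter-++; filter-accept; filter-reject; filter-none; ++-identityʳ; ++-conicalˡ; ++-conicalʳ )
  renaming (++-assoc to ++-assoc≡)
open import Data.Nat.Base using (ℕ; zero; suc; _+_; _*_; _∸_; _/_; _%_; _≤_; _<_; z≤n; s≤s; s≤s⁻¹)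
open import Data.Nat.DivMod using (m*n/n≡m; m*n%n≡0; [m+kn]%n≡m%n; m≡m%n+[m/n]*n; m%n<n)
open import Data.Nat.Properties
open import Data.Nat.Tactic.RingSolver using () renaming (solve to ring)
open import Data.Product.Base using (∃-syntax; _×_; _,_; proj₁; proj₂)
open import Data.Sum.Base using (_⊎_; inj₁; inj₂; [_,_]′)
open import Relation.Binary.PropositionalEquality using
  (_≡_; _≢_; refl; sym; trans; cong; cong₂; subst; subst₂; isEquivalence; module ≡-Reasoning)

-- Linear arithmetic

-- The size of G alone gives fewer than 2|γ| subset sums only when 2|γ| > n. A complement R has n -
-- r terms and T without one term has r - 1, so the three values 2r = n, n + 1, n + 2 escape the
-- structure theorem; they shape the proof. For n + 1 and n + 2 one borrowed term closes the gap: a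
-- subsequence of length exactly r is zero-sum free unless its own sum is zero, and r terms are then
-- enough. For 2r = n a borrowed term would give length r + 1, where a zero-sum subsequence may
-- hide. Hence the alternative there between a complement that misses an element of G, which has few
-- enough subset sums, and one that reaches all of G. G is not assumed cyclic anywhere in this
-- analysis. Outside the last alternative a generator comes from counting: the multiples of g in
-- hand fill more than half of G, so every coset of ⟨g⟩ meets ⟨g⟩. In the last alternative only a
-- subgroup of index two is found, and whether G splits over it decides between (A) and (B). The
-- argument runs on `Fin n` with propositional equality, where subset sums can be decided and
-- counted, and is carried over to G at the end.

≤-absurd : ∀ {a b} k → a ≤ b → a ≡ suc (k + b) → ⊥
≤-absurd {b = b} k a≤b refl = <⇒≱ (s≤s (m≤n+m b k)) a≤b

-- Such refutations are certificates: the hypotheses are added up, and `ring` checks that the left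
-- total exceeds the right one by `suc k`, where k is the number handed to `≤-absurd`. As a rule `w`
-- counts the coefficients equal to 1, while `l` and `s` are the number and the sum of those that
-- are at least 2; `x` or `y` is one coefficient singled out, with `m` others of sum `B`.
part-bound : ∀ w y l s → 2 * l ≤ s → suc (y + s) ≤ w + 2 * suc l → suc (suc w) ≤ y → ⊥
part-bound w y l s h₁ h₂ h₃ =
  ≤-absurd 0 (+-mono-≤ h₁ (+-mono-≤ h₂ h₃)) (ring (l ∷ s ∷ w ∷ y ∷ []))

rest-bound : ∀ w y l s → w + 2 * l ≤ s → suc (y + s) ≤ w + 2 * suc l → 2 ≤ y → ⊥
rest-bound w y l s h₁ h₂ h₃ =
  ≤-absurd 0 (+-mono-≤ h₁ (+-mono-≤ h₂ h₃)) (ring (l ∷ s ∷ w ∷ y ∷ []))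

private
  infixr 4 _⊞_
  _⊞_ : ∀ {a b c d} → a ≤ b → c ≤ d → a + c ≤ b + d
  _⊞_ = +-mono-≤

  ≥-from-≡ : ∀ {a b : ℕ} → a ≡ b → b ≤ a
  ≥-from-≡ e = ≤-reflexive (sym e)

-- Since w + s is at least w + l = n - r, which is at least (n - 1)/2, the multiples 0, g, ..., (w +
-- s) g fill more than half of G.
covers-most : ∀ n r w l s → w + l + r ≡ n → 2 * l ≤ s → 2 * r ≤ suc n → n < 2 * suc (w + s)
covers-most n r w l s eq h₁ h₂ = ≰⇒> λ (h : 2 * suc (w + s) ≤ n) →
  ≤-absurd (2 * l) (h ⊞ h₁ ⊞ h₁ ⊞ h₂ ⊞ ≥-from-≡ eq ⊞ ≥-from-≡ eq) (ring (n ∷ r ∷ w ∷ l ∷ s ∷ []))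

no-large-part : ∀ w x B m → x + B + 2 ≤ w + 2 * suc m → 2 * m ≤ B → w < x → ⊥
no-large-part w x B m h₁ h₂ h₃ = ≤-absurd 0 (h₁ ⊞ h₂ ⊞ h₃) (ring (w ∷ x ∷ B ∷ m ∷ []))

other-parts-small : ∀ w x B m → x + B + 1 ≤ w + 2 * suc m → w < x → B ≤ 2 * m
other-parts-small w x B m h₁ h₂ = ≮⇒≥ λ (h₃ : 2 * m < B) → ≤-absurd 0 (h₁ ⊞ h₂ ⊞ h₃)
    (ring (w ∷ x ∷ B ∷ m ∷ []))

large-part≤ : ∀ w x B m → x + B + 1 ≤ w + 2 * suc m → 2 * m ≤ B → x ≤ suc w
large-part≤ w x B m h₁ h₂ = ≮⇒≥ λ (h₃ : suc w < x) → ≤-absurd 0 (h₁ ⊞ h₂ ⊞ h₃)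
    (ring (w ∷ x ∷ B ∷ m ∷ []))

half-length : ∀ n r w m → w + suc m + r ≡ n → 2 * r ≡ suc n → r ≡ w + m + 2
half-length n r w m refl e = +-cancelʳ-≡ r r (w + m + 2) (trans (2*r r) (trans e (rearrange w m r)))
  where
  2*r : ∀ r → r + r ≡ 2 * r
  2*r r = ring (r ∷ [])
  rearrange : ∀ w m r → suc (w + suc m + r) ≡ w + m + 2 + r
  rearrange w m r = ring (w ∷ m ∷ r ∷ [])

-- The coefficient total of the zero-sum sequence s, 1, s, 2, ..., 2 with s = w + 1 in
-- `unit-or-two`.
half-total : ∀ n r w m → w + suc m + r ≡ n → 2 * r ≡ suc n → suc w + (1 + (suc w + m * 2)) ≡ n
half-total n r w m eq e with refl ← half-length n r w m eq e = trans (rearrange w m) eq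
  where
  rearrange : ∀ w m → suc w + (1 + (suc w + m * 2)) ≡ w + suc m + (w + m + 2)
  rearrange w m = ring (w ∷ m ∷ [])

half-w≡1 : ∀ n r w m → w + suc m + r ≡ n → 2 * r ≡ suc n → 3 + m ≡ r → w ≡ 1
half-w≡1 n r w m eq e₁ e₂ = sym (+-cancelʳ-≡ (m + 2) 1 w
  (trans (rearrange₁ m) (trans e₂ (trans (half-length n r w m eq e₁) (+-assoc w m 2)))))
  where
  rearrange₁ : ∀ m → 1 + (m + 2) ≡ 3 + m
  rearrange₁ m = ring (m ∷ [])

few-large : ∀ n r w l s x y → w + l + r ≡ n → y + x ≡ n → r ≤ suc y → w + s < x → s ≤ l
few-large n r w l s x y e₁ e₂ h₁ h₂ = ≮⇒≥ λ (h₃ : l < s) →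
  ≤-absurd 0 (h₁ ⊞ h₂ ⊞ h₃ ⊞ ≥-from-≡ e₁ ⊞ ≤-reflexive e₂)
    (ring (n ∷ r ∷ w ∷ l ∷ s ∷ x ∷ y ∷ []))

overshoot≤ : ∀ n r w x y → w + r ≡ n → y + x ≡ n → r ≤ suc y → x ≤ suc w
overshoot≤ n r w x y e₁ e₂ h₁ = ≮⇒≥ λ (h₂ : suc w < x) →
  ≤-absurd 0 (h₁ ⊞ h₂ ⊞ ≥-from-≡ e₁ ⊞ ≤-reflexive e₂) (ring (n ∷ r ∷ w ∷ x ∷ y ∷ []))

pair-total : ∀ n w ρ → w + suc ρ ≡ n → 2 * ρ + 2 * suc w ≡ 2 * n
pair-total n w ρ refl = ring (w ∷ ρ ∷ [])

pair-length : ∀ ρ → 2 * ρ + 2 ≢ suc ρ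
pair-length ρ e = ≤-absurd ρ (≤-reflexive e) (ring (ρ ∷ []))

two-left : ∀ n w k ρ → w + suc ρ ≡ n → k + 2 ≡ suc ρ → 2 * suc ρ ≤ suc n → w + k < 2 * ρ →
    suc n ≡ 2 * suc ρ
two-left n w k ρ e₁ e₂ h₁ h₂ = ≤-antisym
  (≮⇒≥ λ (h₃ : 2 * suc ρ < suc n) → ≤-absurd 0 (h₂ ⊞ h₃ ⊞ ≥-from-≡ e₁ ⊞ ≥-from-≡ e₂)
      (ring (n ∷ w ∷ k ∷ ρ ∷ []))) h₁

two-left-w : ∀ n w ρ → w + suc ρ ≡ n → suc n ≡ 2 * suc ρ → w ≡ ρ
two-left-w n w ρ refl e = +-cancelʳ-≡ (2 + ρ) w ρ (trans (l w ρ) (trans e (r ρ)))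
  where
  l : ∀ w ρ → w + (2 + ρ) ≡ suc (w + suc ρ)
  l w ρ = ring (w ∷ ρ ∷ [])
  r : ∀ ρ → 2 * suc ρ ≡ ρ + (2 + ρ)
  r ρ = ring (ρ ∷ [])

n≤3ρ : ∀ n w k ρ → w + suc ρ ≡ n → w + k < 2 * ρ → n ≤ 3 * ρ
n≤3ρ n w k ρ e h₁ = ≮⇒≥ λ (h₂ : 3 * ρ < n) → ≤-absurd k (h₁ ⊞ h₂ ⊞ ≥-from-≡ e)
  (ring (n ∷ w ∷ k ∷ ρ ∷ []))

3ρ≤w+n : ∀ n w ρ → w + suc ρ ≡ n → 2 * suc ρ ≤ suc n → 3 * ρ ≤ w + n
3ρ≤w+n n w ρ e h₁ = ≮⇒≥ λ (h₂ : w + n < 3 * ρ) → ≤-absurd 1 (h₁ ⊞ h₁ ⊞ h₂ ⊞ ≥-from-≡ e)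
  (ring (n ∷ w ∷ ρ ∷ []))

reflected≤ : ∀ n s L → n < 2 * suc L → L < s → n ≤ s + L
reflected≤ n s L h₁ h₂ = ≮⇒≥ λ (h₃ : s + L < n) →
  ≤-absurd 0 (h₁ ⊞ h₂ ⊞ h₃) (ring (n ∷ s ∷ L ∷ []))

twice≤⇒≡0 : ∀ s l → 2 * l ≤ s → s ≤ l → l ≡ 0
twice≤⇒≡0 s l h₁ h₂ = n≤0⇒n≡0 (≮⇒≥ λ (h₃ : 0 < l) → ≤-absurd 0 (h₁ ⊞ h₂ ⊞ h₃) (ring (s ∷ l ∷ [])))

r<n : ∀ n r → 2 ≤ n → 2 * r ≤ suc n → r < n
r<n n r h₁ h₂ = ≰⇒> λ (h₃ : n ≤ r) → ≤-absurd 0 (h₁ ⊞ h₂ ⊞ h₃ ⊞ h₃) (ring (n ∷ r ∷ []))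

triple-total : ∀ n w ρ i → w + suc ρ ≡ n → i + n ≡ 3 * ρ → i + 3 * suc w ≡ 2 * n
triple-total n w ρ i refl e = +-cancelʳ-≡ (w + suc ρ) _ _
  (trans (l i w ρ) (trans (cong (_+ 3 * suc w) e) (m ρ w)))
  where
  l : ∀ i w ρ → i + 3 * suc w + (w + suc ρ) ≡ i + (w + suc ρ) + 3 * suc w
  l i w ρ = ring (i ∷ w ∷ ρ ∷ [])
  m : ∀ ρ w → 3 * ρ + 3 * suc w ≡ 2 * (w + suc ρ) + (w + suc ρ)
  m ρ w = ring (ρ ∷ w ∷ [])

triple-n : ∀ n ρ i → i + n ≡ 3 * ρ → i + 3 ≡ suc ρ → n ≡ 2 * suc ρ
triple-n n ρ i e₁ e₂ = +-cancelʳ-≡ (suc ρ) n _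
  (trans (cong (n +_) (sym e₂)) (trans (l n i) (trans (cong (_+ 3) e₁) (m ρ))))
  where
  l : ∀ n i → n + (i + 3) ≡ i + n + 3
  l n i = ring (n ∷ i ∷ [])
  m : ∀ ρ → 3 * ρ + 3 ≡ 2 * suc ρ + suc ρ
  m ρ = ring (ρ ∷ [])

involutive-total : ∀ n r x h → x + h * 2 ≡ n → n ≡ 2 * r → x + h * 2 * suc r ≡ suc h * n
involutive-total n r x h e₁ e₂ = trans (l x h r) (cong₂ (λ a b → a + h * b) e₁ (sym e₂))
  where
  l : ∀ x h r → x + h * 2 * suc r ≡ (x + h * 2) + h * (2 * r)
  l x h r = ring (x ∷ h ∷ r ∷ [])

half-multiple<2n : ∀ n r k l → k + l ≡ r → 2 * r ≡ suc n → 2 ≤ n → k + l * 2 < n + n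
half-multiple<2n n r k l refl e h₁ = ≰⇒> λ (h : n + n ≤ k + l * 2) →
  ≤-absurd k (h ⊞ h₁ ⊞ ≤-reflexive e) (ring (n ∷ k ∷ l ∷ []))

half-k≡1 : ∀ n r k l → k + l ≡ r → 2 * r ≡ suc n → k + l * 2 ≡ n → k ≡ 1
half-k≡1 n r k l refl e refl = +-cancelʳ-≡ (k + l * 2) k 1 (trans (lemma k l) e)
  where
  lemma : ∀ k l → k + (k + l * 2) ≡ 2 * (k + l)
  lemma k l = ring (k ∷ l ∷ [])

half-double< : ∀ n ρ j → 2 * suc ρ ≡ suc n → j ≤ ρ → j * 2 < n
half-double< n ρ j e h₁ = ≰⇒> λ (h : n ≤ j * 2) →
  ≤-absurd 0 (h ⊞ h₁ ⊞ h₁ ⊞ ≤-reflexive e) (ring (n ∷ ρ ∷ j ∷ []))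

large-part≤w : ∀ w x B m → w + (x + B) + 2 ≤ 2 * (w + suc m) → 2 * m ≤ B → x ≤ w
large-part≤w w x B m h₁ h₂ = ≮⇒≥ λ (h₃ : w < x) →
  ≤-absurd 0 (h₁ ⊞ h₂ ⊞ h₃) (ring (w ∷ x ∷ B ∷ m ∷ []))

mean<2 : ∀ w s l → w + s + 2 ≤ 2 * (w + l) → s < w + 2 * l
mean<2 w s l h₁ = ≰⇒> λ (h₂ : w + 2 * l ≤ s) → ≤-absurd 1 (h₁ ⊞ h₂) (ring (w ∷ s ∷ l ∷ []))

last-part : ∀ n r w x B m q → w + (x + B) ≡ n → w + suc m ≡ r → q + r ≡ n → 2 * m ≤ B → q < x →
    m ≡ 0
last-part n r w x B m q e₁ e₂ e₃ h₁ h₂ = n≤0⇒n≡0 (≮⇒≥ λ (h₃ : 0 < m) →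
  ≤-absurd 0 (h₁ ⊞ h₂ ⊞ h₃ ⊞ ≤-reflexive e₁ ⊞ ≥-from-≡ e₂ ⊞ ≥-from-≡ e₃)
    (ring (n ∷ r ∷ w ∷ x ∷ B ∷ m ∷ q ∷ [])))

cancel-ones : ∀ k w s l → w + s + k ≤ 2 * (w + l) → s + k ≤ w + 2 * l
cancel-ones k w s l h₁ = ≮⇒≥ λ (h₂ : w + 2 * l < s + k) →
  ≤-absurd 0 (h₁ ⊞ h₂) (ring (k ∷ w ∷ s ∷ l ∷ []))

n<2*complement : ∀ n r q → q + r ≡ n → 2 * r < n → n < 2 * q
n<2*complement n r q e h₁ = ≰⇒> λ (h₂ : 2 * q ≤ n) →
  ≤-absurd 0 (h₁ ⊞ h₂ ⊞ ≥-from-≡ e ⊞ ≥-from-≡ e) (ring (n ∷ r ∷ q ∷ []))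

half-complement : ∀ n r q → q + r ≡ n → 2 * r ≡ suc n → suc q ≡ r
half-complement n r q refl e = +-cancelʳ-≡ r (suc q) r (trans (sym e) (lemma r))
  where
  lemma : ∀ r → 2 * r ≡ r + r
  lemma r = ring (r ∷ [])

equal-complement : ∀ n r q → q + r ≡ n → n ≡ 2 * r → q ≡ r
equal-complement n r q refl e = +-cancelʳ-≡ r q r (trans e (lemma r))
  where
  lemma : ∀ r → 2 * r ≡ r + r
  lemma r = ring (r ∷ [])

half-mean : ∀ n r l x s → 2 * r ≡ suc n → suc l ≡ r → x + s < n → 1 ≤ x → s + 1 ≤ 2 * l
half-mean n r l x s e₁ e₂ h₁ h₂ = ≮⇒≥ λ (h₃ : 2 * l < s + 1) →
  ≤-absurd 0 (h₁ ⊞ h₂ ⊞ h₃ ⊞ ≥-from-≡ e₁ ⊞ ≥-from-≡ e₂ ⊞ ≥-from-≡ e₂)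
    (ring (n ∷ r ∷ l ∷ x ∷ s ∷ []))

big-tail : ∀ n r l → suc l ≡ r → 3 + n ≤ 2 * r → n < 2 * l
big-tail n r l refl h₁ = ≰⇒> λ (h₂ : 2 * l ≤ n) → ≤-absurd 0 (h₁ ⊞ h₂) (ring (n ∷ l ∷ []))

complement-nonempty : ∀ n r → 3 ≤ n → 2 * r ≡ 2 + n → r ≢ n
complement-nonempty n .n h₁ e refl = ≤-absurd 0 (h₁ ⊞ ≤-reflexive e) (ring (n ∷ []))

even-or-odd : ∀ y → (∃[ k ] y ≡ k * 2) ⊎ (∃[ k ] y ≡ 1 + k * 2)
even-or-odd zero = inj₁ (0 , refl)
even-or-odd (suc y) with even-or-odd y
... | inj₁ (k , refl) = inj₂ (k , refl)
... | inj₂ (k , refl) = inj₁ (suc k , refl)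

/2-exact : ∀ {m} k → m ≡ 2 * k → m / 2 ≡ k
/2-exact k refl = trans (cong (_/ 2) (*-comm 2 k)) (m*n/n≡m k 2)

+2-exact : ∀ {n} r → n ≡ 2 * r → n + 2 ≡ 2 * suc r
+2-exact r refl = ring (r ∷ [])

+4-exact : ∀ {n} r → n ≡ 2 * r → n + 4 ≡ 2 * (r + 2)
+4-exact r refl = ring (r ∷ [])

odd-% : ∀ {m} h → m ≡ 1 + h * 2 → m % 2 ≡ 1
odd-% h refl = [m+kn]%n≡m%n 1 h 2

even-% : ∀ {m} h → m ≡ h * 2 → m % 2 ≡ 0
even-% h refl = m*n%n≡0 h 2

double-odd-% : ∀ {n} r k → n ≡ 2 * r → r ≡ 1 + k * 2 → n % 4 ≡ 2
double-odd-% r k refl refl = trans (cong (_% 4) (lemma k)) ([m+kn]%n≡m%n 2 k 4)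
  where
  lemma : ∀ k → 2 * (1 + k * 2) ≡ 2 + k * 4
  lemma k = ring (k ∷ [])

*2≢1+*2 : ∀ j k → j * 2 ≢ 1 + k * 2
*2≢1+*2 j k e = even≢odd j k (trans (*-comm 2 j) (trans e (cong suc (*-comm k 2))))

odd-in-even : ∀ x h k → x + (1 + h * 2) ≡ k * 2 → ∃[ j ] x ≡ 1 + j * 2
odd-in-even x h k e with even-or-odd x
... | inj₂ p = p
... | inj₁ (j , refl) = ⊥-elim (*2≢1+*2 k (j + h) (trans (sym e) (lemma j h)))
  where
  lemma : ∀ j h → j * 2 + (1 + h * 2) ≡ 1 + (j + h) * 2
  lemma j h = ring (j ∷ h ∷ [])

odd-in-odd : ∀ x h k → x + (1 + h * 2) ≡ 1 + k * 2 → ∃[ j ] x ≡ j * 2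
odd-in-odd x h k e with even-or-odd x
... | inj₁ p = p
... | inj₂ (j , refl) = ⊥-elim (*2≢1+*2 (1 + j + h) k (trans (lemma j h) e))
  where
  lemma : ∀ j h → (1 + j + h) * 2 ≡ 1 + j * 2 + (1 + h * 2)
  lemma j h = ring (j ∷ h ∷ [])

-- The theorem measures the two blocks by their offset from n/2; this offset is r - y.
blocks : ∀ {n r x y} → n ≡ 2 * r → x + y ≡ n → y ≤ r → n / 2 + (r ∸ y) ≡ x × n / 2 ∸ (r ∸ y) ≡ y
blocks {n} {r} {x} {y} n≡2r e y≤r rewrite /2-exact r n≡2r =
  +-cancelʳ-≡ y _ _ (trans (+-assoc r (r ∸ y) y) (trans (cong (r +_) (m∸n+n≡m y≤r))
    (trans (lemma r) (trans (sym n≡2r) (sym e))))) ,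
  m∸[m∸n]≡n y≤r
  where
  lemma : ∀ r → r + r ≡ 2 * r
  lemma r = ring (r ∷ [])

-- For r = 2k this makes r + 1 its own inverse modulo 2r.
square-one : ∀ k → suc (k * 2) * suc (k * 2) ≡ 1 + suc k * (2 * (k * 2))
square-one k = ring (k ∷ [])

-- For odd r, the inverse c of r + 2 modulo 2r with 2c congruent to r + 1. It is c = (r + 1)/2 when
-- r = 1 + 4j, and c = (r + 1)/2 + r in the companion `halved-odd` with r = 3 + 4j.
halved-even : ∀ j → (1 + j * 2 * 2 + 2) * suc (j * 2) ≡ 1 + suc j * (2 * (1 + j * 2 * 2))
halved-even j = ring (j ∷ [])

halved-odd : ∀ j → (1 + (1 + j * 2) * 2 + 2) * (suc (1 + j * 2) + (1 + (1 + j * 2) * 2)) ≡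
  1 + (3 * j + 4) * (2 * (1 + (1 + j * 2) * 2))
halved-odd j = ring (j ∷ [])

double-even : ∀ j → 2 * suc (j * 2) ≡ suc (1 + j * 2 * 2)
double-even j = ring (j ∷ [])

double-odd : ∀ j → 2 * (suc (1 + j * 2) + (1 + (1 + j * 2) * 2)) ≡ suc (1 + (1 + j * 2) * 2) + 1
    * (2 * (1 + (1 + j * 2) * 2))
double-odd j = ring (j ∷ [])

>half : ∀ {n r x y} → n ≡ 2 * r → x + y ≡ n → r < y → x < r
>half {n} {r} {x} {y} e₁ e₂ h₁ = ≰⇒> λ (h₂ : r ≤ x) →
  ≤-absurd 0 (h₁ ⊞ h₂ ⊞ ≤-reflexive e₂ ⊞ ≤-reflexive e₁) (ring (n ∷ r ∷ x ∷ y ∷ []))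

-- Lets j (r - 1) act as -j on elements killed by r, so that all multipliers stay natural numbers.
cancel-multiple : ∀ j r → 1 ≤ r → j * (r ∸ 1) + j ≡ j * r
cancel-multiple j (suc r) _ = trans (+-comm (j * r) j) (sym (*-suc j r))

regroup : ∀ e j p → e + j * 2 + 2 * (j * p) ≡ e + 2 * (j * p + j)
regroup e j p = ring (e ∷ j ∷ p ∷ [])

odd-predecessor : ∀ n r → suc n ≡ 2 * r → n ≡ 1 + (r ∸ 1) * 2
odd-predecessor n (suc r) e = suc-injective (trans e (lemma r))
  where
  lemma : ∀ r → 2 * suc r ≡ suc (1 + r * 2)
  lemma r = ring (r ∷ [])

open import Data.List.Relation.Binary.Permutation.Propositional as ↭
  using (↭-refl; ↭-sym; ↭-trans; ↭-reflexive; prep)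
  renaming (_↭_ to _↭ˡ_)
open import Data.List.Relation.Binary.Permutation.Propositional.Properties using
  ( All-resp-↭; ∈-resp-↭; ↭-length; ↭-map-inv; map⁺; filter-↭; drop-∷; shift; shifts
  ; ++⁺; ++⁺ˡ; ++⁺ʳ; ++-assoc; ++-comm; ++-commutativeMonoid )
open import Data.List.Relation.Unary.All as All using (All; []; _∷_)
import Data.List.Relation.Unary.All.Properties as All
open import Data.List.Relation.Unary.AllPairs as AllPairs using ([]; _∷_)
import Data.List.Relation.Unary.AllPairs.Properties as AllPairs
open import Data.List.Relation.Unary.Any as Any using (here; there)
open import Data.List.Relation.Unary.Unique.Propositional using (Unique)
import Data.List.Relation.Unary.Unique.Propositional.Properties as Unique
open import Data.Nat.ListAction using (sum)
open import Data.Nat.ListAction.Properties using (sum-++; sum-↭)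
open import Function.Base using (_∘_; case_of_)
open import Level using (0ℓ)
open import Relation.Binary.Definitions using (DecidableEquality; tri<; tri≈; tri>)
open import Relation.Nullary.Decidable using (Dec; yes; no; map′)
open import Relation.Nullary.Negation using (¬_; contradiction)
import Data.List.Relation.Binary.Permutation.Setoid as ↭ᴳ
open import Data.List.Relation.Binary.Pointwise as Pointwise using (Pointwise; []; _∷_)
open import Data.List.Relation.Unary.Unique.DecSetoid.Properties using (deduplicate-!)
open import Data.Nat.Divisibility as ℕ using (m%n≡0⇒n∣m)
open import Function.Bundles using (Inverse)
open import Relation.Binary.Bundles using (DecSetoid)
open import Relation.Unary using (_∈_; _∉_)

-- Lists up to permutation

module _ {a} {A : Set a} where

  extract : ∀ {x : A} {xs} → x ∈ˡ xs → ∃[ ys ] xs ↭ˡ x ∷ ys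
  extract x∈xs with ys , zs , refl ← ∈-∃++ x∈xs = ys ++ zs , shift _ ys zs

  length-⊆ : ∀ {xs ys : List A} → Unique xs → (∀ {x} → x ∈ˡ xs → x ∈ˡ ys) → length xs ≤ length ys
  length-⊆ {[]} [] sub = z≤n
  length-⊆ {x ∷ xs} {ys} (x∉xs ∷ u) sub with as , bs , refl ← ∈-∃++ (sub (here refl)) =
    ≤-trans (s≤s (length-⊆ u sub′)) (≤-reflexive (sym (↭-length (shift x as bs))))
    where
    sub′ : ∀ {y} → y ∈ˡ xs → y ∈ˡ as ++ bs
    sub′ y∈xs with ∈-++⁻ as (sub (there y∈xs))
    ... | inj₁ p = ∈-++⁺ˡ p
    ... | inj₂ (here refl) = ⊥-elim (All.lookup x∉xs y∈xs refl)
    ... | inj₂ (there p) = ∈-++⁺ʳ as p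

  all-equal : ∀ {c : A} {xs} → (∀ {x} → x ∈ˡ xs → x ≡ c) → xs ≡ replicate (length xs) c
  all-equal {xs = []} _ = refl
  all-equal {xs = x ∷ xs} h = cong₂ _∷_ (h (here refl)) (all-equal (h ∘ there))

  two-valued : ∀ {a b : A} xs → (∀ {x} → x ∈ˡ xs → x ≡ a ⊎ x ≡ b) →
               ∃[ k ] ∃[ l ] k + l ≡ length xs × xs ↭ˡ replicate k a ++ replicate l b
  two-valued [] _ = 0 , 0 , refl , ↭-refl
  two-valued {a} {b} (x ∷ xs) h
    with k , l , eq , p ← two-valued xs (λ i → h (there i)) | h (here refl)
  ... | inj₁ refl = suc k , l , cong suc eq , prep a p
  ... | inj₂ refl = k , suc l , trans (+-suc k l) (cong suc eq) ,
                    ↭-trans (prep b p) (↭-sym (shift b (replicate k a) _))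

  constant-or-distinct : DecidableEquality A → ∀ (x : A) xs →
    x ∷ xs ≡ replicate (suc (length xs)) x ⊎
    (∃[ y ] ∃[ ys ] x ≢ y × xs ↭ˡ y ∷ ys)
  constant-or-distinct _≟_ x [] = inj₁ refl
  constant-or-distinct _≟_ x (y ∷ xs) with x ≟ y
  ... | no x≢y = inj₂ (y , xs , x≢y , ↭-refl)
  ... | yes refl with constant-or-distinct _≟_ x xs
  ...   | inj₁ eq = inj₁ (cong (x ∷_) eq)
  ...   | inj₂ (z , zs , x≢z , p) =
    inj₂ (z , x ∷ zs , x≢z , ↭-trans (prep x p) (shift z [ x ] zs))

  replicate-+ : ∀ m n (x : A) → replicate (m + n) x ≡ replicate m x ++ replicate n x
  replicate-+ zero n x = refl
  replicate-+ (suc m) n x = cong (x ∷_) (replicate-+ m n x)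

  replicate-≤ : ∀ {m n} (x : A) → m ≤ n → replicate n x ≡ replicate m x ++ replicate (n ∸ m) x
  replicate-≤ {m} {n} x m≤n =
    trans (cong (λ k → replicate k x) (sym (m+[n∸m]≡n m≤n))) (replicate-+ m (n ∸ m) x)

  module ++-Solver = CommutativeMonoidSolver (++-commutativeMonoid {A = A})

  interchange : ∀ (xs ys zs ws : List A) → (xs ++ ys) ++ (zs ++ ws) ↭ˡ (xs ++ zs) ++ (ys ++ ws)
  interchange = solve′ 4 (λ x y z w → (x ⊕ y) ⊕ (z ⊕ w) ⊜ (x ⊕ z) ⊕ (y ⊕ w)) ↭-refl
    where open ++-Solver renaming (solve to solve′)

-- Partial sums of lists of positive integers

sum-replicate : ∀ k x → sum (replicate k x) ≡ k * x
sum-replicate zero x = refl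
sum-replicate (suc k) x = cong (x +_) (sum-replicate k x)

2*length≤sum : ∀ {xs} → All (2 ≤_) xs → 2 * length xs ≤ sum xs
2*length≤sum [] = z≤n
2*length≤sum {x ∷ xs} (2≤x ∷ h) =
  ≤-trans (≤-reflexive (*-suc 2 (length xs))) (+-mono-≤ 2≤x (2*length≤sum h))

length≤sum : ∀ {xs} → All (1 ≤_) xs → length xs ≤ sum xs
length≤sum [] = z≤n
length≤sum (1≤x ∷ h) = +-mono-≤ 1≤x (length≤sum h)

all-twos : ∀ {xs} → All (2 ≤_) xs → sum xs ≤ 2 * length xs → xs ≡ replicate (length xs) 2
all-twos [] _ = refl
all-twos {x ∷ xs} (2≤x ∷ h) le =
  cong₂ _∷_ (≤-antisym x≤2 2≤x) (all-twos h (+-cancelˡ-≤ 2 _ _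
    (≤-trans (+-monoˡ-≤ (sum xs) 2≤x) (≤-trans le (≤-reflexive (*-suc 2 (length xs)))))))
  where
  x≤2 : x ≤ 2
  x≤2 = +-cancelʳ-≤ (2 * length xs) _ _
    (≤-trans (+-monoʳ-≤ x (2*length≤sum h)) (≤-trans le (≤-reflexive (*-suc 2 (length xs)))))

separate-ones : ∀ {xs} → All (1 ≤_) xs →
  ∃[ w ] ∃[ ys ] All (2 ≤_) ys × xs ↭ˡ replicate w 1 ++ ys
separate-ones [] = 0 , [] , [] , ↭-refl
separate-ones {1 ∷ xs} (_ ∷ h) with w , ys , b , p ← separate-ones h =
  suc w , ys , b , prep 1 p
separate-ones {suc (suc x) ∷ xs} (_ ∷ h) with w , ys , b , p ← separate-ones h =
  w , 2+x ∷ ys , s≤s (s≤s z≤n) ∷ b ,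
  ↭-trans (prep 2+x p) (↭-sym (shift 2+x (replicate w 1) ys))
  where 2+x = suc (suc x)

Covering : List ℕ → Set
Covering xs = ∀ j → j ≤ sum xs → ∃[ ys ] ∃[ zs ] xs ↭ˡ ys ++ zs × sum ys ≡ j

-- With M the old total, the ranges [0, M] and [x, x + M] overlap or abut, so no number is skipped.
covering-∷ : ∀ {x xs} → x ≤ suc (sum xs) → Covering xs → Covering (x ∷ xs)
covering-∷ {x} {xs} x≤ c j j≤ with ≤-<-connex j (sum xs)
... | inj₁ j≤M with ys , zs , p , e ← c j j≤M =
  ys , x ∷ zs , ↭-trans (prep x p) (↭-sym (shift x ys zs)) , e
... | inj₂ M<j with ys , zs , p , e ← c (j ∸ x) (m≤n+o⇒m∸n≤o j x j≤) =
  x ∷ ys , zs , prep x p , trans (cong (x +_) e) (m+[n∸m]≡n (≤-trans x≤ M<j))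

covering-ones : ∀ w → Covering (replicate w 1)
covering-ones zero zero z≤n = [] , [] , ↭-refl , refl
covering-ones (suc w) = covering-∷ (s≤s z≤n) (covering-ones w)

covering-resp-↭ : ∀ {xs ys} → sum xs ≡ sum ys → xs ↭ˡ ys → Covering xs → Covering ys
covering-resp-↭ eq p c j j≤ with as , bs , q , e ← c j (≤-trans j≤ (≤-reflexive (sym eq))) =
  as , bs , ↭-trans (↭-sym p) q , e

-- The ones go in first: every later entry then meets a total of at least w, whatever the order of
-- the entries.
covering-ones++ : ∀ {w ys} → All (_≤ suc w) ys → Covering (replicate w 1 ++ ys)
covering-ones++ {w} {ys} h =
  covering-resp-↭ (trans (sum-++ ys (replicate w 1)) (trans (+-comm (sum ys) _)
      (sym (sum-++ (replicate w 1) ys))))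
    (++-comm ys (replicate w 1)) (go h)
  where
  go : ∀ {ys} → All (_≤ suc w) ys → Covering (ys ++ replicate w 1)
  go [] = covering-ones w
  go {y ∷ ys} (y≤ ∷ h) = covering-∷ (≤-trans y≤ (s≤s (≤-trans
    (≤-reflexive (sym (trans (sum-replicate w 1) (*-identityʳ w))))
    (≤-trans (m≤n+m _ (sum ys)) (≤-reflexive (sym (sum-++ ys _))))))) (go h)

-- With mean value below 2, the parts exceeding 2 are paid for by ones.
parts≤ : ∀ {w ys} → All (2 ≤_) ys → sum ys < w + 2 * length ys → All (_≤ suc w) ys
parts≤ [] _ = []
parts≤ {w} {y ∷ ys} (2≤y ∷ h) lt =
  ≮⇒≥ (part-bound w y (length ys) (sum ys) (2*length≤sum h) lt) ∷
  parts≤ h (≰⇒> λ le → rest-bound w y (length ys) (sum ys) le lt 2≤y)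

singleton∋sum : ∀ ys {s} → length ys ≡ 1 → sum ys ≡ s → s ∈ˡ ys
singleton∋sum (y ∷ []) _ refl = here (+-identityʳ y)

-- Subset sums and zero-sum free sequences

module FiniteGroup {n : ℕ} {op : Fin n → Fin n → Fin n} {0# : Fin n} {inv : Fin n → Fin n}
                   (isAbelianGroup : IsAbelianGroup _≡_ op 0# inv) where

  H : AbelianGroup 0ℓ 0ℓ
  H = record { isAbelianGroup = isAbelianGroup }

  open AbelianGroup H using (commutativeMonoid)
    renaming (_∙_ to infixl 6 _⊕_; ε to 𝟘; _⁻¹ to ⊖_; assoc to ⊕-assoc; comm to ⊕-comm; identityˡ
        to ⊕-identityˡ; identityʳ to ⊕-identityʳ; inverseʳ to ⊕-inverseʳ) public
  open GroupNotions H using (_·_) public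
  open Mult commutativeMonoid using () renaming
    (×-homo-+ to ·-homo-+; ×-homo-1 to ·-homo-1; ×-assocˡ to ·-assocˡ; ×-distrib-+ to ·-distrib-⊕)
        public
  open GroupProperties (AbelianGroup.group H) using ()
    renaming (∙-cancelˡ to ⊕-cancelˡ; ∙-cancelʳ to ⊕-cancelʳ) public
  module ⊕-Solver = CommutativeMonoidSolver commutativeMonoid

  A : Set
  A = Fin n

  ·-𝟘 : ∀ k → k · 𝟘 ≡ 𝟘
  ·-𝟘 zero = refl
  ·-𝟘 (suc k) = trans (⊕-identityˡ _) (·-𝟘 k)

  σ : List A → A
  σ = foldr _⊕_ 𝟘

  σ-++ : ∀ xs ys → σ (xs ++ ys) ≡ σ xs ⊕ σ ys
  σ-++ [] ys = sym (⊕-identityˡ _)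
  σ-++ (x ∷ xs) ys = trans (cong (x ⊕_) (σ-++ xs ys)) (sym (⊕-assoc x _ _))

  σ-↭ : ∀ {xs ys} → xs ↭ˡ ys → σ xs ≡ σ ys
  σ-↭ ↭.refl = refl
  σ-↭ (↭.prep x p) = cong (x ⊕_) (σ-↭ p)
  σ-↭ (↭.swap {xs} {ys} x y p) = trans (cong (λ z → x ⊕ (y ⊕ z)) (σ-↭ p))
    (solve 3 (λ x y z → x ⊙ (y ⊙ z) ⊜ y ⊙ (x ⊙ z)) refl x y (σ ys))
    where open ⊕-Solver renaming (_⊕_ to _⊙_)
  σ-↭ (↭.trans p q) = trans (σ-↭ p) (σ-↭ q)

  σ-split : ∀ {xs ys zs} → xs ↭ˡ ys ++ zs → σ xs ≡ σ ys ⊕ σ zs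
  σ-split {ys = ys} {zs} p = trans (σ-↭ p) (σ-++ ys zs)

  σ-multiples : ∀ g xs → σ (map (_· g) xs) ≡ sum xs · g
  σ-multiples g [] = refl
  σ-multiples g (x ∷ xs) = trans (cong (x · g ⊕_) (σ-multiples g xs)) (sym (·-homo-+ g x (sum xs)))

  σ-replicate : ∀ k c → σ (replicate k c) ≡ k · c
  σ-replicate zero c = refl
  σ-replicate (suc k) c = cong (c ⊕_) (σ-replicate k c)

  Subsum : List A → A → Set
  Subsum γ x = ∃[ T ] ∃[ R ] γ ↭ˡ T ++ R × σ T ≡ x

  subsum-[] : ∀ γ → Subsum γ 𝟘
  subsum-[] γ = [] , γ , ↭-refl , refl

  subsum-skip : ∀ {c γ x} → Subsum γ x → Subsum (c ∷ γ) x
  subsum-skip {c} (T , R , p , e) = T , c ∷ R , ↭-trans (prep c p) (↭-sym (shift c T R)) , e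

  subsum-take : ∀ {c γ x} → Subsum γ x → Subsum (c ∷ γ) (c ⊕ x)
  subsum-take {c} (T , R , p , e) = c ∷ T , R , prep c p , cong (c ⊕_) e

  subsum-resp-↭ : ∀ {γ δ x} → γ ↭ˡ δ → Subsum γ x → Subsum δ x
  subsum-resp-↭ q (T , R , p , e) = T , R , ↭-trans (↭-sym q) p , e

  subsum-total : ∀ γ → Subsum γ (σ γ)
  subsum-total γ = γ , [] , ↭-reflexive (sym (++-identityʳ γ)) , refl

  subsum-complement : ∀ {γ x} → Subsum γ x → ∃[ y ] Subsum γ y × x ⊕ y ≡ σ γ
  subsum-complement (T , R , p , refl) =
    σ R , (R , T , ↭-trans p (++-comm T R) , refl) , sym (σ-split {ys = T} {R} p)

  -- An enumeration with repetitions, used to decide `Subsum` and to split it on the first term.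
  -- Cardinalities are taken from `subsumSet`, where each value occurs once.
  subsums : List A → List A
  subsums [] = [ 𝟘 ]
  subsums (c ∷ γ) = subsums γ ++ map (c ⊕_) (subsums γ)

  ∈-subsums⁻ : ∀ γ {x} → x ∈ˡ subsums γ → Subsum γ x
  ∈-subsums⁻ [] (here refl) = subsum-[] []
  ∈-subsums⁻ (c ∷ γ) x∈ with ∈-++⁻ (subsums γ) x∈
  ... | inj₁ p = subsum-skip (∈-subsums⁻ γ p)
  ... | inj₂ p with y , y∈ , refl ← ∈-map⁻ (c ⊕_) p = subsum-take (∈-subsums⁻ γ y∈)

  ∈-subsums⁺ : ∀ γ {x} → Subsum γ x → x ∈ˡ subsums γ
  ∈-subsums⁺ [] ([] , R , p , refl) = here refl
  ∈-subsums⁺ [] (_ ∷ _ , R , p , e) with () ← ↭-length p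
  ∈-subsums⁺ (c ∷ γ) (T , R , p , e) with ∈-++⁻ T (∈-resp-↭ p (here refl))
  ... | inj₁ c∈T with T₁ , T₂ , refl ← ∈-∃++ c∈T =
    ∈-++⁺ʳ (subsums γ) (subst (_∈ˡ map (c ⊕_) (subsums γ)) (trans (sym (σ-↭ (shift c T₁ T₂))) e)
      (∈-map⁺ (c ⊕_) (∈-subsums⁺ γ (T₁ ++ T₂ , R , drop-∷ (↭-trans p (++⁺ʳ R (shift c T₁ T₂))) ,
          refl))))
  ... | inj₂ c∈R with R₁ , R₂ , refl ← ∈-∃++ c∈R =
    ∈-++⁺ˡ (∈-subsums⁺ γ (T , R₁ ++ R₂ ,
      drop-∷ (↭-trans p (↭-trans (++⁺ˡ T (shift c R₁ R₂)) (shift c T (R₁ ++ R₂)))) , e))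

  open DecMembership (Fin._≟_ {n}) using (_∈?_) public

  subsum? : ∀ γ x → Dec (Subsum γ x)
  subsum? γ x = map′ (∈-subsums⁻ γ) (∈-subsums⁺ γ) (x ∈? subsums γ)

  subsumSet : List A → List A
  subsumSet γ = filter (subsum? γ) (allFin n)

  -- |Σ(γ) ∪ {0}| in the usual notation
  card : List A → ℕ
  card γ = length (subsumSet γ)

  subsumSet-unique : ∀ γ → Unique (subsumSet γ)
  subsumSet-unique γ = Unique.filter⁺ (subsum? γ) (Unique.allFin⁺ n)

  ∈-subsumSet⁺ : ∀ {γ x} → Subsum γ x → x ∈ˡ subsumSet γ
  ∈-subsumSet⁺ {γ} = ∈-filter⁺ (subsum? γ) (∈-allFin _)

  ∈-subsumSet⁻ : ∀ {γ x} → x ∈ˡ subsumSet γ → Subsum γ x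
  ∈-subsumSet⁻ {γ} x∈ = proj₂ (∈-filter⁻ (subsum? γ) {xs = allFin n} x∈)

  unique-length≤card : ∀ {γ xs} → Unique xs → (∀ {x} → x ∈ˡ xs → Subsum γ x) → length xs ≤ card γ
  unique-length≤card u h = length-⊆ u (∈-subsumSet⁺ ∘ h)

  unique-length≤n : ∀ {xs : List A} → Unique xs → length xs ≤ n
  unique-length≤n {xs} u = subst (length xs ≤_) (length-tabulate {n = n} (λ i → i))
      (length-⊆ u (λ _ → ∈-allFin _))

  card≤n : ∀ γ → card γ ≤ n
  card≤n γ = unique-length≤n (subsumSet-unique γ)

  missing : ∀ {γ x} → ¬ Subsum γ x → card γ < n
  missing {γ} {x} ∉ = unique-length≤n
    (All.tabulate (λ { y∈ refl → ∉ (∈-subsumSet⁻ y∈) }) ∷ subsumSet-unique γ)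

  card-resp-↭ : ∀ {γ δ} → γ ↭ˡ δ → card γ ≤ card δ
  card-resp-↭ {γ} p = unique-length≤card (subsumSet-unique γ) (subsum-resp-↭ p ∘ ∈-subsumSet⁻)

  ZeroFree : List A → Set
  ZeroFree γ = ∀ T R → γ ↭ˡ T ++ R → σ T ≡ 𝟘 → T ≡ []

  zeroFree-resp-↭ : ∀ {γ δ} → γ ↭ˡ δ → ZeroFree γ → ZeroFree δ
  zeroFree-resp-↭ p zf T R q = zf T R (↭-trans p q)

  zeroFree-tail : ∀ {c γ} → ZeroFree (c ∷ γ) → ZeroFree γ
  zeroFree-tail {c} zf T R p = zf T (c ∷ R) (↭-trans (prep c p) (↭-sym (shift c T R)))

  zeroFree-∷ : ∀ {c γ x} → ZeroFree (c ∷ γ) → Subsum γ x → c ⊕ x ≢ 𝟘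
  zeroFree-∷ {c} zf (T , R , p , refl) e with () ← zf (c ∷ T) R (prep c p) e

  -- If some T inside γ had the sum of c γ, the terms of γ outside T would add up to -c.
  σ∉tail : ∀ {c γ} → ZeroFree (c ∷ γ) → ¬ Subsum γ (σ (c ∷ γ))
  σ∉tail {c} {γ} zf s with y , sy , e ← subsum-complement s =
    zeroFree-∷ zf sy (⊕-cancelʳ (σ γ) _ _ (trans
      (solve 3 (λ c y s → (c ⊙ y) ⊙ s ⊜ (c ⊙ s) ⊙ y) refl c y (σ γ))
      (trans e (sym (⊕-identityˡ _)))))
    where open ⊕-Solver renaming (_⊕_ to _⊙_)

  -- The total is always a new subset sum by `σ∉tail`; when c brings at most one new one, every
  -- other subset sum is old.
  subsum-drop : ∀ {c γ x} → ZeroFree (c ∷ γ) → card (c ∷ γ) < 2 + card γ →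
                Subsum (c ∷ γ) x → x ≢ σ (c ∷ γ) → Subsum γ x
  subsum-drop {c} {γ} {x} zf lt s x≢σ with subsum? γ x
  ... | yes p = p
  ... | no x∉ = ⊥-elim (<⇒≱ lt (unique-length≤card
    ((x≢σ ∷ All.tabulate (λ { y∈ refl → x∉ (∈-subsumSet⁻ y∈) })) ∷
     All.tabulate (λ { y∈ refl → σ∉tail zf (∈-subsumSet⁻ y∈) }) ∷ subsumSet-unique γ)
    λ { (here refl) → s
      ; (there (here refl)) → subsum-total (c ∷ γ)
      ; (there (there y∈)) → subsum-skip (∈-subsumSet⁻ y∈) }))

  private
    -- Adding the distinct terms a and b to δ, where the last one added (whichever it
    -- is) produces a single new subset sum, necessarily the total: the subset sums
    -- other than the total are then those of both a ∷ δ and b ∷ δ.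
    module OneNewSum {a b : A} {δ : List A} (zf : ZeroFree (a ∷ b ∷ δ))
                     (one-b : card (b ∷ a ∷ δ) < 2 + card (a ∷ δ)) where

      transfer : ∀ {z} → Subsum (b ∷ δ) z → Subsum (a ∷ δ) z
      transfer s = subsum-drop (zeroFree-resp-↭ ab zf) one-b
        (subsum-resp-↭ ab (subsum-skip s))
        λ { refl → σ∉tail zf (subst (Subsum (b ∷ δ)) (sym (σ-↭ ab)) s) }
        where
        ab : a ∷ b ∷ δ ↭ˡ b ∷ a ∷ δ
        ab = ↭.swap a b ↭-refl

      -- z ↦ z + (a − b), the composite of the reflections x ↦ σ(δ) + b − x and
      -- x ↦ σ(δ) + a − x
      translate : ∀ {z} → Subsum (b ∷ δ) z → ∃[ u ] Subsum (a ∷ δ) u × u ⊕ b ≡ z ⊕ a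
      translate {z} s
        with w , sw , e₁ ← subsum-complement s
        with u , su , e₂ ← subsum-complement (transfer sw) =
        u , su , ⊕-cancelʳ w _ _ (begin
          (u ⊕ b) ⊕ w   ≡⟨ solve 3 (λ u b w → (u ⊙ b) ⊙ w ⊜ (w ⊙ u) ⊙ b) refl u b w ⟩
          (w ⊕ u) ⊕ b   ≡⟨ cong (_⊕ b) e₂ ⟩
          (a ⊕ σ δ) ⊕ b ≡⟨ solve 3 (λ a s b → (a ⊙ s) ⊙ b ⊜ (b ⊙ s) ⊙ a) refl a (σ δ) b ⟩
          (b ⊕ σ δ) ⊕ a ≡⟨ cong (_⊕ a) e₁ ⟨
          (z ⊕ w) ⊕ a   ≡⟨ solve 3 (λ z w a → (z ⊙ w) ⊙ a ⊜ (z ⊙ a) ⊙ w) refl z w a ⟩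
          (z ⊕ a) ⊕ w   ∎)
        where
        open ≡-Reasoning
        open ⊕-Solver renaming (_⊕_ to _⊙_)

    -- The subset sums of a δ and of b δ coincide and are closed under translation by a - b in both
    -- directions. Translating σ(b δ) by b - a and adding a gives σ(b δ) + b, which differs from the
    -- total because a ≠ b and so is not new. Translating back by a - b gives the total, which is
    -- new.
    distinct-absurd : ∀ {a b δ} → a ≢ b → ZeroFree (a ∷ b ∷ δ) →
      card (a ∷ b ∷ δ) < 2 + card (b ∷ δ) → card (b ∷ a ∷ δ) < 2 + card (a ∷ δ) → ⊥
    distinct-absurd {a} {b} {δ} a≢b zf one-a one-b =
      let z₁ , s₁ , e₁ = BA.translate (AB.transfer (subsum-total (b ∷ δ)))
          u , su , e₂ = AB.translate (subsum-drop zf one-a (subsum-take s₁) λ e →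
            a≢b (⊕-cancelʳ (σ (b ∷ δ)) a b (trans (sym e) (trans (⊕-comm a z₁)
                (trans e₁ (⊕-comm _ b))))))
      in σ∉tail zf (subst (Subsum (b ∷ δ)) (⊕-cancelʳ b _ _ (begin
        u ⊕ b                 ≡⟨ e₂ ⟩
        (a ⊕ z₁) ⊕ a          ≡⟨ cong (_⊕ a) (trans (⊕-comm a z₁) e₁) ⟩
        (σ (b ∷ δ) ⊕ b) ⊕ a   ≡⟨ solve 3 (λ s b a → (s ⊙ b) ⊙ a ⊜ (a ⊙ s) ⊙ b) refl (σ (b ∷ δ)) b
            a ⟩
        (a ⊕ σ (b ∷ δ)) ⊕ b   ∎)) (BA.transfer su))
      where
      open ≡-Reasoning
      open ⊕-Solver renaming (_⊕_ to _⊙_)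
      module AB = OneNewSum zf one-b
      module BA = OneNewSum (zeroFree-resp-↭ (↭.swap a b ↭-refl) zf) one-a

  card-drop : ∀ {a b δ} → a ≢ b → ZeroFree (a ∷ b ∷ δ) →
              2 + card (b ∷ δ) ≤ card (a ∷ b ∷ δ) ⊎ 2 + card (a ∷ δ) ≤ card (b ∷ a ∷ δ)
  card-drop {a} {b} {δ} a≢b zf
    with ≤-<-connex (2 + card (b ∷ δ)) (card (a ∷ b ∷ δ)) | ≤-<-connex (2 + card (a ∷ δ))
        (card (b ∷ a ∷ δ))
  ... | inj₁ p | _ = inj₁ p
  ... | inj₂ _ | inj₁ p = inj₂ p
  ... | inj₂ one-a | inj₂ one-b = ⊥-elim (distinct-absurd a≢b zf one-a one-b)

  -- Distinct multiples of one element, and zero-sum free sequences with few subset sums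

  TorsionFreeTo : A → ℕ → Set
  TorsionFreeTo g L = ∀ j → 1 ≤ j → j ≤ L → j · g ≢ 𝟘

  torsionFree-≤ : ∀ {g L M} → M ≤ L → TorsionFreeTo g L → TorsionFreeTo g M
  torsionFree-≤ M≤L tf j 1≤j j≤M = tf j 1≤j (≤-trans j≤M M≤L)

  ·-difference : ∀ {g i j} x y → i ≤ j → x ⊕ i · g ≡ y ⊕ j · g → x ≡ y ⊕ (j ∸ i) · g
  ·-difference {g} {i} {j} x y i≤j e = ⊕-cancelʳ (i · g) _ _ (begin
    x ⊕ i · g                  ≡⟨ e ⟩
    y ⊕ j · g                  ≡⟨ cong (λ k → y ⊕ k · g) (m∸n+n≡m i≤j) ⟨
    y ⊕ (j ∸ i + i) · g        ≡⟨ cong (y ⊕_) (·-homo-+ g (j ∸ i) i) ⟩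
    y ⊕ ((j ∸ i) · g ⊕ i · g)  ≡⟨ ⊕-assoc y _ _ ⟨
    y ⊕ (j ∸ i) · g ⊕ i · g    ∎)
    where open ≡-Reasoning

  multiples : A → ℕ → List A
  multiples g L = applyUpTo (_· g) (suc L)

  multiples-unique : ∀ {g L} → TorsionFreeTo g L → Unique (multiples g L)
  multiples-unique {g} {L} tf = Unique.applyUpTo⁺₁ (_· g) (suc L) λ {i} {j} i<j j≤L e →
    tf (j ∸ i) (m<n⇒0<n∸m i<j) (≤-trans (m∸n≤m j i) (s≤s⁻¹ j≤L))
      (sym (trans (·-difference 𝟘 𝟘 (<⇒≤ i<j) (cong (𝟘 ⊕_) e)) (⊕-identityˡ _)))

  torsionFree-<n : ∀ {g L} → TorsionFreeTo g L → L < n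
  torsionFree-<n {g} {L} tf = subst (_≤ n) (length-applyUpTo (_· g) (suc L)) (unique-length≤n
      (multiples-unique tf))

  ∈-multiples⁻ : ∀ {g L x} → x ∈ˡ multiples g L → ∃[ j ] j ≤ L × x ≡ j · g
  ∈-multiples⁻ {g} x∈ with j , j< , e ← ∈-applyUpTo⁻ (_· g) x∈ = j , s≤s⁻¹ j< , e

  -- One half of a dichotomy: either x is a difference of two elements of the progression 0, g, ...,
  -- L g, or the progression and its translate by x provide 2 (L + 1) different elements. Both
  -- `behaving-∷` and `generates` exclude the latter by counting.
  multiples-disjoint : ∀ {L g} x → TorsionFreeTo g L →
    ¬ (∃[ i ] ∃[ j ] i ≤ L × j ≤ L × i · g ≡ x ⊕ j · g) →
    Unique (multiples g L ++ map (x ⊕_) (multiples g L))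
  multiples-disjoint {L = L} {g} x tf none = Unique.++⁺ (multiples-unique tf)
    (Unique.map⁺ (⊕-cancelˡ x _ _) (multiples-unique tf))
    λ (p , q) → let i , i≤L , e₁ = ∈-multiples⁻ p
                    y , y∈ , e₂ = ∈-map⁻ (x ⊕_) q
                    j , j≤L , e₃ = ∈-multiples⁻ y∈
                in none (i , j , i≤L , j≤L , trans (sym e₁) (trans e₂ (cong (x ⊕_) e₃)))

  length-translates : ∀ g L x → length (multiples g L ++ map (x ⊕_) (multiples g L)) ≡ suc L + suc L
  length-translates g L x = trans (length-++ (multiples g L))
    (cong₂ _+_ (length-applyUpTo (_· g) (suc L))
      (trans (length-map (x ⊕_) (multiples g L)) (length-applyUpTo (_· g) (suc L))))

  collision? : ∀ g L x → Dec (∃[ i ] ∃[ j ] i ≤ L × j ≤ L × i · g ≡ x ⊕ j · g)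
  collision? g L x = map′
    (λ p → let y , y∈ , q = find p
               i , i≤L , e₁ = ∈-multiples⁻ y∈
               z , z∈ , e₂ = ∈-map⁻ (x ⊕_) q
               j , j≤L , e₃ = ∈-multiples⁻ z∈
           in i , j , i≤L , j≤L , trans (sym e₁) (trans e₂ (cong (x ⊕_) e₃)))
    (λ (i , j , i≤L , j≤L , e) → lose (∈-applyUpTo⁺ (_· g) (s≤s i≤L))
      (subst (_∈ˡ map (x ⊕_) (multiples g L)) (sym e) (∈-map⁺ (x ⊕_) (∈-applyUpTo⁺ (_· g)
          (s≤s j≤L)))))
    (Any.any? (_∈? map (x ⊕_) (multiples g L)) (multiples g L))

  -- Savchev and Chen call the coefficient list `xs` behaving when it satisfies `covering`. The
  -- field `torsionFree` says that the coefficient sum is below ord(g), so the partial sums give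
  -- distinct elements of G.
  record Behaving (γ : List A) : Set where
    constructor behaving
    field
      g : A
      xs : List ℕ
      γ↭ : γ ↭ˡ map (_· g) xs
      positive : All (1 ≤_) xs
      torsionFree : TorsionFreeTo g (sum xs)
      covering : Covering xs

    length≡ : length γ ≡ length xs
    length≡ = trans (↭-length γ↭) (length-map (_· g) xs)

    multiple-subsum : ∀ j → j ≤ sum xs → Subsum γ (j · g)
    multiple-subsum j j≤ with ys , zs , p , refl ← covering j j≤ =
      map (_· g) ys , map (_· g) zs ,
      ↭-trans γ↭ (↭-trans (map⁺ (_· g) p) (↭-reflexive (map-++ (_· g) ys zs))) ,
      σ-multiples g ys

    sum<card : sum xs < card γ
    sum<card = subst (_≤ card γ) (length-applyUpTo (_· g) (suc (sum xs)))
      (unique-length≤card (multiples-unique torsionFree)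
        λ x∈ → let j , j≤ , e = ∈-multiples⁻ x∈ in subst (Subsum γ) (sym e) (multiple-subsum j j≤))

  behaving-resp-↭ : ∀ {γ δ} → γ ↭ˡ δ → Behaving γ → Behaving δ
  behaving-resp-↭ p (behaving g xs q pos tf cov) = behaving g xs (↭-trans (↭-sym p) q) pos tf cov

  zeroFree-torsionFree : ∀ {c} k → ZeroFree (replicate k c) → TorsionFreeTo c k
  zeroFree-torsionFree {c} k zf (suc j) _ j≤k e
    with () ← zf (replicate (suc j) c) (replicate (k ∸ suc j) c)
                 (↭-reflexive (replicate-≤ c j≤k)) (trans (σ-replicate (suc j) c) e)

  behaving-replicate : ∀ c k → ZeroFree (replicate k c) → Behaving (replicate k c)
  behaving-replicate c k zf = behaving c (replicate k 1)
    (↭-reflexive (trans (cong (replicate k) (sym (·-homo-1 c))) (sym (map-replicate (_· c) k 1))))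
    (All.replicate⁺ k (s≤s z≤n))
    (torsionFree-≤ (≤-reflexive (trans (sum-replicate k 1) (*-identityʳ k))) (zeroFree-torsionFree
        k zf))
    (covering-ones k)

  -- If the progression of multiples of g missed its translate by c, there would be at least 2 (|γ|
  -- + 1) subset sums. So i g = c + j g for some i and j; i ≤ j would complete c to a zero-sum
  -- sequence, hence c = (i - j) g with a positive coefficient. The same obstruction keeps the
  -- enlarged coefficient sum below ord(g): k g = 0 beyond the old sum would say that c plus a
  -- subset sum of γ vanishes.
  behaving-∷ : ∀ {c γ} → ZeroFree (c ∷ γ) → card (c ∷ γ) < 2 * suc (length γ) →
               Behaving γ → Behaving (c ∷ γ)
  behaving-∷ {c} {γ} zf small B with collision? g (sum xs) c
    where open Behaving B
  ... | no none = ⊥-elim (<⇒≱ small (begin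
      2 * suc (length γ)     ≤⟨ *-monoʳ-≤ 2 (s≤s (subst (_≤ sum xs) (sym length≡)
          (length≤sum positive))) ⟩
      2 * suc (sum xs)       ≡⟨ cong (suc (sum xs) +_) (+-identityʳ (suc (sum xs))) ⟩
      suc (sum xs) + suc (sum xs) ≡⟨ length-translates g (sum xs) c ⟨
      length (multiples g (sum xs) ++ map (c ⊕_) (multiples g (sum xs)))
        ≤⟨ unique-length≤card (multiples-disjoint c torsionFree none) sub ⟩
      card (c ∷ γ)           ∎))
    where
    open Behaving B
    open ≤-Reasoning
    multiple : ∀ {x} → x ∈ˡ multiples g (sum xs) → Subsum γ x
    multiple x∈ = let j , j≤ , e = ∈-multiples⁻ x∈ in subst (Subsum γ) (sym e) (multiple-subsum j
                        j≤)
    sub : ∀ {x} → x ∈ˡ multiples g (sum xs) ++ map (c ⊕_) (multiples g (sum xs)) → Subsum (c ∷ γ) x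
    sub x∈ with ∈-++⁻ (multiples g (sum xs)) x∈
    ... | inj₁ p = subsum-skip (multiple p)
    ... | inj₂ p with y , y∈ , refl ← ∈-map⁻ (c ⊕_) p = subsum-take (multiple y∈)
  ... | yes (i , j , i≤M , j≤M , e) with ≤-<-connex i j
  ...   | inj₁ i≤j = ⊥-elim (zeroFree-∷ zf (multiple-subsum (j ∸ i) (≤-trans (m∸n≤m j i) j≤M))
                       (sym (·-difference 𝟘 c i≤j (trans (⊕-identityˡ _) e))))
    where open Behaving B
  ...   | inj₂ j<i = behaving g (y ∷ xs)
          (subst (λ z → c ∷ γ ↭ˡ z ∷ map (_· g) xs) c≡ (prep c γ↭))
          (1≤y ∷ positive) torsionFree′ (covering-∷ (m≤n⇒m≤1+n y≤M) covering)
    where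
    open Behaving B
    y = i ∸ j
    1≤y : 1 ≤ y
    1≤y = m<n⇒0<n∸m j<i
    y≤M : y ≤ sum xs
    y≤M = ≤-trans (m∸n≤m i j) i≤M
    c≡ : c ≡ y · g
    c≡ = trans (·-difference c 𝟘 (<⇒≤ j<i) (trans (sym e) (sym (⊕-identityˡ _)))) (⊕-identityˡ _)
    torsionFree′ : TorsionFreeTo g (y + sum xs)
    torsionFree′ k 1≤k k≤ k·g≡𝟘 with ≤-<-connex k (sum xs)
    ... | inj₁ k≤M = torsionFree k 1≤k k≤M k·g≡𝟘
    ... | inj₂ M<k = zeroFree-∷ zf (multiple-subsum (k ∸ y) (m≤n+o⇒m∸n≤o k y k≤)) (begin
        c ⊕ (k ∸ y) · g      ≡⟨ cong (_⊕ (k ∸ y) · g) c≡ ⟩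
        y · g ⊕ (k ∸ y) · g  ≡⟨ ·-homo-+ g y (k ∸ y) ⟨
        (y + (k ∸ y)) · g    ≡⟨ cong (_· g) (m+[n∸m]≡n (≤-trans y≤M (<⇒≤ M<k))) ⟩
        k · g                ≡⟨ k·g≡𝟘 ⟩
        𝟘                    ∎)
      where open ≡-Reasoning

  -- A form of the Savchev–Chen structure theorem.
  structure : ∀ γ → ZeroFree γ → card γ < 2 * length γ → Behaving γ
  structure γ = go (length γ) γ refl
    where
    -- Two subset sums are lost for one term, so the bound card < 2 · length survives the induction.
    drop₁ : ∀ {c l} l′ → 2 + c ≤ l → l < 2 * suc l′ → c < 2 * l′
    drop₁ {c} {l} l′ h₁ h₂ = +-cancelˡ-≤ 2 _ _
      (≤-trans (s≤s h₁) (≤-trans h₂ (≤-reflexive (*-suc 2 l′))))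

    go : ∀ k γ → length γ ≡ k → ZeroFree γ → card γ < 2 * length γ → Behaving γ
    remove : ∀ {k γ d δ} → length γ ≡ suc k → ZeroFree γ → card γ < 2 * length γ →
             γ ↭ˡ d ∷ δ → 2 + card δ ≤ card (d ∷ δ) → Behaving γ
    remove {k} {γ} {d} {δ} eq zf small p drop = behaving-resp-↭ (↭-sym p)
      (behaving-∷ zf′ small′
        (go k δ (suc-injective (trans (sym (↭-length p)) eq)) (zeroFree-tail zf′) (drop₁ (length δ)
            drop small′)))
      where
      zf′ = zeroFree-resp-↭ p zf
      small′ : card (d ∷ δ) < 2 * suc (length δ)
      small′ = ≤-trans (s≤s (card-resp-↭ (↭-sym p))) (subst (λ l → card γ < 2 * l) (↭-length p)
          small)

    go _ [] _ _ ()
    go (suc k) (c ∷ γ) eq zf small with constant-or-distinct Fin._≟_ c γ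
    ... | inj₁ const = subst Behaving (sym const)
            (behaving-replicate c (suc (length γ)) (subst ZeroFree const zf))
    ... | inj₂ (b , δ , c≢b , p) with card-drop c≢b (zeroFree-resp-↭ (prep c p) zf)
    ...   | inj₁ d = remove eq zf small (prep c p) d
    ...   | inj₂ d = remove eq zf small (↭-trans (prep c p) (↭.swap c b ↭-refl)) d

  -- Orders and generators

  multiple-≡𝟘 : ∀ {g m} q → m · g ≡ 𝟘 → (q * m) · g ≡ 𝟘
  multiple-≡𝟘 {g} {m} q e = trans (sym (·-assocˡ g q m)) (trans (cong (q ·_) e) (·-𝟘 q))

  ·-+-≡𝟘 : ∀ {g j} i → j · g ≡ 𝟘 → (i + j) · g ≡ i · g
  ·-+-≡𝟘 {g} {j} i e = trans (·-homo-+ g i j) (trans (cong (i · g ⊕_) e) (⊕-identityʳ _))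

  ·-% : ∀ {g m} k → suc m · g ≡ 𝟘 → k · g ≡ (k % suc m) · g
  ·-% {g} {m} k e = trans (cong (_· g) (m≡m%n+[m/n]*n k (suc m)))
    (·-+-≡𝟘 (k % suc m) (multiple-≡𝟘 (k / suc m) e))

  order-≥n : ∀ {g m} → suc m · g ≡ 𝟘 → (∀ x → ∃[ k ] x ≡ k · g) → n ≤ suc m
  order-≥n {g} {m} e all = begin
    n                          ≡⟨ length-tabulate {n = n} (λ i → i) ⟨
    length (allFin n)          ≤⟨ length-⊆ (Unique.allFin⁺ n) (λ {x} _ → sub x) ⟩
    length (multiples g m)     ≡⟨ length-applyUpTo (_· g) (suc m) ⟩
    suc m                      ∎
    where
    open ≤-Reasoning
    sub : ∀ x → x ∈ˡ multiples g m
    sub x with k , refl ← all x =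
      subst (_∈ˡ multiples g m) (sym (·-% k e)) (∈-applyUpTo⁺ (_· g) (m%n<n k (suc m)))

  first-multiple-𝟘 : ∀ g k → TorsionFreeTo g k ⊎
                     (∃[ m ] suc m ≤ k × suc m · g ≡ 𝟘 × TorsionFreeTo g m)
  first-multiple-𝟘 g zero = inj₁ λ { _ 1≤j j≤0 _ → <⇒≱ 1≤j j≤0 }
  first-multiple-𝟘 g (suc k) with first-multiple-𝟘 g k
  ... | inj₂ (m , m< , e , tf) = inj₂ (m , m≤n⇒m≤1+n m< , e , tf)
  ... | inj₁ tf with suc k · g Fin.≟ 𝟘
  ...   | yes e = inj₂ (k , ≤-refl , e , tf)
  ...   | no ≢𝟘 = inj₁ tf′
    where
    tf′ : TorsionFreeTo g (suc k)
    tf′ j 1≤j j≤ with m≤n⇒m<n∨m≡n j≤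
    ... | inj₁ j<1+k = tf j 1≤j (s≤s⁻¹ j<1+k)
    ... | inj₂ refl = ≢𝟘

  -- Logarithms are taken in [1, n], so that 𝟘 has logarithm n. Every term of a sequence thereby has
  -- a positive coefficient, as `by-parts` requires.
  record Generates (g : A) : Set where
    field
      log : A → ℕ
      1≤log : ∀ x → 1 ≤ log x
      log≤n : ∀ x → log x ≤ n
      log-correct : ∀ x → x ≡ log x · g
      n·g≡𝟘 : n · g ≡ 𝟘
      torsionFree : ∀ j → 1 ≤ j → j < n → j · g ≢ 𝟘

    n≤order : ∀ {j} → 1 ≤ j → j · g ≡ 𝟘 → n ≤ j
    n≤order {j} 1≤j e = ≮⇒≥ λ j<n → torsionFree j 1≤j j<n e

    order-unique : ∀ {j} → 1 ≤ j → j < n + n → j · g ≡ 𝟘 → j ≡ n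
    order-unique {j} 1≤j j<2n e with m≤n⇒m<n∨m≡n (n≤order 1≤j e)
    ... | inj₂ n≡j = sym n≡j
    ... | inj₁ n<j = ⊥-elim (torsionFree (j ∸ n) (m<n⇒0<n∸m n<j)
      (+-cancelʳ-< n _ _ (subst (_< n + n) (sym (m∸n+n≡m (<⇒≤ n<j))) j<2n))
      (trans (sym (·-+-≡𝟘 (j ∸ n) n·g≡𝟘)) (trans (cong (_· g) (m∸n+n≡m (<⇒≤ n<j))) e)))

  -- If more than half of G consists of distinct multiples of g, then every coset of
  -- ⟨ g ⟩ meets ⟨ g ⟩.
  generates : ∀ {g L} → TorsionFreeTo g L → n < 2 * suc L → Generates g
  generates {g} {L} tf n<2L+2 with first-multiple-𝟘 g n
  ... | inj₁ tfn = ⊥-elim (<⇒≱ ≤-refl (subst (_≤ n) (length-applyUpTo (_· g) (suc n))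
      (unique-length≤n (multiples-unique tfn))))
  ... | inj₂ (m , m<n , e , tfm) = record
    { log = λ x → proj₁ (log′ x)
    ; 1≤log = λ x → proj₁ (proj₂ (log′ x))
    ; log≤n = λ x → proj₁ (proj₂ (proj₂ (log′ x)))
    ; log-correct = λ x → proj₂ (proj₂ (proj₂ (log′ x)))
    ; n·g≡𝟘 = trans (cong (_· g) n≡) e
    ; torsionFree = λ j 1≤j j<n → tfm j 1≤j (s≤s⁻¹ (subst (j <_) n≡ j<n))
    }
    where
    L≤m : L ≤ m
    L≤m = ≮⇒≥ λ m<L → tf (suc m) (s≤s z≤n) m<L e
    log₀ : ∀ x → ∃[ k ] x ≡ k · g
    log₀ x with collision? g L x
    ... | no none = ⊥-elim (<⇒≱ n<2L+2 (begin
      2 * suc L     ≡⟨ cong (suc L +_) (+-identityʳ (suc L)) ⟩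
      suc L + suc L ≡⟨ length-translates g L x ⟨
      length (multiples g L ++ map (x ⊕_) (multiples g L))
          ≤⟨ unique-length≤n (multiples-disjoint x tf none) ⟩
      n             ∎))
      where open ≤-Reasoning
    ... | yes (i , j , i≤L , j≤L , eq) = i + (suc m ∸ j) , (begin
      x                                  ≡⟨ ⊕-identityʳ x ⟨
      x ⊕ 𝟘                              ≡⟨ cong (x ⊕_) (trans (cong (_· g) (m+[n∸m]≡n j≤)) e) ⟨
      x ⊕ (j + (suc m ∸ j)) · g          ≡⟨ cong (x ⊕_) (·-homo-+ g j _) ⟩
      x ⊕ (j · g ⊕ (suc m ∸ j) · g)      ≡⟨ ⊕-assoc x _ _ ⟨
      (x ⊕ j · g) ⊕ (suc m ∸ j) · g      ≡⟨ cong (_⊕ (suc m ∸ j) · g) eq ⟨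
      i · g ⊕ (suc m ∸ j) · g            ≡⟨ ·-homo-+ g i _ ⟨
      (i + (suc m ∸ j)) · g              ∎)
      where
      open ≡-Reasoning
      j≤ : j ≤ suc m
      j≤ = m≤n⇒m≤1+n (≤-trans j≤L L≤m)
    n≡ : n ≡ suc m
    n≡ = ≤-antisym (order-≥n e log₀) m<n
    log′ : ∀ x → ∃[ k ] 1 ≤ k × k ≤ n × x ≡ k · g
    log′ x with k , refl ← log₀ x with k % suc m in eq
    ... | zero = n , subst (1 ≤_) (sym n≡) (s≤s z≤n) , ≤-refl ,
      trans (·-% k e) (trans (cong (_· g) eq) (sym (trans (cong (_· g) n≡) e)))
    ... | suc j = suc j , s≤s z≤n ,
      subst₂ _≤_ eq (sym n≡) (<⇒≤ (m%n<n k (suc m))) , trans (·-% k e) (cong (_· g) eq)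

  -- Serves where the structure theorem applies only to γ enlarged by a borrowed term c. The
  -- coefficient x of c stays in the bound because it sharpens the estimate for the sum of the
  -- others.
  behaving-uncons : ∀ {c γ} → Behaving (c ∷ γ) → ∃[ g ] ∃[ x ] ∃[ ys ]
    γ ≡ map (_· g) ys × 1 ≤ x × All (1 ≤_) ys × TorsionFreeTo g (x + sum ys)
  behaving-uncons (behaving g xs p pos tf _) with ↭-map-inv (_· g) (↭-sym p)
  ... | x ∷ ys , refl , q with 1≤x ∷ pos′ ← All-resp-↭ q pos =
    g , x , ys , refl , 1≤x , pos′ , subst (TorsionFreeTo g) (sum-↭ q) tf

  by-parts : ∀ {γ g xs} → γ ↭ˡ map (_· g) xs → All (1 ≤_) xs → ∃[ w ] ∃[ ys ]
    γ ↭ˡ map (_· g) (replicate w 1 ++ ys) × All (2 ≤_) ys ×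
    w + sum ys ≡ sum xs × w + length ys ≡ length xs
  by-parts {g = g} p pos with w , ys , big , q ← separate-ones pos =
    w , ys , ↭-trans p (map⁺ (_· g) q) , big ,
    sym (trans (sum-↭ q) (trans (sum-++ (replicate w 1) ys) (cong (_+ sum ys)
        (trans (sum-replicate w 1) (*-identityʳ w))))) ,
    sym (trans (↭-length q) (trans (length-++ (replicate w 1)) (cong (_+ length ys)
        (length-replicate w))))

  -- What the combinatorics yields before it is known whether G is cyclic. In `involutive` the
  -- second value differs from g by the involution r g. In `index-two` the element t generates a
  -- subgroup of index two, and b represents the other coset.
  data Shape (S : List A) (r : ℕ) : Set where
    almost-constant : ∀ {x g b} → Generates g → x + 1 ≡ n →
      S ↭ˡ replicate x g ++ [ b ] → Shape S r
    half-pair : ∀ {x g} → Generates g → suc n ≡ 2 * r → x + 2 ≡ n →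
      S ↭ˡ replicate x g ++ replicate 2 (r · g) → Shape S r
    involutive : ∀ {x g h} → Generates g → n ≡ 2 * r → x + (1 + h * 2) ≡ n →
      S ↭ˡ replicate x g ++ replicate (1 + h * 2) (suc r · g) → Shape S r
    index-two : ∀ {x y t b} → n ≡ 2 * r → (∀ j → 1 ≤ j → j < r → j · t ≢ 𝟘) → r · t ≡ 𝟘 →
      (∀ i → b ≢ i · t) → (∀ z → ∃[ i ] (z ≡ i · t ⊎ z ≡ i · t ⊕ b)) → x + y ≡ n →
      S ↭ˡ replicate x t ++ replicate y b →
      (y ≡ 1 ⊎ (∃[ h ] y ≡ 1 + h * 2 × 2 · b ≡ 2 · t × y ≤ r)) → Shape S r

  -- Sequences whose nonempty zero-sum subsequences all have length r

  module UniqueLength (S : List A) (|S|≡n : length S ≡ n) (r : ℕ) (1≤r : 1 ≤ r)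
    (unique : ∀ T R → S ↭ˡ T ++ R → σ T ≡ 𝟘 → T ≢ [] → length T ≡ r) where

    record ZeroSum (T R : List A) : Set where
      constructor zeroSum
      field
        split : S ↭ˡ T ++ R
        sum≡𝟘 : σ T ≡ 𝟘
        size : length T ≡ r

      complement-size : length R + r ≡ n
      complement-size = trans (+-comm (length R) r) (trans (cong (_+ length R) (sym size))
        (trans (sym (length-++ T)) (trans (sym (↭-length split)) |S|≡n)))

    open ZeroSum

    zeroSum-resp-↭ : ∀ {T T′ R R′} → T ↭ˡ T′ → R ↭ˡ R′ → ZeroSum T R → ZeroSum T′ R′
    zeroSum-resp-↭ p q (zeroSum s e l) =
      zeroSum (↭-trans s (++⁺ p q)) (trans (sym (σ-↭ p)) e) (trans (sym (↭-length p)) l)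

    complement-zeroFree : ∀ {T R} → ZeroSum T R → ZeroFree R
    complement-zeroFree zs [] _ _ _ = refl
    complement-zeroFree {T} {R} zs T′@(_ ∷ _) R′ p e =
        ⊥-elim (1+n≢0 (+-cancelˡ-≡ (length T) (length T′) 0 (begin
      length T + length T′  ≡⟨ length-++ T ⟨
      length (T ++ T′)      ≡⟨ unique (T ++ T′) R′ S↭ (trans (σ-++ T T′)
          (trans (cong₂ _⊕_ (sum≡𝟘 zs) e) (⊕-identityˡ 𝟘)))
                                 (λ eq → contradiction (++-conicalʳ T T′ eq) λ ()) ⟩
      r                     ≡⟨ size zs ⟨
      length T              ≡⟨ +-identityʳ _ ⟨
      length T + 0          ∎)))
      where
      open ≡-Reasoning
      S↭ : S ↭ˡ (T ++ T′) ++ R′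
      S↭ = ↭-trans (split zs) (↭-trans (++⁺ˡ T p) (↭-sym (++-assoc T T′ R′)))

    proper-zeroFree : ∀ {t T R} → ZeroSum (t ∷ T) R → ZeroFree T
    proper-zeroFree zs [] _ _ _ = refl
    proper-zeroFree {t} {T} {R} zs U@(_ ∷ _) V p e = ⊥-elim (<⇒≱ (s≤s |U|≤|T|) (≤-reflexive
      (trans (size zs) (sym (unique U (V ++ t ∷ R) S↭ e (λ ()))))))
      where
      |U|≤|T| : length U ≤ length T
      |U|≤|T| = ≤-trans (m≤m+n (length U) (length V)) (≤-reflexive (trans (sym (length-++ U))
          (sym (↭-length p))))
      S↭ : S ↭ˡ U ++ (V ++ t ∷ R)
      S↭ = ↭-trans (split zs) (↭-trans (prep t (++⁺ʳ R p))
        (solve 4 (λ t u v s → t ⊕′ ((u ⊕′ v) ⊕′ s) ⊜ u ⊕′ (v ⊕′ (t ⊕′ s))) ↭-refl [ t ] U V R))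
        where open ++-Solver renaming (_⊕_ to _⊕′_)

    exchange : ∀ {T R} T′ T″ R′ R″ → ZeroSum T R → T ↭ˡ T′ ++ T″ → R ↭ˡ R′ ++ R″ →
               σ T′ ≡ σ R′ → R′ ≢ [] → length T′ ≡ length R′
    exchange {T} {R} T′ T″ R′ R″ zs p q e R′≢[] = +-cancelʳ-≡ (length T″) _ _ (begin
      length T′ + length T″ ≡⟨ length-++ T′ ⟨
      length (T′ ++ T″)     ≡⟨ ↭-length p ⟨
      length T              ≡⟨ size zs ⟩
      r                     ≡⟨ unique (R′ ++ T″) (T′ ++ R″) S↭ (trans (σ-++ R′ T″)
          (trans (cong (_⊕ σ T″) (sym e)) (trans (sym (σ-split {ys = T′} p)) (sum≡𝟘 zs)))) nonempty
          ⟨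
      length (R′ ++ T″)     ≡⟨ length-++ R′ ⟩
      length R′ + length T″ ∎)
      where
      open ≡-Reasoning
      nonempty : R′ ++ T″ ≢ []
      nonempty eq = R′≢[] (++-conicalˡ R′ T″ eq)
      S↭ : S ↭ˡ (R′ ++ T″) ++ (T′ ++ R″)
      S↭ = ↭-trans (split zs) (↭-trans (++⁺ p q)
        (solve 4 (λ t u v s → (t ⊕′ u) ⊕′ (v ⊕′ s) ⊜ (v ⊕′ u) ⊕′ (t ⊕′ s)) ↭-refl T′ T″ R′ R″))
        where open ++-Solver renaming (_⊕_ to _⊕′_)

    box : ∀ {x y a b i j} → S ↭ˡ replicate x a ++ replicate y b → i ≤ x → j ≤ y →
          i · a ⊕ j · b ≡ 𝟘 → 1 ≤ i + j → i + j ≡ r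
    box {x} {y} {a} {b} {i} {j} p i≤x j≤y e 1≤ = trans (sym len) (unique U V S↭
      (trans (σ-++ (replicate i a) (replicate j b)) (trans (cong₂ _⊕_ (σ-replicate i a)
          (σ-replicate j b)) e))
      λ eq → <⇒≢ 1≤ (sym (trans (sym len) (cong length eq))))
      where
      U = replicate i a ++ replicate j b
      V = replicate (x ∸ i) a ++ replicate (y ∸ j) b
      len : length U ≡ i + j
      len = trans (length-++ (replicate i a)) (cong₂ _+_ (length-replicate i) (length-replicate j))
      S↭ : S ↭ˡ U ++ V
      S↭ = ↭-trans p (↭-trans (↭-reflexive (cong₂ _++_ (replicate-≤ a i≤x) (replicate-≤ b j≤y)))
        (interchange (replicate i a) _ _ _))

    -- Reading T off the coefficients of R, for 2r at most n + 1

    module SmallParts {T R : List A} {g : A} {w : ℕ} {big : List ℕ} (zs : ZeroSum T R)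
        (R↭ : R ↭ˡ map (_· g) (replicate w 1 ++ big))
      (2≤big : All (2 ≤_) big) (tf : TorsionFreeTo g (w + sum big)) (2r≤1+n : 2 * r ≤ suc n)
      -- With the w ones added on both sides: the coefficient sum of R is below twice their number,
      -- by at least 2 in general and by at least 1 when 2r = n + 1, where R is one term shorter
      -- than T.
      (mean : sum big + 2 ≤ w + 2 * length big ⊎
              (sum big + 1 ≤ w + 2 * length big × 2 * r ≡ suc n)) where

      parts = replicate w 1 ++ big

      |parts| : length parts ≡ w + length big
      |parts| = trans (length-++ (replicate w 1)) (cong (_+ length big) (length-replicate w))

      sum-parts : sum parts ≡ w + sum big
      sum-parts = trans (sum-++ (replicate w 1) big)
        (cong (_+ sum big) (trans (sum-replicate w 1) (*-identityʳ w)))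

      sizes : w + length big + r ≡ n
      sizes = trans (cong (_+ r) (trans (sym |parts|) (trans (sym (length-map (_· g) parts))
          (sym (↭-length R↭)))))
        (complement-size zs)

      mean′ : sum big + 1 ≤ w + 2 * length big
      mean′ = [ ≤-trans (+-monoʳ-≤ (sum big) (s≤s z≤n)) , proj₁ ]′ mean

      n<2L+2 : n < 2 * suc (w + sum big)
      n<2L+2 = covers-most n r w (length big) (sum big) sizes (2*length≤sum 2≤big) 2r≤1+n

      gen : Generates g
      gen = generates tf n<2L+2

      open Generates gen using (log; log-correct; 1≤log; log≤n)

      cover : Covering parts
      cover = covering-ones++ (parts≤ 2≤big (subst (_≤ w + 2 * length big) (+-comm (sum big) 1)
          mean′))

      selection : ∀ ys zs → parts ↭ˡ ys ++ zs → R ↭ˡ map (_· g) ys ++ map (_· g) zs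
      selection ys zs p = ↭-trans R↭ (↭-trans (map⁺ (_· g) p) (↭-reflexive (map-++ (_· g) ys zs)))

      selection-length : ∀ {s} ys zs → s · g ∈ˡ T → 1 ≤ s → parts ↭ˡ ys ++ zs → sum ys ≡ s →
          length ys ≡ 1
      selection-length {s} ys zs′ t∈T 1≤s p refl with T′ , q ← extract t∈T =
          trans (sym (length-map (_· g) ys))
        (sym (exchange [ sum ys · g ] T′ (map (_· g) ys) (map (_· g) zs′) zs q (selection ys zs′ p)
            (trans (⊕-identityʳ _) (sym (σ-multiples g ys))) (nonempty ys 1≤s)))
        where
        nonempty : ∀ ys → 1 ≤ sum ys → map (_· g) ys ≢ []
        nonempty [] ()
        nonempty (_ ∷ _) _ ()

      -- The one configuration that lets 2 g occur in T: R has a single coefficient 1, so the 2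
      -- cannot be replaced by ones. It ends in form (3), with 2 g as the generator.
      Half : Set
      Half = w ≡ 1 × 2 * r ≡ suc n × (∃[ m ] big ↭ˡ 2 ∷ replicate m 2)

      -- By the exchange a coefficient s ≠ 1 of T must be a single part of R, and larger than the
      -- number w of ones since otherwise s ones would do. A margin of 2 in `mean` has no room for
      -- such a part. A margin of 1 forces all other big parts to be 2 and s = w + 1; the length of
      -- one more zero-sum sequence then gives w = 1.
      unit-or-two : ∀ {s} → s · g ∈ˡ T → 1 ≤ s → s ≤ w + sum big → s ≡ 1 ⊎ (s ≡ 2 × Half)
      unit-or-two {s} t∈T 1≤s s≤L with s ≟ 1
      ... | yes s≡1 = inj₁ s≡1
      ... | no s≢1 = let ys , zs′ , p , sum≡s = cover s (subst (s ≤_) (sym sum-parts) s≤L) in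
        inj₂ (two (in-big (∈-++⁻ (replicate w 1) (∈-resp-↭ (↭-sym p)
          (∈-++⁺ˡ (singleton∋sum ys (selection-length ys zs′ t∈T 1≤s p sum≡s) sum≡s))))))
        where
        in-big : s ∈ˡ replicate w 1 ⊎ s ∈ˡ big → s ∈ˡ big
        in-big (inj₁ s∈) = ⊥-elim (s≢1 (All.lookup (All.replicate⁺ {P = _≡ 1} w refl) s∈))
        in-big (inj₂ s∈) = s∈
        w<s : w < s
        w<s = ≰⇒> λ s≤w → s≢1 (trans (sym (length-replicate s))
          (selection-length (replicate s 1) (replicate (w ∸ s) 1 ++ big) t∈T 1≤s
            (↭-trans (↭-reflexive (cong (_++ big) (replicate-≤ 1 s≤w))) (++-assoc (replicate s 1) _
                big))
            (trans (sum-replicate s 1) (*-identityʳ s))))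
        two : s ∈ˡ big → s ≡ 2 × Half
        two s∈big with big′ , q ← extract s∈big with 2≤s ∷ 2≤big′ ← All-resp-↭ q 2≤big = go mean
          where
          B≥ : 2 * length big′ ≤ sum big′
          B≥ = 2*length≤sum 2≤big′
          large : ∀ {k} → sum big + k ≤ w + 2 * length big → s + sum big′ + k ≤ w + 2 * suc
              (length big′)
          large {k} = subst₂ (λ a b → a + k ≤ w + 2 * b) (sum-↭ q) (↭-length q)
          go : _ → s ≡ 2 × Half
          go (inj₁ h) = ⊥-elim (no-large-part w s (sum big′) (length big′) (large h) B≥ w<s)
          go (inj₂ (h , 2r≡1+n)) = trans s≡ (cong suc w≡1) , w≡1 , 2r≡1+n , length big′ ,
            subst (λ z → big ↭ˡ z ∷ replicate (length big′) 2) (trans s≡ (cong suc w≡1)) big↭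
            where
            m = length big′
            twos : big′ ≡ replicate m 2
            twos = all-twos 2≤big′ (other-parts-small w s (sum big′) m (large h) w<s)
            big↭ : big ↭ˡ s ∷ replicate m 2
            big↭ = subst (λ z → big ↭ˡ s ∷ z) twos q
            s≡ : s ≡ suc w
            s≡ = ≤-antisym (large-part≤ w s (sum big′) m (large h) B≥) w<s
            sizes′ : w + suc m + r ≡ n
            sizes′ = subst (λ l → w + l + r ≡ n) (↭-length q) sizes
            1≤w : 1 ≤ w
            1≤w = s≤s⁻¹ (subst (2 ≤_) s≡ 2≤s)
            -- s ∈ T, and 1, s, 2, …, 2 from R
            zero-sum : length (s · g ∷ map (_· g) (1 ∷ s ∷ replicate m 2)) ≡ r
            zero-sum with T′ , T↭ ← extract t∈T = unique (s · g ∷ map (_· g) (1 ∷ s ∷ replicate m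
                2)) (T′ ++ map (_· g) (replicate (w ∸ 1) 1))
              (↭-trans (split zs) (↭-trans (++⁺ T↭ (selection (1 ∷ s ∷ replicate m 2)
                  (replicate (w ∸ 1) 1) (↭-trans (++⁺ (↭-reflexive (replicate-≤ 1 1≤w)) big↭)
                  (prep 1 (++-comm (replicate (w ∸ 1) 1) _)))))
                (prep (s · g) (shifts T′ (map (_· g) (1 ∷ s ∷ replicate m 2))))))
              (trans (cong (s · g ⊕_) (σ-multiples g (1 ∷ s ∷ replicate m 2)))
                (trans (sym (·-homo-+ g s _)) (trans (cong (_· g) total) (Generates.n·g≡𝟘 gen))))
              λ ()
              where
              total : s + (1 + (s + sum (replicate m 2))) ≡ n
              total = trans (cong₂ (λ a b → a + (1 + (a + b))) s≡ (sum-replicate m 2))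
                (half-total n r w m sizes′ 2r≡1+n)
            w≡1 : w ≡ 1
            w≡1 = half-w≡1 n r w m sizes′ 2r≡1+n
              (trans (cong (λ k → suc (suc (suc k)))
                  (sym (trans (length-map (_· g) (replicate m 2)) (length-replicate m)))) zero-sum)

      -- Parts of R with sum n - s complete s g to a zero-sum sequence. There are r - 1 of them, so
      -- r - 1 ≤ n - s. Together with s exceeding the coefficient sum of R this makes the sum of the
      -- big parts at most their number, so there are none, and s can only be w + 1.
      beyond : ∀ {s} → s · g ∈ˡ T → s ≤ n → w + sum big < s → big ≡ [] × s ≡ suc w
      beyond {s} t∈T s≤n L<s
        with ys , zs′ , p , sum≡ ← cover (n ∸ s) (subst (n ∸ s ≤_) (sym sum-parts)
               (m≤n+o⇒m∸n≤o n s (reflected≤ n s (w + sum big) n<2L+2 L<s)))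
        with T′ , T↭ ← extract t∈T =
        big≡[] big l≡0 ,
        ≤-antisym (overshoot≤ n r w s (n ∸ s) sizes′ (m∸n+n≡m s≤n) r≤1+y)
                  (≤-trans (s≤s (m≤m+n w (sum big))) L<s)
        where
        y·g : σ (s · g ∷ map (_· g) ys) ≡ 𝟘
        y·g = begin
          s · g ⊕ σ (map (_· g) ys)  ≡⟨ cong (s · g ⊕_) (trans (σ-multiples g ys)
              (cong (_· g) sum≡)) ⟩
          s · g ⊕ (n ∸ s) · g        ≡⟨ ·-homo-+ g s (n ∸ s) ⟨
          (s + (n ∸ s)) · g          ≡⟨ cong (_· g) (m+[n∸m]≡n s≤n) ⟩
          n · g                      ≡⟨ Generates.n·g≡𝟘 gen ⟩
          𝟘                          ∎
          where open ≡-Reasoning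
        positive : All (1 ≤_) ys
        positive = All.++⁻ˡ ys (All-resp-↭ p (All.++⁺ (All.replicate⁺ w (s≤s z≤n))
            (All.map (≤-trans (s≤s z≤n)) 2≤big)))
        |ys|+1≡r : suc (length ys) ≡ r
        |ys|+1≡r = trans (cong suc (sym (length-map (_· g) ys))) (unique (s · g ∷ map (_· g) ys)
            (T′ ++ map (_· g) zs′)
          (↭-trans (split zs) (↭-trans (++⁺ T↭ (selection ys zs′ p))
              (prep (s · g) (shifts T′ (map (_· g) ys))))) y·g λ ())
        r≤1+y : r ≤ suc (n ∸ s)
        r≤1+y = subst₂ _≤_ |ys|+1≡r (cong suc sum≡) (s≤s (length≤sum positive))
        few : sum big ≤ length big
        few = few-large n r w (length big) (sum big) s (n ∸ s) sizes (m∸n+n≡m s≤n) r≤1+y L<s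
        l≡0 : length big ≡ 0
        l≡0 = twice≤⇒≡0 (sum big) (length big) (2*length≤sum 2≤big) few
        big≡[] : ∀ (b : List ℕ) → length b ≡ 0 → b ≡ []
        big≡[] [] _ = refl
        sizes′ : w + r ≡ n
        sizes′ = trans (cong (_+ r) (trans (sym (+-identityʳ w)) (cong (w +_) (sym l≡0)))) sizes

      combine : ∀ i j m → i · g ⊕ j · (m · g) ≡ (i + j * m) · g
      combine i j m = trans (cong (i · g ⊕_) (·-assocˡ g j m)) (sym (·-homo-+ g i (j * m)))

      not-constant : ∀ {a} → 2 ≤ n → T ↭ˡ replicate a g ++ [] → a + 0 ≡ length T → ⊥
      not-constant {a} 2≤n p a≡ = <⇒≱ (r<n n r 2≤n 2r≤1+n)
        (Generates.n≤order gen 1≤r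
            (trans (cong (_· g) (trans (sym (size zs)) (trans (sym a≡) (+-identityʳ a))))
          (trans (sym (σ-replicate a g)) (trans (cong σ (sym (++-identityʳ (replicate a g))))
            (trans (sym (σ-↭ p)) (sum≡𝟘 zs))))))

      -- From w + 1 = n - ρ with ρ = r - 1 follows b = -ρ g, so j copies of b are cancelled by jρ
      -- copies of g, taken modulo n. For j = 2 the resulting length 2r cannot be r, so S has fewer
      -- than 2ρ copies of g; if l = 2 this leaves only 2r = n + 1. For l ≥ 3 the case j = 3 gives n
      -- = 2r, and then b = (r + 1) g.
      overshoot-shape : ∀ {k l} → 2 ≤ n → w + r ≡ n → R ↭ˡ replicate w g →
        k + l ≡ length T → T ↭ˡ replicate k g ++ replicate l (suc w · g) → Shape S r
      overshoot-shape {k} {l} 2≤n w+r≡n R↭g k+l≡ T↭ = go l k+l≡r S↭ T↭ k+l≡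
        where
        b = suc w · g
        ρ = r ∸ 1
        r≡ : r ≡ suc ρ
        r≡ = sym (m+[n∸m]≡n 1≤r)
        w+1+ρ≡n : w + suc ρ ≡ n
        w+1+ρ≡n = trans (cong (w +_) (sym r≡)) w+r≡n
        2+2ρ≤ : 2 * suc ρ ≤ suc n
        2+2ρ≤ = subst (λ z → 2 * z ≤ suc n) r≡ 2r≤1+n
        k+l≡r : k + l ≡ r
        k+l≡r = trans k+l≡ (size zs)
        S↭ : S ↭ˡ replicate (w + k) g ++ replicate l b
        S↭ = ↭-trans (split zs) (↭-trans (++-comm T R) (↭-trans (++⁺ R↭g T↭)
          (↭-reflexive (trans (sym (++-assoc≡ (replicate w g) _ _)) (cong (_++ replicate l b)
              (sym (replicate-+ w k g)))))))
        total : ∀ {l} → k + l ≡ r → w + k + l ≡ n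
        total {l} e = trans (+-assoc w k l) (trans (cong (w +_) e) w+r≡n)
        2ρ>w+k : ∀ l → S ↭ˡ replicate (w + k) g ++ replicate (2 + l) b → w + k < 2 * ρ
        2ρ>w+k l p = ≰⇒> λ h → pair-length ρ (trans (box {i = 2 * ρ} {j = 2} p h (s≤s (s≤s z≤n))
          (trans (combine (2 * ρ) 2 (suc w)) (trans (cong (_· g) (pair-total n w ρ w+1+ρ≡n))
              (multiple-≡𝟘 {g} {n} 2 (Generates.n·g≡𝟘 gen))))
          (m≤n⇒m≤o+n (2 * ρ) (s≤s z≤n))) r≡)
        go : ∀ l → k + l ≡ r → S ↭ˡ replicate (w + k) g ++ replicate l b →
             T ↭ˡ replicate k g ++ replicate l b → k + l ≡ length T → Shape S r
        go 0 e p q e′ = ⊥-elim (not-constant 2≤n q e′)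
        go 1 e p q e′ = almost-constant {x = w + k} gen (total e) p
        go 2 e p q e′ = half-pair {x = w + k} gen (subst (λ z → suc n ≡ 2 * z) (sym r≡) 1+n≡)
            (total e)
          (subst (λ z → S ↭ˡ replicate (w + k) g ++ replicate 2 (z · g))
            (trans (cong suc (two-left-w n w ρ w+1+ρ≡n 1+n≡)) (sym r≡)) p)
          where
          1+n≡ : suc n ≡ 2 * suc ρ
          1+n≡ = two-left n w k ρ w+1+ρ≡n (trans e r≡) 2+2ρ≤ (2ρ>w+k 0 p)
        go l@(suc (suc (suc l′))) e p q e′ = odd (even-or-odd l)
          where
          -- Three copies of b need 3ρ copies of g; one n is taken off to stay within the copies at
          -- hand.
          i = 3 * ρ ∸ n
          i+n≡ : i + n ≡ 3 * ρ
          i+n≡ = m∸n+n≡m (n≤3ρ n w k ρ w+1+ρ≡n (2ρ>w+k (suc l′) p))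
          i≤ : i ≤ w + k
          i≤ = ≤-trans (m≤n+o⇒m∸n≤o (3 * ρ) n (subst (3 * ρ ≤_) (+-comm w n) (3ρ≤w+n n w ρ w+1+ρ≡n
              2+2ρ≤))) (m≤m+n w k)
          i+3≡r : i + 3 ≡ r
          i+3≡r = box {i = i} {j = 3} p i≤ (s≤s (s≤s (s≤s z≤n)))
            (trans (combine i 3 (suc w)) (trans (cong (_· g) (triple-total n w ρ i w+1+ρ≡n i+n≡))
                (multiple-≡𝟘 {g} {n} 2 (Generates.n·g≡𝟘 gen))))
            (m≤n⇒m≤o+n i (s≤s z≤n))
          n≡2r : n ≡ 2 * r
          n≡2r = subst (λ z → n ≡ 2 * z) (sym r≡) (triple-n n ρ i i+n≡ (trans i+3≡r r≡))
          w≡r : w ≡ r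
          w≡r = +-cancelʳ-≡ r w r (trans w+r≡n (trans n≡2r (cong (r +_) (+-identityʳ r))))
          p′ : S ↭ˡ replicate (w + k) g ++ replicate l (suc r · g)
          p′ = subst (λ z → S ↭ˡ replicate (w + k) g ++ replicate l (suc z · g)) w≡r p
          odd : _ → Shape S r
          odd (inj₂ (h , l≡)) = involutive {x = w + k} {h = h} gen n≡2r
              (subst (λ z → w + k + z ≡ n) l≡ (total e))
            (subst (λ z → S ↭ˡ replicate (w + k) g ++ replicate z (suc r · g)) l≡ p′)
          -- For even l the whole of S sums to zero, which would make r equal to n.
          odd (inj₁ (h , l≡)) = ⊥-elim (<⇒≢ (r<n n r 2≤n 2r≤1+n)
              (trans (sym (box {i = w + k} {j = l} p′ ≤-refl ≤-refl
            (trans (combine (w + k) l (suc r))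
                (trans (cong (_· g) (trans (cong (λ z → w + k + z * suc r) l≡)
              (involutive-total n r (w + k) h (trans (cong (w + k +_) (sym l≡)) (total e)) n≡2r)))
                  (multiple-≡𝟘 {g} {n} (suc h) (Generates.n·g≡𝟘 gen))))
            (m≤n⇒m≤o+n (w + k) (s≤s z≤n)))) (total e)))

      -- The coefficient sum k + 2l of T is a positive multiple of n below 2n, hence n itself, and 2
      -- (k + l) = n + 1 leaves k = 1. So g occurs once in T and once in R, and all other terms are
      -- 2 g. As n is odd, 2 g generates as well, with r (2 g) = (n + 1) g = g.
      half-shape : ∀ {k l} → 2 ≤ n → Half → k + l ≡ length T →
        T ↭ˡ replicate k g ++ replicate l (2 · g) → Shape S r
      half-shape {k} {l} 2≤n (refl , 2r≡1+n , m , big↭) k+l≡ T↭ =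
        half-pair {x = suc m + l} gen₂ (sym 2r≡1+n) x+2≡n (subst (λ z → S ↭ˡ replicate (suc m + l)
            (2 · g) ++ z ∷ z ∷ [])
          (sym r·2g≡g) S↭)
        where
        k+l≡r : k + l ≡ r
        k+l≡r = trans k+l≡ (size zs)
        multiple : (k + l * 2) · g ≡ 𝟘
        multiple = trans (sym (combine k l 2))
            (trans (sym (trans (σ-↭ T↭) (trans (σ-++ (replicate k g) _)
          (cong₂ _⊕_ (σ-replicate k g) (σ-replicate l (2 · g)))))) (sum≡𝟘 zs))
        k≡1 : k ≡ 1
        k≡1 = half-k≡1 n r k l k+l≡r 2r≡1+n (Generates.order-unique gen
          (≤-trans 1≤r (≤-trans (≤-reflexive (sym k+l≡r)) (+-monoʳ-≤ k (m≤m*n l 2))))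
          (half-multiple<2n n r k l k+l≡r 2r≡1+n 2≤n) multiple)
        r≡1+l : r ≡ suc l
        r≡1+l = trans (sym k+l≡r) (cong (_+ l) k≡1)
        r·2g≡g : r · (2 · g) ≡ g
        r·2g≡g = trans (·-assocˡ g r 2) (trans (cong (_· g) (trans (*-comm r 2) 2r≡1+n))
          (trans (·-+-≡𝟘 {g} {n} 1 (Generates.n·g≡𝟘 gen)) (·-homo-1 g)))
        gen₂ : Generates (2 · g)
        gen₂ = generates {L = l} (λ j 1≤j j≤l e → Generates.torsionFree gen (j * 2)
            (≤-trans 1≤j (m≤m*n j 2))
            (half-double< n l j (subst (λ z → 2 * z ≡ suc n) r≡1+l 2r≡1+n) j≤l)
                (trans (sym (·-assocˡ g j 2)) e))
          (≤-reflexive (trans (sym 2r≡1+n) (cong (2 *_) r≡1+l)))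
        |big| : length big ≡ suc m
        |big| = trans (↭-length big↭) (cong suc (length-replicate m))
        x+2≡n : suc m + l + 2 ≡ n
        x+2≡n = trans (trans (+-suc (suc m + l) 1) (cong suc (+-comm (suc m + l) 1)))
          (trans (cong suc (sym (+-suc (suc m) l))) (trans (cong₂ (λ a b → 1 + a + b) (sym |big|)
              (sym r≡1+l)) sizes))
        S↭ : S ↭ˡ replicate (suc m + l) (2 · g) ++ g ∷ g ∷ []
        S↭ = ↭-trans (split zs) (↭-trans (++⁺
               (↭-trans T↭ (↭-reflexive (cong (λ z → replicate z g ++ replicate l (2 · g)) k≡1)))
               (↭-trans R↭ (prep (1 · g) (map⁺ (_· g) big↭))))
          (↭-trans (↭-reflexive (cong₂ (λ a c → (g ∷ replicate l (2 · g)) ++ a ∷ 2 · g ∷ c)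
              (·-homo-1 g) (map-replicate (_· g) m 2)))
          (↭-trans (solve 3 (λ u v s → (u ⊕′ v) ⊕′ (u ⊕′ s) ⊜ (s ⊕′ v) ⊕′ (u ⊕′ u)) ↭-refl [ g ]
              (replicate l (2 · g)) (replicate (suc m) (2 · g)))
            (↭-reflexive (cong (_++ g ∷ g ∷ []) (sym (replicate-+ (suc m) l (2 · g))))))))
          where open ++-Solver renaming (_⊕_ to _⊕′_)

      Overshooting : A → Set
      Overshooting t = big ≡ [] × t ≡ suc w · g

      classify : ∀ {t} → t ∈ˡ T → t ≡ g ⊎ (t ≡ 2 · g × Half) ⊎ Overshooting t
      classify {t} t∈T = [ within , past ]′ (≤-<-connex (log t) (w + sum big))
        where
        t≡ : ∀ {k} → log t ≡ k → t ≡ k · g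
        t≡ e = trans (log-correct t) (cong (_· g) e)
        s∈T : log t · g ∈ˡ T
        s∈T = subst (_∈ˡ T) (log-correct t) t∈T
        within : log t ≤ w + sum big → t ≡ g ⊎ (t ≡ 2 · g × Half) ⊎ Overshooting t
        within s≤L = [ (λ s≡1 → inj₁ (trans (t≡ s≡1) (·-homo-1 g)))
                     , (λ (s≡2 , half) → inj₂ (inj₁ (t≡ s≡2 , half))) ]′
                     (unit-or-two s∈T (1≤log t) s≤L)
        past : w + sum big < log t → t ≡ g ⊎ (t ≡ 2 · g × Half) ⊎ Overshooting t
        past L<s = let big≡[] , s≡ = beyond s∈T (log≤n t) L<s in inj₂ (inj₂ (big≡[] , t≡ s≡))

      ¬half : big ≡ [] → ¬ Half
      ¬half big≡[] (_ , _ , _ , p) = 1+n≢0 (trans (sym (↭-length p)) (cong length big≡[]))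

      shape-all-ones : 2 ≤ n → big ≡ [] → Shape S r
      shape-all-ones 2≤n big≡[] =
        let k , l , e , p = two-valued T (λ t∈T → values (classify t∈T)) in
        overshoot-shape {k} {l} 2≤n
          (trans (cong (_+ r) (sym (trans (cong (w +_) (cong length big≡[])) (+-identityʳ w))))
              sizes)
          (↭-trans R↭ (↭-reflexive ones≡)) e p
        where
        values : ∀ {t} → t ≡ g ⊎ (t ≡ 2 · g × Half) ⊎ Overshooting t → t ≡ g ⊎ t ≡ suc w · g
        values (inj₁ e) = inj₁ e
        values (inj₂ (inj₁ (_ , half))) = ⊥-elim (¬half big≡[] half)
        values (inj₂ (inj₂ (_ , e))) = inj₂ e
        ones≡ : map (_· g) parts ≡ replicate w g
        ones≡ = trans (cong (λ z → map (_· g) (replicate w 1 ++ z)) big≡[])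
          (trans (cong (map (_· g)) (++-identityʳ (replicate w 1)))
          (trans (map-replicate (_· g) w 1) (cong (replicate w) (·-homo-1 g))))

      shape-half : 2 ≤ n → big ≢ [] → Shape S r
      shape-half 2≤n big≢[] = go (two-valued T (λ t∈T → values (classify t∈T)))
        where
        values : ∀ {t} → t ≡ g ⊎ (t ≡ 2 · g × Half) ⊎ Overshooting t → t ≡ g ⊎ t ≡ 2 · g
        values (inj₁ e) = inj₁ e
        values (inj₂ (inj₁ (e , _))) = inj₂ e
        values (inj₂ (inj₂ (big≡[] , _))) = ⊥-elim (big≢[] big≡[])
        2≤sum : ∀ {xs} → xs ≢ [] → All (2 ≤_) xs → 2 ≤ sum xs
        2≤sum ≢[] [] = ⊥-elim (≢[] refl)
        2≤sum _ (h ∷ _) = ≤-trans h (m≤m+n _ _)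
        go : ∃[ k ] ∃[ l ] k + l ≡ length T × T ↭ˡ replicate k g ++ replicate l (2 · g) → Shape S r
        go (k , zero , e , p) = ⊥-elim (not-constant 2≤n p e)
        go (k , suc l , e , p) =
          [ (λ ()) , (λ (_ , half) → half-shape {k} {suc l} 2≤n half e p) ]′
          (unit-or-two (∈-resp-↭ (↭-sym p) (∈-++⁺ʳ (replicate k g) (here refl))) (s≤s z≤n)
            (≤-trans (2≤sum big≢[] 2≤big) (m≤n+m (sum big) w)))

      shape : 2 ≤ n → Shape S r
      shape 2≤n = [ shape-all-ones 2≤n , shape-half 2≤n ]′ (empty? big)
        where
        empty? : ∀ (xs : List ℕ) → xs ≡ [] ⊎ xs ≢ []
        empty? [] = inj₁ refl
        empty? (_ ∷ _) = inj₂ λ ()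

    small-shape : ∀ {T R g xs} → ZeroSum T R → R ↭ˡ map (_· g) xs → All (1 ≤_) xs →
      TorsionFreeTo g (sum xs) → 2 ≤ n → 2 * r ≤ suc n →
      (sum xs + 2 ≤ 2 * length xs ⊎ (sum xs + 1 ≤ 2 * length xs × 2 * r ≡ suc n)) → Shape S r
    small-shape {g = g} {xs} zs p pos tf 2≤n 2r≤ mean with w , big , q , 2≤big , sum≡ , len≡ ←
        by-parts p pos =
      SmallParts.shape zs q 2≤big (subst (TorsionFreeTo g) (sym sum≡) tf) 2r≤
        ([ (λ h → inj₁ (convert h)) , (λ (h , e) → inj₂ (convert h , e)) ]′ mean) 2≤n
      where
      convert : ∀ {k} → sum xs + k ≤ 2 * length xs → sum big + k ≤ w + 2 * length big
      convert {k} h = cancel-ones k w (sum big) (length big)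
        (subst₂ (λ a b → a + k ≤ 2 * b) (sym sum≡) (sym len≡) h)

    -- Reading S off the coefficients of T, for 2r at least n + 2

    module LargeZeroSum {T R : List A} {g : A} {w : ℕ} {big : List ℕ} (zs : ZeroSum T R)
        (T↭ : T ↭ˡ map (_· g) (replicate w 1 ++ big))
      (2≤big : All (2 ≤_) big) (total : w + sum big ≡ n) (gen : Generates g)
          (n+2≤2r : n + 2 ≤ 2 * r) where

      open Generates gen using (log; log-correct; 1≤log; log≤n)

      parts = replicate w 1 ++ big

      |parts| : w + length big ≡ r
      |parts| = trans (sym (trans (length-++ (replicate w 1)) (cong (_+ length big)
          (length-replicate w))))
        (trans (sym (length-map (_· g) parts)) (trans (sym (↭-length T↭)) (size zs)))

      sum-parts : sum parts ≡ n
      sum-parts = trans (sum-++ (replicate w 1) big)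
        (trans (cong (_+ sum big) (trans (sum-replicate w 1) (*-identityʳ w))) total)

      mean : w + sum big + 2 ≤ 2 * (w + length big)
      mean = subst₂ (λ a b → a + 2 ≤ 2 * b) (sym total) (sym |parts|) n+2≤2r

      cover : Covering parts
      cover = covering-ones++ (parts≤ 2≤big (mean<2 w (sum big) (length big) mean))

      selection-length : ∀ {c} ys zs → c ∈ˡ R → c ≡ sum ys · g → parts ↭ˡ ys ++ zs → length ys ≡ 1
      selection-length {c} ys zs′ c∈R c≡ p with R′ , q ← extract c∈R =
          trans (sym (length-map (_· g) ys))
        (exchange (map (_· g) ys) (map (_· g) zs′) [ c ] R′ zs
          (↭-trans T↭ (↭-trans (map⁺ (_· g) p) (↭-reflexive (map-++ (_· g) ys zs′)))) q
          (trans (σ-multiples g ys) (trans (sym c≡) (sym (⊕-identityʳ c)))) λ ())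

      ones-selected : ∀ {k} → k ≤ w → parts ↭ˡ replicate k 1 ++ (replicate (w ∸ k) 1 ++ big)
      ones-selected {k} k≤w = ↭-trans (↭-reflexive (cong (_++ big) (replicate-≤ 1 k≤w)))
          (++-assoc (replicate k 1) _ big)

      -- Here an element s g of R is exchanged for parts of T with sum s, so one part must suffice.
      -- When s ≤ w, s ones can be used, hence s = 1. When s > w, s is itself a part; the mean below
      -- 2 bounds every big part by w, so it is not a big one.
      log≡1 : ∀ {c} → c ∈ˡ R → log c ≡ 1
      log≡1 {c} c∈R = [ few , many ]′ (≤-<-connex (log c) w)
        where
        few : log c ≤ w → log c ≡ 1
        few s≤w = trans (sym (length-replicate (log c))) (selection-length (replicate (log c) 1) _
            c∈R
          (trans (log-correct c) (cong (_· g) (sym (trans (sum-replicate (log c) 1)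
              (*-identityʳ (log c)))))) (ones-selected s≤w))
        many : w < log c → log c ≡ 1
        many w<s = let ys , zs′ , p , sum≡ = cover (log c) (subst (log c ≤_) (sym sum-parts)
                         (log≤n c))
                       len = selection-length ys zs′ c∈R (trans (log-correct c)
                           (cong (_· g) (sym sum≡))) p
                   in [ All.lookup (All.replicate⁺ {P = _≡ 1} w refl) , (λ s∈ → ⊥-elim (large s∈))
                       ]′
                      (∈-++⁻ (replicate w 1) (∈-resp-↭ (↭-sym p)
                          (∈-++⁺ˡ (singleton∋sum ys len sum≡))))
          where
          large : log c ∈ˡ big → ⊥
          large s∈ with big′ , q ← extract s∈ with _ ∷ 2≤big′ ← All-resp-↭ q 2≤big =
            <⇒≱ w<s (large-part≤w w (log c) (sum big′) (length big′)
              (subst₂ (λ a b → w + a + 2 ≤ 2 * (w + b)) (sum-↭ q) (↭-length q) mean)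
                  (2*length≤sum 2≤big′))

      q = length R

      R≡ : R ≡ replicate q g
      R≡ = all-equal λ {c} c∈R → trans (log-correct c) (trans (cong (_· g) (log≡1 c∈R))
          (·-homo-1 g))

      w≡ : ∀ {k} → w + k ≡ r → k ≡ 0 → w ≡ r
      w≡ {k} e refl = trans (sym (+-identityʳ w)) e

      no-big : ∀ b → big ≡ b → length b ≡ 0 → Shape S r
      no-big [] refl _ = almost-constant {x = (w ∸ 1) + q} gen x+1≡n S↭
        where
        w≡r : w ≡ r
        w≡r = w≡ |parts| refl
        1+w∸1≡w : 1 + (w ∸ 1) ≡ w
        1+w∸1≡w = m+[n∸m]≡n (subst (1 ≤_) (sym w≡r) 1≤r)
        x+1≡n : (w ∸ 1) + q + 1 ≡ n
        x+1≡n = trans (+-comm _ 1) (trans (cong (_+ q) (trans 1+w∸1≡w w≡r)) (trans (+-comm r q)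
            (complement-size zs)))
        S↭ : S ↭ˡ replicate ((w ∸ 1) + q) g ++ [ g ]
        S↭ = ↭-trans (split zs) (↭-trans (++⁺ T↭ (↭-reflexive R≡))
            (↭-trans (↭-reflexive (cong (_++ replicate q g)
              (trans (cong (map (_· g)) (trans (++-identityʳ (replicate w 1))
                  (cong (λ z → replicate z 1) (sym 1+w∸1≡w))))
                (trans (map-replicate (_· g) (1 + (w ∸ 1)) 1) (cong (replicate (1 + (w ∸ 1)))
                    (·-homo-1 g))))))
            (↭-trans (↭-reflexive (cong (g ∷_) (sym (replicate-+ (w ∸ 1) q g))))
                (++-comm [ g ] (replicate ((w ∸ 1) + q) g)))))

      one-big : ∀ x → big ≡ x ∷ [] → Shape S r
      one-big x refl = almost-constant {x = w + q} {b = x · g} gen x+1≡n S↭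
        where
        x+1≡n : w + q + 1 ≡ n
        x+1≡n = trans (+-assoc w q 1) (trans (cong (w +_) (+-comm q 1)) (trans (sym (+-assoc w 1 q))
          (trans (cong (_+ q) |parts|) (trans (+-comm r q) (complement-size zs)))))
        S↭ : S ↭ˡ replicate (w + q) g ++ [ x · g ]
        S↭ = ↭-trans (split zs) (↭-trans (++⁺ T↭ (↭-reflexive R≡))
          (↭-trans (↭-reflexive (cong (_++ replicate q g) (trans (map-++ (_· g) (replicate w 1) [ x
              ])
            (cong (_++ [ x · g ]) (trans (map-replicate (_· g) w 1) (cong (replicate w)
                (·-homo-1 g)))))))
          (↭-trans (solve 3 (λ u v s → (u ⊕′ v) ⊕′ s ⊜ (u ⊕′ s) ⊕′ v) ↭-refl (replicate w g) [
              x · g ] (replicate q g))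
            (↭-reflexive (cong (_++ [ x · g ]) (sym (replicate-+ w q g)))))))
          where open ++-Solver renaming (_⊕_ to _⊕′_)

      -- All of R being g^q, a big part x ≤ q could be exchanged for x copies of g. So x > q = n -
      -- r, and r coefficients with sum n then admit no second big part.
      some-big : ∀ x xs → big ≡ x ∷ xs → Shape S r
      some-big x xs refl = [ small , large ]′ (≤-<-connex x q)
        where
        2≤x : 2 ≤ x
        2≤x = All.head 2≤big
        small : x ≤ q → Shape S r
        small x≤q = ⊥-elim (<⇒≢ 2≤x (trans (exchange [ x · g ] (map (_· g) (replicate w 1 ++ xs))
            (replicate x g) (replicate (q ∸ x) g) zs
          (↭-trans T↭ (map⁺ (_· g) (shift x (replicate w 1) xs)))
              (↭-reflexive (trans R≡ (replicate-≤ g x≤q)))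
          (trans (⊕-identityʳ _) (sym (σ-replicate x g))) λ e → <⇒≢ (≤-trans (s≤s z≤n) 2≤x)
              (sym (trans (sym (length-replicate x)) (cong length e))))
          (length-replicate x)))
        large : q < x → Shape S r
        large q<x = one-big x (cong (x ∷_) (empty xs (last-part n r w x (sum xs) (length xs) q
            total |parts| (complement-size zs)
          (2*length≤sum (All.tail 2≤big)) q<x)))
          where
          empty : ∀ (xs : List ℕ) → length xs ≡ 0 → xs ≡ []
          empty [] _ = refl

      shape : Shape S r
      shape = go big refl
        where
        go : ∀ b → big ≡ b → Shape S r
        go [] e = no-big [] e refl
        go (x ∷ xs) e = some-big x xs e

    -- The coefficient sum of t T is a multiple of n. The logarithm of t is at most n and the other
    -- coefficients add up to less than n, so the sum is exactly n.
    large-shape : ∀ {t T R g ys} → ZeroSum (t ∷ T) R → T ↭ˡ map (_· g) ys → All (1 ≤_) ys →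
      TorsionFreeTo g (sum ys) → n + 2 ≤ 2 * r → Shape S r
    large-shape {t} {T} {R} {g} {ys} zs p pos tf n+2≤2r =
      let w , big , q , 2≤big , sum≡ , _ = by-parts {xs = log t ∷ ys} t∷T↭ (1≤log t ∷ pos)
      in LargeZeroSum.shape zs q 2≤big (trans sum≡ total) gen n+2≤2r
      where
      1+|ys|≡r : suc (length ys) ≡ r
      1+|ys|≡r = trans (cong suc (trans (sym (length-map (_· g) ys)) (sym (↭-length p)))) (size zs)
      gen : Generates g
      gen = generates tf (≤-trans (≤-trans (n≤1+n _) (≤-reflexive (+-comm 2 n))) (≤-trans n+2≤2r
        (≤-trans (≤-reflexive (cong (2 *_) (sym 1+|ys|≡r))) (*-monoʳ-≤ 2 (s≤s (length≤sum pos))))))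
      open Generates gen
      t∷T↭ : t ∷ T ↭ˡ map (_· g) (log t ∷ ys)
      t∷T↭ = ↭-trans (prep t p) (↭-reflexive (cong (_∷ map (_· g) ys) (log-correct t)))
      total : log t + sum ys ≡ n
      total = order-unique (≤-trans (1≤log t) (m≤m+n _ _)) (+-mono-≤-< (log≤n t)
          (torsionFree-<n tf))
        (trans (sym (σ-multiples g (log t ∷ ys))) (trans (sym (σ-↭ t∷T↭)) (sum≡𝟘 zs)))

    μ : A
    μ = σ S

    σ-complement : ∀ {T R} → ZeroSum T R → σ R ≡ μ
    σ-complement {T} {R} zs = sym (trans (σ-split {ys = T} (split zs))
        (trans (cong (_⊕ σ R) (sum≡𝟘 zs)) (⊕-identityˡ _)))

    1+r∸1≡r : suc (r ∸ 1) ≡ r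
    1+r∸1≡r = m+[n∸m]≡n 1≤r

    constant-torsionFree : ∀ {t R} → ZeroSum (replicate r t) R → TorsionFreeTo t (r ∸ 1)
    constant-torsionFree {t} {R} zs j 1≤j j≤r∸1 e = <⇒≢ j<r (trans (sym (length-replicate j))
      (unique (replicate j t) (replicate (r ∸ j) t ++ R)
        (↭-trans (split zs) (↭-trans (↭-reflexive (cong (_++ R) (replicate-≤ t (<⇒≤ j<r))))
            (++-assoc (replicate j t) _ R)))
        (trans (σ-replicate j t) e) λ eq → <⇒≢ 1≤j (sym (trans (sym (length-replicate j))
            (cong length eq)))))
      where
      j<r : j < r
      j<r = subst (j <_) 1+r∸1≡r (s≤s j≤r∸1)

    infixl 1 _>>=_
    -- `Shape S r` acts as an exception: each step either finishes the classification or hands on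
    -- further information.
    _>>=_ : ∀ {X Y : Set} → Shape S r ⊎ X → (X → Shape S r ⊎ Y) → Shape S r ⊎ Y
    m >>= f = [ inj₁ , f ]′ m

    -- The case n = 2r

    module Balanced (n≡2r : n ≡ 2 * r) (2≤r : 2 ≤ r) where

      2≤n : 2 ≤ n
      2≤n = ≤-trans 2≤r (≤-trans (m≤m+n r (r + 0)) (≤-reflexive (sym n≡2r)))

      |R|≡r : ∀ {T R} → ZeroSum T R → length R ≡ r
      |R|≡r {R = R} zs = equal-complement n r (length R) (complement-size zs) n≡2r

      -- R is zero-sum free and nonempty, so its sum, which is μ, cannot vanish.
      μ≢𝟘 : ∀ {T R} → ZeroSum T R → μ ≢ 𝟘
      μ≢𝟘 {T} {R} zs e = <⇒≢ 1≤r
          (trans (cong length (sym (complement-zeroFree zs R [] (↭-reflexive (sym (++-identityʳ R)))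
        (trans (σ-complement zs) e)))) (|R|≡r zs))

      Full : List A → Set
      Full R = ∀ x → Subsum R x

      -- Here 2|R| = n is exactly |G|, so a complement that misses even one element already
      -- satisfies the bound of the structure theorem.
      shape-or-full : ∀ {T R} → ZeroSum T R → Shape S r ⊎ Full R
      shape-or-full {T} {R} zs with ≤-<-connex n (card R)
      ... | inj₁ n≤card = inj₂ full
        where
        full : Full R
        full x with subsum? R x
        ... | yes p = p
        ... | no ∉ = ⊥-elim (<⇒≱ (missing ∉) n≤card)
      ... | inj₂ card<n = inj₁ (small-shape zs γ↭ positive torsionFree 2≤n
          (≤-trans (≤-reflexive (sym n≡2r)) (n≤1+n n))
            (inj₁ (≤-trans (≤-reflexive (+-comm (sum xs) 2)) (≤-trans (s≤s sum<card)
                (≤-trans card<n (≤-reflexive n≡2|xs|))))))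
        where
        n≡2|R| : n ≡ 2 * length R
        n≡2|R| = trans n≡2r (cong (2 *_) (sym (|R|≡r zs)))
        open Behaving (structure R (complement-zeroFree zs) (≤-trans card<n (≤-reflexive n≡2|R|)))
        n≡2|xs| : n ≡ 2 * length xs
        n≡2|xs| = trans n≡2|R| (cong (2 *_) length≡)

      ∈⇒≢𝟘 : ∀ {T R t} → ZeroSum T R → t ∈ˡ T → t ≢ 𝟘
      ∈⇒≢𝟘 {R = R} {t} zs t∈T t≡𝟘 with T′ , q ← extract t∈T = <⇒≢ 2≤r
        (unique [ t ] (T′ ++ R) (↭-trans (split zs) (++⁺ʳ R q)) (trans (⊕-identityʳ t) t≡𝟘) λ ())

      -- Fullness writes t as a sum over some R′ inside R, nonempty because t ≠ 𝟘; exchanging t for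
      -- R′ shows that R′ is a single term.
      full⇒∈ : ∀ {T R} → ZeroSum T R → Full R → ∀ {t} → t ∈ˡ T → t ∈ˡ R
      full⇒∈ {T} {R} zs full {t} t∈T with T′ , q ← extract t∈T | R′ , R″ , p , σ≡ ← full t =
        single R′ p σ≡ (exchange [ t ] T′ R′ R″ zs q p (trans (⊕-identityʳ t) (sym σ≡))
          λ { refl → ∈⇒≢𝟘 zs t∈T (sym σ≡) })
        where
        single : ∀ R′ → R ↭ˡ R′ ++ R″ → σ R′ ≡ t → 1 ≡ length R′ → t ∈ˡ R
        single (ρ ∷ []) p σ≡ _ = ∈-resp-↭ (↭-sym p) (here (trans (sym σ≡) (⊕-identityʳ ρ)))

      -- Take R′ inside R with sum -t. Then t R′ is zero-sum, so it has length r = |R| and R′ leaves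
      -- out just one term of R, namely σ(R) - σ(R′) = μ + t. The new zero-sum sequence t R′, with
      -- complement (t + μ) T′, is the move that the rest of this case iterates.
      full⇒partner : ∀ {t T T′ R} → ZeroSum T R → Full R → T ↭ˡ t ∷ T′ →
        ∃[ R′ ] R ↭ˡ (t ⊕ μ) ∷ R′ × ZeroSum (t ∷ R′) ((t ⊕ μ) ∷ T′)
      full⇒partner {t} {T} {T′} {R} zs full q with R′ , R″ , p , σ≡ ← full (⊖ t) =
          single R″ p |R″|≡1
        where
        S↭ : ∀ R″ → R ↭ˡ R′ ++ R″ → S ↭ˡ (t ∷ R′) ++ (T′ ++ R″)
        S↭ R″ p = ↭-trans (split zs) (↭-trans (++⁺ q p) (prep t (shifts T′ R′)))
        sum-zero : σ (t ∷ R′) ≡ 𝟘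
        sum-zero = trans (cong (t ⊕_) σ≡) (⊕-inverseʳ t)
        size′ : suc (length R′) ≡ r
        size′ = unique (t ∷ R′) (T′ ++ R″) (S↭ R″ p) sum-zero λ ()
        |R″|≡1 : length R″ ≡ 1
        |R″|≡1 = +-cancelˡ-≡ (length R′) _ _ (trans (sym (length-++ R′)) (trans (sym (↭-length p))
          (trans (|R|≡r zs) (trans (sym size′) (+-comm 1 (length R′))))))
        single : ∀ R″ → R ↭ˡ R′ ++ R″ → length R″ ≡ 1 → ∃[ R′ ] R ↭ˡ (t ⊕ μ) ∷ R′ × ZeroSum
            (t ∷ R′) ((t ⊕ μ) ∷ T′)
        single (a ∷ []) p _ = R′ , ↭-trans p (↭-trans (++-comm R′ [ a ])
            (↭-reflexive (cong (_∷ R′) a≡))) ,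
          zeroSum (↭-trans (S↭ (a ∷ []) p) (++⁺ˡ (t ∷ R′) (↭-trans (++-comm T′ [ a ])
              (↭-reflexive (cong (_∷ T′) a≡))))) sum-zero size′
          where
          a≡ : a ≡ t ⊕ μ
          a≡ = sym (begin
            t ⊕ μ                  ≡⟨ cong (t ⊕_) (trans (sym (σ-complement zs)) (σ-split {ys = R′}
                p)) ⟩
            t ⊕ (σ R′ ⊕ (a ⊕ 𝟘))   ≡⟨ ⊕-assoc t _ _ ⟨
            t ⊕ σ R′ ⊕ (a ⊕ 𝟘)     ≡⟨ cong₂ _⊕_ sum-zero (⊕-identityʳ a) ⟩
            𝟘 ⊕ a                  ≡⟨ ⊕-identityˡ a ⟩
            a                      ∎)
            where open ≡-Reasoning

      -- After the partner move R′ belongs to a zero-sum sequence with complement (t + μ) T′;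
      -- fullness of this complement puts every term of R′ into it.
      complement-values : ∀ {t T T′ R} → ZeroSum T R → T ↭ˡ t ∷ T′ →
        Shape S r ⊎ (∀ {ρ} → ρ ∈ˡ R → ρ ∈ˡ T ⊎ ρ ≡ t ⊕ μ)
      complement-values {t} {T} {T′} {R} zs q =
        shape-or-full zs >>= λ full → let R′ , p , zs₁ = full⇒partner zs full q in
        shape-or-full zs₁ >>= λ full₁ → inj₂ λ ρ∈R → values p zs₁ full₁ (∈-resp-↭ p ρ∈R)
        where
        values : ∀ {R′ ρ} → R ↭ˡ (t ⊕ μ) ∷ R′ → ZeroSum (t ∷ R′) ((t ⊕ μ) ∷ T′) →
            Full ((t ⊕ μ) ∷ T′) →
          ρ ∈ˡ (t ⊕ μ) ∷ R′ → ρ ∈ˡ T ⊎ ρ ≡ t ⊕ μ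
        values p zs₁ full₁ (here ρ≡) = inj₂ ρ≡
        values p zs₁ full₁ (there ρ∈R′) with full⇒∈ zs₁ full₁ (there ρ∈R′)
        ... | here ρ≡ = inj₂ ρ≡
        ... | there ρ∈T′ = inj₁ (∈-resp-↭ (↭-sym q) (there ρ∈T′))

      Constant : Set
      Constant = ∃[ t ] ∃[ R ] ZeroSum (replicate r t) R

      constant : ∀ {t T R} → ZeroSum (t ∷ T) R → t ∷ T ≡ replicate (suc (length T)) t → Constant
      constant {t} {T} {R} zs eq =
        t , R , subst (λ Z → ZeroSum Z R) (trans eq (cong (λ k → replicate k t) (size zs))) zs

      module _ (e : A) (e∈S : e ∈ˡ S) where

        count : List A → ℕ
        count xs = length (filter (e Fin.≟_) xs)

        count-↭ : ∀ {xs ys} → xs ↭ˡ ys → count xs ≡ count ys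
        count-↭ p = ↭-length (filter-↭ (e Fin.≟_) p)

        count-self : ∀ xs → count (e ∷ xs) ≡ suc (count xs)
        count-self xs = cong length (filter-accept (e Fin.≟_) {e} {xs} refl)

        count-other : ∀ {x} xs → e ≢ x → count (x ∷ xs) ≡ count xs
        count-other {x} xs e≢x = cong length (filter-reject (e Fin.≟_) {x} {xs} e≢x)

        count-tail≤ : ∀ x xs → count xs ≤ count (x ∷ xs)
        count-tail≤ x xs with e Fin.≟ x
        ... | yes _ = n≤1+n (count xs)
        ... | no _ = ≤-refl

        Progress : List A → Set
        Progress T = Constant ⊎ (∃[ T₂ ] ∃[ R₂ ] ZeroSum T₂ R₂ × count T₂ < count T)

        -- A non-constant T contains e: an element of the complement outside T would be
        -- both t + μ and y + μ.  Swapping e for e + μ, and then y + μ back for y, where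
        -- y ≠ e, lowers the multiplicity of e.
        progress : ∀ T {R} → ZeroSum T R → Shape S r ⊎ Progress T
        progress [] zs = ⊥-elim (<⇒≢ 1≤r (size zs))
        progress (t ∷ T₀) {R} zs with constant-or-distinct Fin._≟_ t T₀
        ... | inj₁ eq = inj₂ (inj₁ (constant zs eq))
        ... | inj₂ (y , ys , t≢y , p) =
          complement-values zs ↭-refl >>= λ values-t →
          complement-values zs (↭-trans (prep t p) (↭.swap t y ↭-refl)) >>= λ values-y →
          shape-or-full zs >>= λ full →
          let T′ , q = extract (e∈T values-t values-y (∈-++⁻ (t ∷ T₀) (∈-resp-↭ (split zs) e∈S)))
              R′ , R↭ , zs₁ = full⇒partner zs full q
          in continue q zs₁ (constant-or-distinct Fin._≟_ e R′)
          where
          e∈T : (∀ {ρ} → ρ ∈ˡ R → ρ ∈ˡ t ∷ T₀ ⊎ ρ ≡ t ⊕ μ) → (∀ {ρ} → ρ ∈ˡ R → ρ ∈ˡ t ∷ T₀ ⊎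
              ρ ≡ y ⊕ μ) →
                e ∈ˡ t ∷ T₀ ⊎ e ∈ˡ R → e ∈ˡ t ∷ T₀
          e∈T _ _ (inj₁ e∈) = e∈
          e∈T values-t values-y (inj₂ e∈R) with values-t e∈R | values-y e∈R
          ... | inj₁ e∈ | _ = e∈
          ... | inj₂ _ | inj₁ e∈ = e∈
          ... | inj₂ e≡ | inj₂ e≡′ = ⊥-elim (t≢y (⊕-cancelʳ μ _ _ (trans (sym e≡) e≡′)))
          e≢e+μ : e ≢ e ⊕ μ
          e≢e+μ eq = μ≢𝟘 zs (⊕-cancelˡ e _ _ (trans (sym eq) (sym (⊕-identityʳ e))))
          continue : ∀ {T′ R′} → t ∷ T₀ ↭ˡ e ∷ T′ → ZeroSum (e ∷ R′) ((e ⊕ μ) ∷ T′) →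
            e ∷ R′ ≡ replicate (suc (length R′)) e ⊎ (∃[ y ] ∃[ ys ] e ≢ y × R′ ↭ˡ y ∷ ys) →
            Shape S r ⊎ Progress (t ∷ T₀)
          continue q zs₁ (inj₁ eq) = inj₂ (inj₁ (constant zs₁ eq))
          continue {T′} {R′} q zs₁ (inj₂ (y , ys , e≢y , p)) =
            shape-or-full zs₁ >>= λ full₁ →
            let R₁ , R₁↭ , zs₂ = full⇒partner zs₁ full₁ (↭-trans (prep e p) (↭.swap e y ↭-refl))
            in inj₂ (inj₂ (y ∷ R₁ , _ , zs₂ , (begin-strict
              count (y ∷ R₁)       ≡⟨ count-other R₁ e≢y ⟩
              count R₁             ≤⟨ count-tail≤ (y ⊕ μ) R₁ ⟩
              count (y ⊕ μ ∷ R₁)   ≡⟨ count-↭ R₁↭ ⟨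
              count (e ⊕ μ ∷ T′)   ≡⟨ count-other T′ e≢e+μ ⟩
              count T′             <⟨ ≤-refl ⟩
              suc (count T′)       ≡⟨ count-self T′ ⟨
              count (e ∷ T′)       ≡⟨ count-↭ q ⟨
              count (t ∷ T₀)       ∎)))
            where open ≤-Reasoning

        reach-constant : ∀ k T {R} → ZeroSum T R → count T ≤ k → Shape S r ⊎ Constant
        reach-constant k T zs c≤k = progress T zs >>= λ
          { (inj₁ const) → inj₂ const
          ; (inj₂ (T₂ , _ , zs₂ , c<)) → again k T₂ zs₂ (≤-trans c< c≤k) }
          where
          again : ∀ k T₂ {R₂} → ZeroSum T₂ R₂ → count T₂ < k → Shape S r ⊎ Constant
          again (suc k) T₂ zs₂ c<k = reach-constant k T₂ zs₂ (s≤s⁻¹ c<k)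

      module _ {t : A} {R : List A} (zs : ZeroSum (replicate r t) R) where

        private
          b : A
          b = t ⊕ μ

          T′ : List A
          T′ = replicate (r ∸ 1) t

          T↭ : replicate r t ↭ˡ t ∷ T′
          T↭ = ↭-reflexive (cong (λ k → replicate k t) (sym 1+r∸1≡r))

          r·t≡𝟘 : r · t ≡ 𝟘
          r·t≡𝟘 = trans (sym (σ-replicate r t)) (sum≡𝟘 zs)

          -- The union of ⟨t⟩ and ⟨t⟩ + b. Since R is full and its terms are t and b, showing that
          -- its subset sums stay in this union makes the union all of G.
          Coset : A → Set
          Coset z = ∃[ i ] (z ≡ i · t ⊎ z ≡ i · t ⊕ b)

          coset-t : ∀ {z} → Coset z → Coset (t ⊕ z)
          coset-t (i , inj₁ refl) = suc i , inj₁ refl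
          coset-t (i , inj₂ refl) = suc i , inj₂ (sym (⊕-assoc t _ _))

          coset-b : 2 · b ≡ 2 · t → ∀ {z} → Coset z → Coset (b ⊕ z)
          coset-b _ (i , inj₁ refl) = i , inj₂ (⊕-comm b _)
          coset-b 2b≡2t (i , inj₂ refl) = 2 + i , inj₁ (begin
            b ⊕ (i · t ⊕ b)    ≡⟨ solve 2 (λ b x → b ⊙ (x ⊙ b) ⊜ (b ⊙ (b ⊙ id)) ⊙ x) refl b
                (i · t) ⟩
            2 · b ⊕ i · t      ≡⟨ cong (_⊕ i · t) 2b≡2t ⟩
            2 · t ⊕ i · t      ≡⟨ ·-homo-+ t 2 i ⟨
            (2 + i) · t        ∎)
            where
            open ≡-Reasoning
            open ⊕-Solver renaming (_⊕_ to _⊙_)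

          subsum-∷⁻ : ∀ {c γ x} → Subsum (c ∷ γ) x → Subsum γ x ⊎ (∃[ y ] Subsum γ y × x ≡ c ⊕ y)
          subsum-∷⁻ {c} {γ} s with ∈-++⁻ (subsums γ) (∈-subsums⁺ (c ∷ γ) s)
          ... | inj₁ p = inj₁ (∈-subsums⁻ γ p)
          ... | inj₂ p with y , y∈ , e ← ∈-map⁻ (c ⊕_) p = inj₂ (y , ∈-subsums⁻ γ y∈ , e)

          coset-prefix : ∀ {c} → (∀ {z} → Coset z → Coset (c ⊕ z)) → ∀ k γ →
            (∀ {z} → Subsum γ z → Coset z) → ∀ {z} → Subsum (replicate k c ++ γ) z → Coset z
          coset-prefix step zero γ base s = base s
          coset-prefix step (suc k) γ base s with subsum-∷⁻ s
          ... | inj₁ s′ = coset-prefix step k γ base s′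
          ... | inj₂ (y , s′ , refl) = step (coset-prefix step k γ base s′)

          coset-[] : ∀ {z} → Subsum [] z → Coset z
          coset-[] s with here refl ← ∈-subsums⁺ [] s = 0 , inj₁ refl

          coset-[b] : ∀ {z} → Subsum [ b ] z → Coset z
          coset-[b] s with subsum-∷⁻ s
          ... | inj₁ s′ = coset-[] s′
          ... | inj₂ (y , s′ , refl) with here refl ← ∈-subsums⁺ [] s′ = 0 , inj₂ (⊕-comm b 𝟘)

          -- Otherwise every element would be a multiple of t, although r t = 𝟘 and r < n.
          b∉⟨t⟩ : (∀ z → Coset z) → ∀ i → b ≢ i · t
          b∉⟨t⟩ coset i b≡ = <⇒≱ (m<m+n r 1≤r)
              (≤-trans (≤-reflexive (trans (cong (r +_) (sym (+-identityʳ r))) (sym n≡2r)))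
            (≤-trans (order-≥n (trans (cong (_· t) 1+r∸1≡r) r·t≡𝟘) λ z → multiple (coset z))
                (≤-reflexive 1+r∸1≡r)))
            where
            multiple : ∀ {z} → Coset z → ∃[ k ] z ≡ k · t
            multiple (k , inj₁ e) = k , e
            multiple (k , inj₂ e) = k + i , trans e (trans (cong (k · t ⊕_) b≡)
                (sym (·-homo-+ t k i)))

          assemble : ∀ {k l} → Full R → R ↭ˡ replicate k t ++ replicate (suc l) b →
            (∀ z → Coset z) → (suc l ≡ 1 ⊎ (∃[ h ] suc l ≡ 1 + h * 2 × 2 · b ≡ 2 · t × suc l ≤ r))
                → Shape S r
          assemble {k} {l} full R↭ coset shape = index-two {x = r + k} {y = suc l} n≡2r
            (λ j 1≤j j<r → constant-torsionFree zs j 1≤j (s≤s⁻¹ (subst (j <_) (sym 1+r∸1≡r) j<r)))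
            r·t≡𝟘 (b∉⟨t⟩ coset) coset
            (trans (+-assoc r k (suc l)) (trans (cong (r +_) k+l≡r)
                (trans (cong (r +_) (sym (+-identityʳ r))) (sym n≡2r))))
            (↭-trans (split zs) (↭-trans (++⁺ˡ (replicate r t) R↭) (↭-reflexive
              (trans (sym (++-assoc≡ (replicate r t) _ _)) (cong (_++ replicate (suc l) b)
                  (sym (replicate-+ r k t)))))))
            shape
            where
            k+l≡r : k + suc l ≡ r
            k+l≡r = trans (sym (trans (length-++ (replicate k t)) (cong₂ _+_ (length-replicate k)
                (length-replicate (suc l)))))
              (trans (sym (↭-length R↭)) (|R|≡r zs))

          -- With 2 b = 2 t an even number of terms b may be replaced by t in the sum of R, so that
          -- μ = r t = 𝟘.
          odd-multiplicity : ∀ {k} h → R ↭ˡ replicate k t ++ replicate (h * 2) b → k + h * 2 ≡ r →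
              2 · b ≢ 2 · t
          odd-multiplicity {k} h R↭ k+y≡r 2b≡2t = μ≢𝟘 zs (begin
            μ                            ≡⟨ σ-complement zs ⟨
            σ R                          ≡⟨ trans (σ-↭ R↭) (σ-++ (replicate k t) _) ⟩
            σ (replicate k t) ⊕ σ (replicate (h * 2) b)
                ≡⟨ cong₂ _⊕_ (σ-replicate k t) (σ-replicate (h * 2) b) ⟩
            k · t ⊕ (h * 2) · b          ≡⟨ cong (k · t ⊕_) (·-assocˡ b h 2) ⟨
            k · t ⊕ h · (2 · b)          ≡⟨ cong (λ z → k · t ⊕ h · z) 2b≡2t ⟩
            k · t ⊕ h · (2 · t)          ≡⟨ cong (k · t ⊕_) (·-assocˡ t h 2) ⟩
            k · t ⊕ (h * 2) · t          ≡⟨ ·-homo-+ t k (h * 2) ⟨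
            (k + h * 2) · t              ≡⟨ cong (_· t) k+y≡r ⟩
            r · t                        ≡⟨ r·t≡𝟘 ⟩
            𝟘                            ∎)
            where open ≡-Reasoning

          -- A second partner move, now for the term b of t R′, finds b + μ in the complement b T′.
          -- As μ ≠ 𝟘 this term is t, and 2 b = b + (t + μ) = t + (b + μ) = 2 t.
          doubled : ∀ {k l R′} → R′ ↭ˡ replicate k t ++ replicate (suc l) b → ZeroSum (t ∷ R′)
              (b ∷ T′) →
            Full (b ∷ T′) → 2 · b ≡ 2 · t
          doubled {k} {l} {R′} R′↭ zs₁ full₁
            with _ , p , _ ← full⇒partner {t = b} {T′ = t ∷ replicate k t ++ replicate l b} zs₁
                full₁
              (↭-trans (prep t (↭-trans R′↭ (shift b (replicate k t) (replicate l b))))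
                  (↭.swap t b ↭-refl)) =
            case (∈-resp-↭ (↭-sym p) (here refl))
            where
            2b : b ⊕ μ ≡ t → 2 · b ≡ 2 · t
            2b e = begin
              b ⊕ (b ⊕ 𝟘)         ≡⟨ cong (b ⊕_) (⊕-identityʳ b) ⟩
              b ⊕ (t ⊕ μ)         ≡⟨ solve 3 (λ b t m → b ⊙ (t ⊙ m) ⊜ t ⊙ (b ⊙ m)) refl b t μ ⟩
              t ⊕ (b ⊕ μ)         ≡⟨ cong (t ⊕_) (trans e (sym (⊕-identityʳ t))) ⟩
              t ⊕ (t ⊕ 𝟘)         ∎
              where
              open ≡-Reasoning
              open ⊕-Solver renaming (_⊕_ to _⊙_)
            case : b ⊕ μ ∈ˡ b ∷ T′ → 2 · b ≡ 2 · t
            case (here e) = ⊥-elim (μ≢𝟘 zs (⊕-cancelˡ b _ _ (trans e (sym (⊕-identityʳ b)))))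
            case (there ∈T′) = 2b (All.lookup (All.replicate⁺ {P = _≡ t} (r ∸ 1) refl) ∈T′)

          finish : ∀ {k l R′} → Full R → R ↭ˡ b ∷ R′ → R′ ↭ˡ replicate k t ++ replicate l b →
            ZeroSum (t ∷ R′) (b ∷ T′) → Shape S r ⊎ Shape S r
          finish {k} {zero} full R↭ R′↭ zs₁ = inj₂ (assemble {k} {0} full R↭′
              (λ z → coset-prefix coset-t k [ b ] coset-[b] (subsum-resp-↭ R↭′ (full z)))
                  (inj₁ refl))
            where
            R↭′ : R ↭ˡ replicate k t ++ [ b ]
            R↭′ = ↭-trans R↭ (↭-trans
                (prep b (↭-trans R′↭ (↭-reflexive (++-identityʳ (replicate k t)))))
              (++-comm [ b ] (replicate k t)))
          finish {k} {suc l} {R′} full R↭ R′↭ zs₁ = shape-or-full zs₁ >>= λ full₁ →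
            let 2b≡2t = doubled {k} {l} R′↭ zs₁ full₁ in
            inj₂ (assemble {k} {suc l} full R↭′
              (λ z → coset-prefix coset-t k (replicate (2 + l) b)
                (coset-prefix (coset-b 2b≡2t) (2 + l) [] coset-[] ∘ subsum-resp-↭
                    (↭-reflexive (sym (++-identityʳ (replicate (2 + l) b)))))
                (subsum-resp-↭ R↭′ (full z)))
              (inj₂ (odd 2b≡2t (even-or-odd (2 + l)))))
            where
            R↭′ : R ↭ˡ replicate k t ++ replicate (2 + l) b
            R↭′ = ↭-trans R↭ (↭-trans (prep b R′↭)
                (↭-sym (shift b (replicate k t) (replicate (suc l) b))))
            k+l≡r : k + (2 + l) ≡ r
            k+l≡r = trans (sym (trans (length-++ (replicate k t)) (cong₂ _+_ (length-replicate k)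
                (length-replicate (2 + l)))))
              (trans (sym (↭-length R↭′)) (|R|≡r zs))
            odd : 2 · b ≡ 2 · t → (∃[ h ] 2 + l ≡ h * 2) ⊎ (∃[ h ] 2 + l ≡ 1 + h * 2) →
              ∃[ h ] 2 + l ≡ 1 + h * 2 × 2 · b ≡ 2 · t × 2 + l ≤ r
            odd 2b≡2t (inj₁ (h , e)) = ⊥-elim (odd-multiplicity {k} h
              (subst (λ z → R ↭ˡ replicate k t ++ replicate z b) e R↭′)
                  (trans (cong (k +_) (sym e)) k+l≡r) 2b≡2t)
            odd 2b≡2t (inj₂ (h , e)) = h , e , 2b≡2t , ≤-trans (m≤n+m (2 + l) k) (≤-reflexive k+l≡r)

        constant-shape : Shape S r
        constant-shape = [ (λ s → s) , (λ s → s) ]′ (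
          shape-or-full zs >>= λ full →
          complement-values zs T↭ >>= λ values →
          let R′ , R↭ , zs₁ = full⇒partner zs full T↭
              k , l , _ , R′↭ = two-valued R′ λ ρ∈ →
                [ (λ ρ∈T → inj₁ (All.lookup (All.replicate⁺ {P = _≡ t} r refl) ρ∈T)) , inj₂ ]′
                  (values (∈-resp-↭ (↭-sym R↭) (there ρ∈)))
          in finish {k} {l} full R↭ R′↭ zs₁)

      shape : ∀ {T R} → ZeroSum T R → Shape S r
      shape {[]} zs = ⊥-elim (<⇒≢ 1≤r (size zs))
      shape {t ∷ T} zs =
        [ (λ s → s) , (λ (_ , _ , zs′) → constant-shape zs′) ]′
          (reach-constant t (∈-resp-↭ (↭-sym (split zs)) (here refl)) (count′ (t ∷ T)) (t ∷ T) zs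
              ≤-refl)
        where count′ = count t (∈-resp-↭ (↭-sym (split zs)) (here refl))

    -- The remaining values of r, with a borrowed term where needed

    extend : ∀ {c γ} δ → S ↭ˡ (c ∷ γ) ++ δ → suc (length γ) ≡ r →
             ZeroFree (c ∷ γ) ⊎ c ⊕ σ γ ≡ 𝟘
    extend {c} {γ} δ S↭ |cγ|≡r with c ⊕ σ γ Fin.≟ 𝟘
    ... | yes e = inj₂ e
    ... | no ≢𝟘 = inj₁ zf
      where
      zf : ZeroFree (c ∷ γ)
      zf [] _ _ _ = refl
      zf U@(_ ∷ _) V p e = ⊥-elim (≢𝟘 (whole V p (+-cancelˡ-≡ (length U) _ _ (begin
        length U + length V  ≡⟨ length-++ U ⟨
        length (U ++ V)      ≡⟨ ↭-length p ⟨
        suc (length γ)       ≡⟨ |cγ|≡r ⟩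
        r                    ≡⟨ unique U (V ++ δ)
            (↭-trans S↭ (↭-trans (++⁺ʳ δ p) (++-assoc U V δ))) e (λ ()) ⟨
        length U             ≡⟨ +-identityʳ _ ⟨
        length U + 0         ∎))))
        where
        open ≡-Reasoning
        whole : ∀ V → c ∷ γ ↭ˡ U ++ V → length V ≡ 0 → c ⊕ σ γ ≡ 𝟘
        whole [] p _ = trans (σ-↭ p) (trans (cong σ (++-identityʳ U)) e)

    all-or-shape : ∀ {P : A → Set} xs → (∀ {x} → x ∈ˡ xs → Shape S r ⊎ P x) →
                   Shape S r ⊎ (∀ {x} → x ∈ˡ xs → P x)
    all-or-shape [] _ = inj₂ λ ()
    all-or-shape (x ∷ xs) f =
      f (here refl) >>= λ px → all-or-shape xs (f ∘ there) >>= λ pxs →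
      inj₂ λ { (here refl) → px ; (there x∈) → pxs x∈ }

    constant-generates : ∀ {t R} → ZeroSum (replicate r t) R → n < 2 * r → Generates t
    constant-generates zs n<2r = generates (constant-torsionFree zs)
        (≤-trans n<2r (≤-reflexive (cong (2 *_) (sym 1+r∸1≡r))))

    shape-below-half : ∀ {T R} → ZeroSum T R → 2 ≤ n → 2 * r < n → Shape S r
    shape-below-half {R = R} zs 2≤n 2r<n = small-shape zs γ↭ positive torsionFree 2≤n
        (m≤n⇒m≤1+n (<⇒≤ 2r<n))
      (inj₁ (≤-trans (≤-reflexive (+-comm (sum xs) 2)) (≤-trans (s≤s (torsionFree-<n torsionFree))
        (≤-trans n<2|R| (≤-reflexive (cong (2 *_) length≡))))))
      where
      n<2|R| : n < 2 * length R
      n<2|R| = n<2*complement n r (length R) (complement-size zs) 2r<n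
      open Behaving (structure R (complement-zeroFree zs) (≤-trans (s≤s (card≤n R)) n<2|R|))

    -- R has r - 1 terms, one too few, so t from T is added: t R is zero-sum free unless t = -σ(R).
    -- If this exception holds for every t, then T is constant; its term has order at least r > n/2,
    -- hence generates G, against r t = 𝟘 with r < n.
    shape-half-up : ∀ {T R} → ZeroSum T R → 2 ≤ n → 2 * r ≡ suc n → Shape S r
    shape-half-up {T} {R} zs 2≤n 2r≡1+n = [ (λ s → s) , all-inverse ]′
        (all-or-shape T inverse-or-shape)
      where
      1+|R|≡r : suc (length R) ≡ r
      1+|R|≡r = half-complement n r (length R) (complement-size zs) 2r≡1+n
      n<2r : n < 2 * r
      n<2r = ≤-reflexive (sym 2r≡1+n)
      from-behaving : ∀ {t} → Behaving (t ∷ R) → Shape S r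
      from-behaving B with g , x , ys , R≡ , 1≤x , pos , tf ← behaving-uncons B =
        small-shape zs (↭-reflexive R≡) pos (torsionFree-≤ (m≤n+m (sum ys) x) tf) 2≤n
            (≤-reflexive 2r≡1+n)
          (inj₂ (half-mean n r (length ys) x (sum ys) 2r≡1+n
            (trans (cong suc (sym (trans (cong length R≡) (length-map (_· g) ys)))) 1+|R|≡r)
                (torsionFree-<n tf) 1≤x , 2r≡1+n))
      inverse-or-shape : ∀ {t} → t ∈ˡ T → Shape S r ⊎ t ⊕ σ R ≡ 𝟘
      inverse-or-shape {t} t∈T with T′ , q ← extract t∈T =
        [ (λ zf → inj₁ (from-behaving (structure (t ∷ R) zf
            (≤-trans (s≤s (card≤n (t ∷ R)))
                (≤-trans n<2r (≤-reflexive (cong (2 *_) (sym 1+|R|≡r)))))))) , inj₂ ]′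
        (extend T′ (↭-trans (split zs) (↭-trans (++⁺ʳ R q) (prep t (++-comm T′ R)))) 1+|R|≡r)
      all-inverse : (∀ {t} → t ∈ˡ T → t ⊕ σ R ≡ 𝟘) → Shape S r
      all-inverse inverse = ⊥-elim (<⇒≱ (r<n n r 2≤n (≤-reflexive 2r≡1+n))
        (Generates.n≤order (constant-generates zs′ n<2r) 1≤r (trans (sym (σ-replicate r (⊖ σ R)))
            (sum≡𝟘 zs′))))
        where
        T≡ : T ≡ replicate r (⊖ σ R)
        T≡ = trans (all-equal λ t∈ → ⊕-cancelʳ (σ R) _ _ (trans (inverse t∈)
            (sym (trans (⊕-comm _ _) (⊕-inverseʳ (σ R))))))
               (cong (λ k → replicate k (⊖ σ R)) (size zs))
        zs′ : ZeroSum (replicate r (⊖ σ R)) R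
        zs′ = subst (λ Z → ZeroSum Z R) T≡ zs

    -- T without a term t is one term too short, so t is replaced by a term c of R: the result is
    -- zero-sum free unless c = t. If this exception holds for all t and c, then S is constant.
    shape-half-plus : ∀ {t T R} → ZeroSum (t ∷ T) R → 3 ≤ n → 2 * r ≡ 2 + n → Shape S r
    shape-half-plus {t₀} {T₀} {R} zs 3≤n 2r≡2+n =
      nonempty R refl
      where
      n<2r : n < 2 * r
      n<2r = ≤-trans (n≤1+n _) (≤-reflexive (sym 2r≡2+n))
      T = t₀ ∷ T₀
      equal-or-shape : ∀ {t c} → t ∈ˡ T → c ∈ˡ R → Shape S r ⊎ t ≡ c
      equal-or-shape {t} {c} t∈T c∈R with T′ , q ← extract t∈T | R′ , q′ ← extract c∈R =
        [ (λ zf → inj₁ (from-behaving (structure (c ∷ T′) zf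
            (≤-trans (s≤s (card≤n (c ∷ T′)))
                (≤-trans n<2r (≤-reflexive (cong (2 *_) (sym |cT′|≡r)))))))) ,
          (λ e → inj₂ (⊕-cancelʳ (σ T′) _ _ (trans (trans (sym (σ-↭ q)) (sum≡𝟘 zs)) (sym e)))) ]′
        (extend (t ∷ R′) (↭-trans (split zs) (↭-trans (++⁺ q q′)
            (solve 4 (λ t u c s → (t ⊕′ u) ⊕′ (c ⊕′ s) ⊜ (c ⊕′ u) ⊕′ (t ⊕′ s)) ↭-refl [ t ] T′ [ c
                ] R′))) |cT′|≡r)
        where
        open ++-Solver renaming (_⊕_ to _⊕′_)
        |cT′|≡r : suc (length T′) ≡ r
        |cT′|≡r = trans (sym (↭-length q)) (size zs)
        from-behaving : Behaving (c ∷ T′) → Shape S r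
        from-behaving B with g , x , ys , T′≡ , _ , pos , tf ← behaving-uncons B =
          large-shape (zeroSum-resp-↭ q ↭-refl zs) (↭-reflexive T′≡) pos
              (torsionFree-≤ (m≤n+m (sum ys) x) tf)
            (≤-reflexive (trans (+-comm n 2) (sym 2r≡2+n)))
      nonempty : ∀ R′ → R ≡ R′ → Shape S r
      nonempty [] e = ⊥-elim (complement-nonempty n r 3≤n 2r≡2+n
          (trans (cong (_+ r) (cong length (sym e))) (complement-size zs)))
      nonempty (c ∷ R₀) R≡ = [ (λ s → s) , (λ s → s) ]′ (
        all-or-shape T (λ t∈T → equal-or-shape t∈T (subst (c ∈ˡ_) (sym R≡) (here refl))) >>= λ T≡c →
        all-or-shape R (λ c′∈R → equal-or-shape (here refl) c′∈R) >>= λ t₀≡R →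
        inj₂ (all-c T≡c λ c′∈R → trans (sym (t₀≡R c′∈R)) (T≡c (here refl))))
        where
        all-c : (∀ {t} → t ∈ˡ T → t ≡ c) → (∀ {c′} → c′ ∈ˡ R → c′ ≡ c) → Shape S r
        all-c T≡c R≡c = almost-constant {x = n ∸ 1} {g = c} {b = c}
          (constant-generates (subst (λ Z → ZeroSum Z R) (trans (all-equal T≡c)
              (cong (λ k → replicate k c) (size zs))) zs) n<2r)
          n∸1+1≡n
          (↭-reflexive (trans (all-equal λ x∈S → [ T≡c , R≡c ]′ (∈-++⁻ T (∈-resp-↭ (split zs) x∈S)))
            (trans (cong (λ k → replicate k c) (trans |S|≡n (sym n∸1+1≡n))) (replicate-+ (n ∸ 1) 1
                c))))
          where
          n∸1+1≡n : n ∸ 1 + 1 ≡ n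
          n∸1+1≡n = m∸n+n≡m (≤-trans (s≤s z≤n) 3≤n)

    shape-large : ∀ {t T R} → ZeroSum (t ∷ T) R → 3 + n ≤ 2 * r → Shape S r
    shape-large {T = T} zs h = large-shape zs γ↭ positive torsionFree
      (≤-trans (≤-reflexive (+-comm n 2)) (≤-trans (n≤1+n _) h))
      where open Behaving (structure T (proper-zeroFree zs) (≤-trans (s≤s (card≤n T))
              (big-tail n r (length T) (size zs) h)))

    shape-3≤n : ∀ {T R} → ZeroSum T R → 3 ≤ n → Shape S r
    shape-3≤n {[]} zs _ = ⊥-elim (<⇒≢ 1≤r (size zs))
    shape-3≤n {_ ∷ _} zs 3≤n with <-cmp (2 * r) n | <-cmp (2 * r) (1 + n) | <-cmp (2 * r) (2 + n)
    ... | tri< 2r<n _ _ | _ | _ = shape-below-half zs (<⇒≤ 3≤n) 2r<n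
    ... | tri≈ _ 2r≡n _ | _ | _ = Balanced.shape (sym 2r≡n)
      (*-cancelˡ-< 2 1 r (≤-trans 3≤n (≤-reflexive (sym 2r≡n)))) zs
    ... | tri> _ _ n<2r | tri< 2r<1+n _ _ | _ = ⊥-elim (<⇒≱ n<2r (s≤s⁻¹ 2r<1+n))
    ... | _ | tri≈ _ 2r≡1+n _ | _ = shape-half-up zs (<⇒≤ 3≤n) 2r≡1+n
    ... | _ | tri> _ _ 1+n<2r | tri< 2r<2+n _ _ = ⊥-elim (<⇒≱ 1+n<2r (s≤s⁻¹ 2r<2+n))
    ... | _ | _ | tri≈ _ 2r≡2+n _ = shape-half-plus zs 3≤n 2r≡2+n
    ... | _ | _ | tri> _ _ 2+n<2r = shape-large zs 2+n<2r

    shape-≤2 : ∀ {T R} → ZeroSum T R → n ≤ 2 → Shape S r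
    shape-≤2 {R = R} zs n≤2 = go S ↭-refl |S|≡n
      where
      nonzero-generates : ∀ {x} → x ≢ 𝟘 → Generates x
      nonzero-generates x≢𝟘 = generates {L = 1}
        (λ { 1 _ _ e → x≢𝟘 (trans (sym (·-homo-1 _)) e) ; (suc (suc _)) _ (s≤s ()) _ })
            (s≤s (≤-trans n≤2 (n≤1+n 2)))
      go : ∀ xs → S ↭ˡ xs → length xs ≡ n → Shape S r
      go [] _ 0≡n = ⊥-elim (<⇒≱ 1≤r (≤-trans (m≤n+m r (length R))
          (≤-reflexive (trans (complement-size zs) (sym 0≡n)))))
      go (x ∷ []) p 1≡n = almost-constant {x = 0} {g = x} (generates {L = 0} (λ _ 1≤j j≤0 _ →
          <⇒≱ 1≤j j≤0) (s≤s (≤-reflexive (sym 1≡n)))) 1≡n p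
      go (x ∷ y ∷ []) p 2≡n with x Fin.≟ 𝟘 | y Fin.≟ 𝟘
      ... | no x≢𝟘 | _ = almost-constant {x = 1} (nonzero-generates x≢𝟘) 2≡n p
      ... | yes _ | no y≢𝟘 = almost-constant {x = 1} (nonzero-generates y≢𝟘) 2≡n
          (↭-trans p (↭.swap x y ↭-refl))
      ... | yes x≡𝟘 | yes y≡𝟘 = ⊥-elim (<⇒≢ (s≤s (s≤s z≤n)) (trans
        (unique [ x ] [ y ] p (trans (⊕-identityʳ x) x≡𝟘) λ ())
        (sym (unique (x ∷ y ∷ []) [] p (trans (cong₂ (λ a b → a ⊕ (b ⊕ 𝟘)) x≡𝟘 y≡𝟘)
            (trans (⊕-identityˡ _) (⊕-identityˡ 𝟘))) λ ()))))
      go (_ ∷ _ ∷ _ ∷ _) _ 3≤ = ⊥-elim (<⇒≱ (s≤s (s≤s (s≤s z≤n))) (≤-trans (≤-reflexive 3≤) n≤2))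

    classification : ∀ {T R} → ZeroSum T R → Shape S r
    classification zs = [ shape-≤2 zs , shape-3≤n zs ]′ (≤-<-connex n 2)

  -- The forms of (A) and (B) over Fin n

  data CyclicForm (S : List A) (r : ℕ) (g : A) : Set where
    form₁ : ∀ {b} → S ↭ˡ replicate (n ∸ 1) g ++ replicate 1 b → CyclicForm S r g
    form₂ : ∀ {b} → (∀ i → b ≢ i · 2 · g) →
      S ↭ˡ replicate (n ∸ 1) (2 · g) ++ replicate 1 b → CyclicForm S r g
    form₃ : n % 2 ≡ 1 → r ≡ (n + 1) / 2 →
      S ↭ˡ replicate (n ∸ 2) g ++ replicate 2 (((n + 1) / 2) · g) → CyclicForm S r g
    form₄ : ∀ {x} → n % 4 ≡ 2 → r ≡ n / 2 → x % 2 ≡ 0 → x < n / 2 →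
      S ↭ˡ replicate (n / 2 + x) (2 · g) ++ replicate (n / 2 ∸ x) (((n + 4) / 2) · g) →
          CyclicForm S r g
    form₅ : ∀ {x} → n % 2 ≡ 0 → r ≡ n / 2 → x < n / 2 → (n / 2 ∸ x) % 2 ≡ 1 →
      S ↭ˡ replicate (n / 2 + x) g ++ replicate (n / 2 ∸ x) (((n + 2) / 2) · g) → CyclicForm S r g

  -- The third alternative of (A) is the second one for the involution h + m g in place of h.
  data NonCyclicForm (S : List A) (t h : A) : Set where
    formᴬ₁ : ∀ {b} → (∀ i → b ≢ i · t) → S ↭ˡ replicate (n ∸ 1) t ++ replicate 1 b → NonCyclicForm
        S t h
    formᴬ₂ : ∀ {x} → x % 2 ≡ 1 → 1 ≤ x → x < n / 2 →
      S ↭ˡ replicate (n / 2 + x) t ++ replicate (n / 2 ∸ x) (h ⊕ t) → NonCyclicForm S t h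

  data Form (S : List A) (r : ℕ) : Set where
    cyclic : ∀ {g} → Generates g → CyclicForm S r g → Form S r
    noncyclic : ∀ {t h m} → 1 ≤ m → n ≡ 2 * (2 * m) → r ≡ 2 * m →
      (2 * m) · t ≡ 𝟘 → (∀ j → 1 ≤ j → j < 2 * m → j · t ≢ 𝟘) → 2 · h ≡ 𝟘 → (∀ i → h ≢ i · t) →
      (∀ z → ∃[ i ] (z ≡ i · t ⊎ z ≡ h ⊕ i · t)) → NonCyclicForm S t h → Form S r

  generates-all : ∀ {g} → (∀ x → ∃[ k ] x ≡ k · g) → Generates g
  generates-all {g} all = generates {L = n ∸ 1} torsionFree
    (≤-trans (m<m+n n (≤-trans 1≤n (m≤m+n n 0))) (≤-reflexive (cong (2 *_) (sym (m+[n∸m]≡n 1≤n)))))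
    where
    1≤n : 1 ≤ n
    1≤n = unique-length≤n {xs = [ g ]} ([] ∷ [])
    torsionFree : TorsionFreeTo g (n ∸ 1)
    torsionFree (suc j) _ j<n∸1 e = <⇒≱ (≤-trans (s≤s j<n∸1) (≤-reflexive (m+[n∸m]≡n 1≤n)))
        (order-≥n e all)

  generates-multiple : ∀ {g g′} k → Generates g → g ≡ k · g′ → Generates g′
  generates-multiple {g} {g′} k gen g≡ = generates-all λ x → log x * k ,
    trans (log-correct x) (trans (cong (log x ·_) g≡) (·-assocˡ g′ (log x) k))
    where open Generates gen

  swap-blocks : ∀ {S : List A} xs {ys} → S ↭ˡ xs ++ ys → S ↭ˡ ys ++ xs
  swap-blocks xs {ys} p = ↭-trans p (++-comm xs ys)

  two-blocks : ∀ {S r x y} {a b a′ b′ : A} → n ≡ 2 * r → x + y ≡ n → y ≤ r → a ≡ a′ → b ≡ b′ →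
    S ↭ˡ replicate x a ++ replicate y b →
    S ↭ˡ replicate (n / 2 + (r ∸ y)) a′ ++ replicate (n / 2 ∸ (r ∸ y)) b′
  two-blocks {S} {a = a} {b} n≡2r e y≤r refl refl p with e₁ , e₂ ← blocks n≡2r e y≤r =
    subst₂ (λ i j → S ↭ˡ replicate i a ++ replicate j b) (sym e₁) (sym e₂) p

  r∸y<n/2 : ∀ {r y} → n ≡ 2 * r → 1 ≤ y → y ≤ r → r ∸ y < n / 2
  r∸y<n/2 {r} {y} n≡2r 1≤y y≤r = ≤-trans (∸-monoʳ-< 1≤y y≤r) (≤-reflexive (sym (/2-exact r n≡2r)))

  -- From shapes to the forms of the theorem

  module _ {S : List A} {r : ℕ} where

    -- If b = (r + 1) g is in the minority, this is form (5) for g. Otherwise the roles are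
    -- exchanged. For even r the multiplier r + 1 is its own inverse modulo n, so b generates and
    -- form (5) holds for b. For odd r the multiplier r + 1 is even and b does not generate; it is
    -- the double of another generator, which gives form (4).
    involutive-form : ∀ {x g h} → Generates g → n ≡ 2 * r → x + (1 + h * 2) ≡ n →
      S ↭ˡ replicate x g ++ replicate (1 + h * 2) (suc r · g) → Form S r
    involutive-form {x} {g} {h} gen n≡2r x+y≡n p = [ few , many ]′ (≤-<-connex y r)
      where
      y = 1 + h * 2
      b = suc r · g
      n/2≡r : n / 2 ≡ r
      n/2≡r = /2-exact r n≡2r
      n-even : n % 2 ≡ 0
      n-even = even-% r (trans n≡2r (*-comm 2 r))
      form₅-coefficient : (n + 2) / 2 ≡ suc r
      form₅-coefficient = /2-exact (suc r) (+2-exact r n≡2r)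
      form₄-coefficient : (n + 4) / 2 ≡ r + 2
      form₄-coefficient = /2-exact (r + 2) (+4-exact r n≡2r)
      few : y ≤ r → Form S r
      few y≤r = cyclic gen (form₅ {x = r ∸ y} n-even (sym n/2≡r) (r∸y<n/2 n≡2r (s≤s z≤n) y≤r)
        (odd-% h (proj₂ (blocks n≡2r x+y≡n y≤r)))
        (two-blocks n≡2r x+y≡n y≤r refl (cong (_· g) (sym form₅-coefficient)) p))
      reduce : ∀ k q → k ≡ 1 + q * (2 * r) → g ≡ k · g
      reduce k q e = sym (trans (cong (_· g) (trans e (cong (λ z → 1 + q * z) (sym n≡2r))))
        (trans (·-+-≡𝟘 {g} {q * n} 1 (multiple-≡𝟘 {g} {n} q (Generates.n·g≡𝟘 gen))) (·-homo-1 g)))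
      many : r < y → Form S r
      many r<y = [ even , odd ]′ (even-or-odd r)
        where
        y+x≡n : y + x ≡ n
        y+x≡n = trans (+-comm y x) x+y≡n
        x<r : x < r
        x<r = >half n≡2r x+y≡n r<y
        x-odd : ∃[ k ] x ≡ 1 + k * 2
        x-odd = odd-in-even x h r (trans x+y≡n (trans n≡2r (*-comm 2 r)))
        1≤x : 1 ≤ x
        1≤x = subst (1 ≤_) (sym (proj₂ x-odd)) (s≤s z≤n)
        p′ : S ↭ˡ replicate y b ++ replicate x g
        p′ = swap-blocks (replicate x g) p
        even : ∃[ k ] r ≡ k * 2 → Form S r
        even (k , r≡) = cyclic (generates-multiple (suc r) gen g≡) (form₅ {x = r ∸ x} n-even
            (sym n/2≡r) (r∸y<n/2 n≡2r 1≤x (<⇒≤ x<r))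
          (odd-% (proj₁ x-odd) (trans (proj₂ (blocks n≡2r y+x≡n (<⇒≤ x<r))) (proj₂ x-odd)))
          (two-blocks n≡2r y+x≡n (<⇒≤ x<r) refl (trans g≡ (cong (_· b) (sym form₅-coefficient)))
              p′))
          where
          g≡ : g ≡ suc r · b
          g≡ = trans (reduce (suc r * suc r) (suc k) (subst (λ z → suc z * suc z ≡ 1 + suc
              k * (2 * z)) (sym r≡) (square-one k)))
            (sym (·-assocˡ g (suc r) (suc r)))
        -- The new generator is c g, with 2 c g = b and (r + 2) c g = g. Modulo the odd number r
        -- both conditions read 2c = 1, and modulo 2 the second one asks for an odd c.
        halving : ∀ c q q′ k → r ≡ 1 + k * 2 → (r + 2) * c ≡ 1 + q * (2 * r) →
            2 * c ≡ suc r + q′ * (2 * r) → Form S r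
        halving c q q′ k r≡ e₁ e₂ = cyclic (generates-multiple {g′ = c · g} (r + 2) gen g≡)
          (form₄ {x = r ∸ x} (double-odd-% r k n≡2r r≡) (sym n/2≡r)
            (even-% (proj₁ r∸x-even) (proj₂ r∸x-even))
            (r∸y<n/2 n≡2r 1≤x (<⇒≤ x<r))
            (two-blocks n≡2r y+x≡n (<⇒≤ x<r) b≡
                (trans g≡ (cong (_· c · g) (sym form₄-coefficient))) p′))
          where
          r∸x-even : ∃[ j ] r ∸ x ≡ j * 2
          r∸x-even = odd-in-odd (r ∸ x) (proj₁ x-odd) k
            (trans (cong (r ∸ x +_) (sym (proj₂ x-odd))) (trans (m∸n+n≡m (<⇒≤ x<r)) r≡))
          g≡ : g ≡ (r + 2) · c · g
          g≡ = trans (reduce ((r + 2) * c) q e₁) (sym (·-assocˡ g (r + 2) c))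
          b≡ : b ≡ 2 · c · g
          b≡ = sym (trans (·-assocˡ g 2 c)
              (trans (cong (_· g) (trans e₂ (cong (λ z → suc r + q′ * z) (sym n≡2r))))
            (·-+-≡𝟘 {g} {q′ * n} (suc r) (multiple-≡𝟘 {g} {n} q′ (Generates.n·g≡𝟘 gen)))))
        odd : ∃[ k ] r ≡ 1 + k * 2 → Form S r
        odd (k , r≡) with even-or-odd k
        ... | inj₁ (j , refl) = halving (suc (j * 2)) (suc j) 0 (j * 2) r≡
          (subst (λ z → (z + 2) * suc (j * 2) ≡ 1 + suc j * (2 * z)) (sym r≡) (halved-even j))
          (trans (double-even j) (trans (cong suc (sym r≡)) (sym (+-identityʳ (suc r)))))
        -- Here (r + 1)/2 is even; adding the odd r corrects the parity without changing the class
        -- modulo r.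
        ... | inj₂ (j , refl) = halving (suc (1 + j * 2) + (1 + (1 + j * 2) * 2)) (3 * j + 4) 1
            (1 + j * 2) r≡
          (subst (λ z → (z + 2) * (suc (1 + j * 2) + (1 + (1 + j * 2) * 2)) ≡ 1 + (3 * j + 4)
              * (2 * z)) (sym r≡) (halved-odd j))
          (subst (λ z → 2 * (suc (1 + j * 2) + (1 + (1 + j * 2) * 2)) ≡ suc z + 1 * (2 * z))
              (sym r≡) (double-odd j))

    -- A cyclic subgroup of index two

    module IndexTwo {x y : ℕ} {t b : A} (n≡2r : n ≡ 2 * r) (1≤r : 1 ≤ r) (torsionFree : ∀ j →
        1 ≤ j → j < r → j · t ≢ 𝟘)
      (r·t≡𝟘 : r · t ≡ 𝟘) (b∉⟨t⟩ : ∀ i → b ≢ i · t) (coset : ∀ z → ∃[ i ] (z ≡ i · t ⊎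
          z ≡ i · t ⊕ b))
      (x+y≡n : x + y ≡ n) (S↭ : S ↭ˡ replicate x t ++ replicate y b) where

      n/2≡r : n / 2 ≡ r
      n/2≡r = /2-exact r n≡2r

      -- h = b − j t
      module Representative (j : ℕ) where

        h : A
        h = b ⊕ (j * (r ∸ 1)) · t

        j·r·t≡𝟘 : ∀ i → (i * r) · t ≡ 𝟘
        j·r·t≡𝟘 i = multiple-≡𝟘 {t} {r} i r·t≡𝟘

        b≡ : b ≡ h ⊕ j · t
        b≡ = sym (begin
          b ⊕ (j * (r ∸ 1)) · t ⊕ j · t    ≡⟨ ⊕-assoc b _ _ ⟩
          b ⊕ ((j * (r ∸ 1)) · t ⊕ j · t)  ≡⟨ cong (b ⊕_) (·-homo-+ t (j * (r ∸ 1)) j) ⟨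
          b ⊕ (j * (r ∸ 1) + j) · t        ≡⟨ cong (λ k → b ⊕ k · t) (cancel-multiple j r 1≤r) ⟩
          b ⊕ (j * r) · t                  ≡⟨ cong (b ⊕_) (j·r·t≡𝟘 j) ⟩
          b ⊕ 𝟘                            ≡⟨ ⊕-identityʳ b ⟩
          b                                ∎)
          where open ≡-Reasoning

        h∉⟨t⟩ : ∀ i → h ≢ i · t
        h∉⟨t⟩ i h≡ = b∉⟨t⟩ (i + j) (trans b≡ (trans (cong (_⊕ j · t) h≡) (sym (·-homo-+ t i j))))

        -- Used with e the parity of the coefficient of 2 b. For e = 0 the representative h is an
        -- involution and G splits over ⟨t⟩; for e = 1 it satisfies 2 h = t and generates G.
        2·h : ∀ e → 2 · b ≡ (e + j * 2) · t → 2 · h ≡ e · t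
        2·h e 2b≡ = begin
          2 · h                                      ≡⟨ ·-distrib-⊕ b _ 2 ⟩
          2 · b ⊕ 2 · (j * (r ∸ 1)) · t              ≡⟨ cong₂ _⊕_ 2b≡ (·-assocˡ t 2 (j * (r ∸ 1))) ⟩
          (e + j * 2) · t ⊕ (2 * (j * (r ∸ 1))) · t  ≡⟨ ·-homo-+ t (e + j * 2) _ ⟨
          (e + j * 2 + 2 * (j * (r ∸ 1))) · t        ≡⟨ cong (_· t) (regroup e j (r ∸ 1)) ⟩
          (e + 2 * (j * (r ∸ 1) + j)) · t            ≡⟨ cong (λ k → (e + 2 * k) · t)
              (cancel-multiple j r 1≤r) ⟩
          (e + 2 * (j * r)) · t                      ≡⟨ ·-+-≡𝟘 {t} {2 * (j * r)} e (multiple-≡𝟘 {t}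
              {j * r} 2 (j·r·t≡𝟘 j)) ⟩
          e · t                                      ∎
          where open ≡-Reasoning

        coset-h : ∀ z → ∃[ i ] (z ≡ i · t ⊎ z ≡ h ⊕ i · t)
        coset-h z = [ (λ e → proj₁ (coset z) , inj₁ e) , (λ e → proj₁ (coset z) + j , inj₂ (begin
          z                                ≡⟨ e ⟩
          proj₁ (coset z) · t ⊕ b          ≡⟨ ⊕-comm _ b ⟩
          b ⊕ proj₁ (coset z) · t          ≡⟨ cong (_⊕ proj₁ (coset z) · t) b≡ ⟩
          h ⊕ j · t ⊕ proj₁ (coset z) · t  ≡⟨ ⊕-assoc h _ _ ⟩
          h ⊕ (j · t ⊕ proj₁ (coset z) · t)
              ≡⟨ cong (h ⊕_) (trans (⊕-comm _ _) (sym (·-homo-+ t (proj₁ (coset z)) j))) ⟩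
          h ⊕ (proj₁ (coset z) + j) · t    ∎)) ]′ (proj₂ (coset z))
          where open ≡-Reasoning

        generates-from : ∀ {g} c d → t ≡ c · g → h ≡ d · g → Generates g
        generates-from {g} c d t≡ h≡ = generates-all λ z → all (coset-h z)
          where
          multiple : ∀ i → i · t ≡ (i * c) · g
          multiple i = trans (cong (i ·_) t≡) (·-assocˡ g i c)
          all : ∀ {z} → ∃[ i ] (z ≡ i · t ⊎ z ≡ h ⊕ i · t) → ∃[ k ] z ≡ k · g
          all (i , inj₁ e) = i * c , trans e (multiple i)
          all (i , inj₂ e) = d + i * c , trans e (trans (cong₂ _⊕_ h≡ (multiple i))
              (sym (·-homo-+ g d (i * c))))

        b-single : ∀ {g} → t ≡ 2 · g → y ≡ 1 → CyclicForm S r g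
        b-single {g} t≡ refl = form₂ {b = b} (λ i → subst (λ z → b ≢ i · z) t≡ (b∉⟨t⟩ i))
          (subst₂ (λ k z → S ↭ˡ replicate k z ++ replicate 1 b) x≡ t≡ S↭)
          where
          x≡ : x ≡ n ∸ 1
          x≡ = trans (sym (m+n∸n≡m x 1)) (cong (_∸ 1) x+y≡n)

        Multiplicity : Set
        Multiplicity = y ≡ 1 ⊎ (∃[ k ] y ≡ 1 + k * 2 × j ≡ 1 × y ≤ r)

        -- G is the direct sum of ⟨h⟩ of order 2 and ⟨t⟩ of order r, which is cyclic exactly when r
        -- is odd.
        split-form : 2 · h ≡ 𝟘 → Multiplicity → Form S r
        split-form 2h≡𝟘 multiplicity = [ even , odd ]′ (even-or-odd r)
          where
          h⊕t≡b : j ≡ 1 → h ⊕ t ≡ b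
          h⊕t≡b j≡1 = sym (trans b≡ (cong (h ⊕_) (trans (cong (_· t) j≡1) (·-homo-1 t))))

          even : ∃[ m ] r ≡ m * 2 → Form S r
          even (m , r≡m*2) = noncyclic (positive m r≡) (trans n≡2r (cong (2 *_) r≡)) r≡
            (subst (λ k → k · t ≡ 𝟘) r≡ r·t≡𝟘) (λ i 1≤i i<2m → torsionFree i 1≤i
                (subst (i <_) (sym r≡) i<2m))
            2h≡𝟘 h∉⟨t⟩ coset-h (form multiplicity)
            where
            r≡ : r ≡ 2 * m
            r≡ = trans r≡m*2 (*-comm m 2)
            positive : ∀ m → r ≡ 2 * m → 1 ≤ m
            positive zero e = subst (1 ≤_) e 1≤r
            positive (suc m) _ = s≤s z≤n
            form : Multiplicity → NonCyclicForm S t h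
            form (inj₁ y≡1) = formᴬ₁ {b = b} b∉⟨t⟩ (subst₂ (λ k l → S ↭ˡ replicate k t ++ replicate
                l b)
              (trans (sym (m+n∸n≡m x 1)) (cong (_∸ 1) (trans (cong (x +_) (sym y≡1)) x+y≡n))) y≡1
                  S↭)
            form (inj₂ (k , y≡ , j≡1 , y≤r)) = formᴬ₂ {x = r ∸ y} (odd-% (proj₁ r∸y-odd)
                (proj₂ r∸y-odd))
              (subst (1 ≤_) (sym (proj₂ r∸y-odd)) (s≤s z≤n)) (r∸y<n/2 n≡2r (subst (1 ≤_) (sym y≡)
                  (s≤s z≤n)) y≤r)
              (two-blocks n≡2r x+y≡n y≤r refl (sym (h⊕t≡b j≡1)) S↭)
              where
              r∸y-odd : ∃[ i ] r ∸ y ≡ 1 + i * 2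
              r∸y-odd = odd-in-even (r ∸ y) k m (trans (cong (r ∸ y +_) (sym y≡))
                  (trans (m∸n+n≡m y≤r) r≡m*2))

          odd : ∃[ k ] r ≡ 1 + k * 2 → Form S r
          odd (k , r≡) = cyclic {g = g} (generates-from 2 r t≡ h≡) (form multiplicity)
            where
            g : A
            -- The multiplier k + 1 = (r + 1)/2 is one half modulo r, so 2 g = t; then r g = g + k t
            -- = h + r t = h.
            g = h ⊕ suc k · t
            t≡ : t ≡ 2 · g
            t≡ = sym (begin
              2 · g                          ≡⟨ ·-distrib-⊕ h _ 2 ⟩
              2 · h ⊕ 2 · suc k · t          ≡⟨ cong₂ _⊕_ 2h≡𝟘 (·-assocˡ t 2 (suc k)) ⟩
              𝟘 ⊕ (2 * suc k) · t            ≡⟨ ⊕-identityˡ _ ⟩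
              (2 * suc k) · t                ≡⟨ cong (_· t) (trans (*-comm 2 (suc k))
                  (cong suc (sym r≡))) ⟩
              (1 + r) · t                    ≡⟨ ·-+-≡𝟘 {t} {r} 1 r·t≡𝟘 ⟩
              1 · t                          ≡⟨ ·-homo-1 t ⟩
              t                              ∎)
              where open ≡-Reasoning
            h≡ : h ≡ r · g
            h≡ = sym (begin
              r · g                          ≡⟨ cong (_· g) r≡ ⟩
              g ⊕ (k * 2) · g                ≡⟨ cong (g ⊕_) (·-assocˡ g k 2) ⟨
              g ⊕ k · 2 · g                  ≡⟨ cong (λ z → g ⊕ k · z) t≡ ⟨
              h ⊕ suc k · t ⊕ k · t          ≡⟨ ⊕-assoc h _ _ ⟩
              h ⊕ (suc k · t ⊕ k · t)        ≡⟨ cong (h ⊕_) (·-homo-+ t (suc k) k) ⟨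
              h ⊕ (suc k + k) · t            ≡⟨ cong (λ z → h ⊕ z · t)
                  (trans (cong suc (trans (cong (k +_) (sym (+-identityʳ k))) (*-comm 2 k)))
                  (sym r≡)) ⟩
              h ⊕ r · t                      ≡⟨ cong (h ⊕_) r·t≡𝟘 ⟩
              h ⊕ 𝟘                          ≡⟨ ⊕-identityʳ h ⟩
              h                              ∎)
              where open ≡-Reasoning
            form : Multiplicity → CyclicForm S r g
            form (inj₁ y≡1) = b-single t≡ y≡1
            form (inj₂ (l , y≡ , j≡1 , y≤r)) = form₄ {x = r ∸ y} (double-odd-% r k n≡2r r≡)
                (sym n/2≡r)
              (even-% (proj₁ r∸y-even) (proj₂ r∸y-even)) (r∸y<n/2 n≡2r (subst (1 ≤_) (sym y≡)
                  (s≤s z≤n)) y≤r)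
              (two-blocks n≡2r x+y≡n y≤r t≡ b≡coefficient S↭)
              where
              r∸y-even : ∃[ i ] r ∸ y ≡ i * 2
              r∸y-even = odd-in-odd (r ∸ y) l k (trans (cong (r ∸ y +_) (sym y≡))
                  (trans (m∸n+n≡m y≤r) r≡))
              b≡coefficient : b ≡ ((n + 4) / 2) · g
              b≡coefficient = trans (sym (h⊕t≡b j≡1)) (trans (cong₂ _⊕_ h≡ t≡)
                (trans (sym (·-homo-+ g r 2))
                    (cong (_· g) (sym (/2-exact (r + 2) (+4-exact r n≡2r))))))

      -- When b occurs more than once, 2 b = 2 t fixes the representative h = b - t. When it occurs
      -- once, 2 b lies in ⟨t⟩, as b would otherwise, and half its coefficient, rounded down,
      -- determines h.
      index-two-form : (y ≡ 1 ⊎ (∃[ k ] y ≡ 1 + k * 2 × 2 · b ≡ 2 · t × y ≤ r)) → Form S r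
      index-two-form (inj₂ (k , y≡ , 2b≡2t , y≤r)) = split-form (2·h 0 2b≡2t)
          (inj₂ (k , y≡ , refl , y≤r))
        where open Representative 1
      index-two-form (inj₁ y≡1) = go (coset (2 · b))
        where
        halve : ∀ i → 2 · b ≡ i · t → (∃[ j ] i ≡ j * 2) ⊎ (∃[ j ] i ≡ 1 + j * 2) → Form S r
        halve i 2b≡ (inj₁ (j , i≡)) = split-form (2·h 0 (trans 2b≡ (cong (_· t) i≡))) (inj₁ y≡1)
          where open Representative j
        halve i 2b≡ (inj₂ (j , i≡)) = cyclic {g = h} (generates-from 2 1 t≡ (sym (·-homo-1 h)))
            (b-single t≡ y≡1)
          where
          open Representative j
          t≡ : t ≡ 2 · h
          t≡ = sym (trans (2·h 1 (trans 2b≡ (cong (_· t) i≡))) (·-homo-1 t))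
        go : ∃[ i ] (2 · b ≡ i · t ⊎ 2 · b ≡ i · t ⊕ b) → Form S r
        go (i , inj₁ e) = halve i e (even-or-odd i)
        go (i , inj₂ e) = ⊥-elim (b∉⟨t⟩ i (trans (sym (⊕-identityʳ b)) (⊕-cancelˡ b _ _
            (trans e (⊕-comm _ b)))))

    form : 1 ≤ r → Shape S r → Form S r
    form _ (almost-constant {x} {g} {b} gen x+1≡n p) = cyclic gen (form₁ {b = b}
      (subst (λ k → S ↭ˡ replicate k g ++ [ b ]) (trans (sym (m+n∸n≡m x 1)) (cong (_∸ 1) x+1≡n)) p))
    form _ (half-pair {x} {g} gen 1+n≡2r x+2≡n p) = cyclic gen (form₃ (odd-% (r ∸ 1) n-odd)
        (sym n+1/2)
      (subst₂ (λ k l → S ↭ˡ replicate k g ++ replicate 2 (l · g))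
        (trans (sym (m+n∸n≡m x 2)) (cong (_∸ 2) x+2≡n)) (sym n+1/2) p))
      where
      n+1/2 : (n + 1) / 2 ≡ r
      n+1/2 = /2-exact r (trans (+-comm n 1) 1+n≡2r)
      n-odd : n ≡ 1 + (r ∸ 1) * 2
      n-odd = odd-predecessor n r 1+n≡2r
    form _ (involutive {x} {g} {h} gen n≡2r x+y≡n p) = involutive-form {x} {g} {h} gen n≡2r x+y≡n p
    form 1≤r (index-two {x} {y} {t} {b} n≡2r tf r·t≡𝟘 b∉ coset x+y≡n p multiplicity) =
      IndexTwo.index-two-form {x} {y} {t} {b} n≡2r 1≤r tf r·t≡𝟘 b∉ coset x+y≡n p multiplicity

open import Data.Integer.Base using (+_; -[1+_]; ∣_∣; _-_)
open import Data.Integer.Divisibility.Signed as ℤ using ()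
open import Data.Integer.Properties using (∣i-j∣≡∣j-i∣; [+m]-[+n]≡m⊖n; ∣⊖∣-≤)

-- Multiplicities and permutations

count : ∀ {n} → Fin n → List (Fin n) → ℕ
count e xs = length (filter (e Fin.≟_) xs)

count-++ : ∀ {n} (e : Fin n) xs {ys} → count e (xs ++ ys) ≡ count e xs + count e ys
count-++ e xs {ys} = trans (cong length (filter-++ (e Fin.≟_) xs ys))
    (length-++ (filter (e Fin.≟_) xs))

submultiset : ∀ {n} (xs : List (Fin n)) {ys} → (∀ e → count e xs ≤ count e ys) →
              ∃[ zs ] ys ↭ˡ xs ++ zs
submultiset [] {ys} _ = ys , ↭-refl
submultiset (x ∷ xs) {ys} h with Any.any? (x Fin.≟_) ys
... | no x∉ = ⊥-elim (<⇒≱ (subst (1 ≤_) (sym (cong length (filter-accept (x Fin.≟_) {x} {xs}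
    refl))) (s≤s z≤n))
  (≤-trans (h x) (≤-reflexive (cong length (filter-none (x Fin.≟_) (All.¬Any⇒All¬ ys x∉))))))
... | yes x∈ with zs , p ← extract x∈ =
  let ws , q = submultiset xs {zs} h′ in ws , ↭-trans p (prep x q)
  where
  h′ : ∀ e → count e xs ≤ count e zs
  h′ e = +-cancelˡ-≤ (count e [ x ]) _ _ (subst₂ _≤_ (count-++ e [ x ])
    (trans (↭-length (filter-↭ (e Fin.≟_) p)) (count-++ e [ x ])) (h e))

-- Transport to the given group

module Transport {c ℓ} (G : AbelianGroup c ℓ) {n : ℕ} (|G|≡n : HasCardinality G n) where

  open GroupNotions G
  open Sequences G |G|≡n renaming (_≟_ to _≟ᴳ_)
  open AbelianGroup G using (setoid; ∙-cong; assoc; comm; identityˡ; identityʳ; inverseˡ; inverseʳ;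
      ⁻¹-cong)
    renaming (refl to ≈-refl; sym to ≈-sym; trans to ≈-trans; reflexive to ≈-reflexive; _⁻¹ to -ᴳ_)
  open GroupProperties (AbelianGroup.group G) using () renaming (∙-cancelʳ to +ᴳ-cancelʳ)
  open Inverse |G|≡n using (to; from; to-cong; from-cong; strictlyInverseˡ; strictlyInverseʳ)

  isAbelianGroup : IsAbelianGroup _≡_ (λ x y → to (from x +ᴳ from y)) (to 0ᴳ) (λ x → to (-ᴳ from x))
  isAbelianGroup = record
    { isGroup = record
      { isMonoid = record
        { isSemigroup = record
          { isMagma = record { isEquivalence = isEquivalence ; ∙-cong = cong₂ _ }
          ; assoc = λ x y z → to-cong (≈-trans (∙-cong (strictlyInverseʳ _) ≈-refl)
              (≈-trans (assoc _ _ _) (∙-cong ≈-refl (≈-sym (strictlyInverseʳ _)))))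
          }
        ; identity = (λ x → trans (to-cong (≈-trans (∙-cong (strictlyInverseʳ _) ≈-refl)
            (identityˡ _))) (strictlyInverseˡ x))
                   , (λ x → trans (to-cong (≈-trans (∙-cong ≈-refl (strictlyInverseʳ _))
                       (identityʳ _))) (strictlyInverseˡ x))
        }
      ; inverse = (λ x → to-cong (≈-trans (∙-cong (strictlyInverseʳ _) ≈-refl) (inverseˡ _)))
                , (λ x → to-cong (≈-trans (∙-cong ≈-refl (strictlyInverseʳ _)) (inverseʳ _)))
      ; ⁻¹-cong = cong (λ x → to (-ᴳ from x))
      }
    ; comm = λ x y → to-cong (comm _ _)
    }

  module F = FiniteGroup isAbelianGroup
  open F using (A; 𝟘; _⊕_) renaming (_·_ to _·ᶠ_)

  to-injective : ∀ {x y} → to x ≡ to y → x ≈ y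
  to-injective {x} {y} e = ≈-trans (≈-sym (strictlyInverseʳ x)) (≈-trans (from-cong e)
      (strictlyInverseʳ y))

  to-+ : ∀ x y → to (x +ᴳ y) ≡ to x ⊕ to y
  to-+ x y = to-cong (∙-cong (≈-sym (strictlyInverseʳ x)) (≈-sym (strictlyInverseʳ y)))

  to-· : ∀ k x → to (k · x) ≡ k ·ᶠ to x
  to-· zero x = refl
  to-· (suc k) x = trans (to-+ x (k · x)) (cong (to x ⊕_) (to-· k x))

  from-· : ∀ k x → from (k ·ᶠ x) ≈ k · from x
  from-· k x = to-injective (trans (strictlyInverseˡ _)
      (sym (trans (to-· k (from x)) (cong (k ·ᶠ_) (strictlyInverseˡ x)))))

  to-σ : ∀ T → to (σ T) ≡ F.σ (map to T)
  to-σ [] = refl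
  to-σ (t ∷ T) = trans (to-+ t (σ T)) (cong (to t ⊕_) (to-σ T))

  to-map-from : ∀ xs → map to (map from xs) ≡ xs
  to-map-from [] = refl
  to-map-from (x ∷ xs) = cong₂ _∷_ (strictlyInverseˡ x) (to-map-from xs)

  v≡count : ∀ g S → v g S ≡ count (to g) (map to S)
  v≡count g [] = refl
  v≡count g (x ∷ S) with to g Fin.≟ to x
  ... | yes _ = cong suc (v≡count g S)
  ... | no _ = v≡count g S

  ∣⇒split : ∀ {T S} → T ∣ S → ∃[ R ] map to S ↭ˡ map to T ++ R
  ∣⇒split {T} {S} T∣S = submultiset (map to T) λ e → subst (λ z → count z (map to T) ≤ count z
      (map to S)) (strictlyInverseˡ e)
    (subst₂ _≤_ (v≡count (from e) T) (v≡count (from e) S) (T∣S (from e)))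

  split⇒∣ : ∀ {S T R} → map to S ↭ˡ T ++ R → map from T ∣ S
  split⇒∣ {S} {T} {R} p g = begin
    v g (map from T)                       ≡⟨ v≡count g (map from T) ⟩
    count (to g) (map to (map from T))     ≡⟨ cong (count (to g)) (to-map-from T) ⟩
    count (to g) T                         ≤⟨ m≤m+n _ (count (to g) R) ⟩
    count (to g) T + count (to g) R        ≡⟨ count-++ (to g) T ⟨
    count (to g) (T ++ R)                  ≡⟨ ↭-length (filter-↭ (to g Fin.≟_) p) ⟨
    count (to g) (map to S)                ≡⟨ v≡count g S ⟨
    v g S                                  ∎
    where open ≤-Reasoning

  from-map-to : ∀ S → S ↭ map from (map to S)
  from-map-to S = ↭ᴳ.refl (go S)
    where
    go : ∀ S → Pointwise _≈_ S (map from (map to S))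
    go [] = []
    go (x ∷ S) = ≈-sym (strictlyInverseʳ x) ∷ go S

  map-from-↭ : ∀ {xs ys} → xs ↭ˡ ys → map from xs ↭ map from ys
  map-from-↭ ↭.refl = ↭ᴳ.refl (Pointwise.refl ≈-refl)
  map-from-↭ (↭.prep x p) = ↭ᴳ.prep ≈-refl (map-from-↭ p)
  map-from-↭ (↭.swap x y p) = ↭ᴳ.swap ≈-refl ≈-refl (map-from-↭ p)
  map-from-↭ (↭.trans p q) = ↭ᴳ.trans (map-from-↭ p) (map-from-↭ q)

  from-blocks : ∀ {S} i j {a b a′ b′} → from a ≈ a′ → from b ≈ b′ →
    map to S ↭ˡ replicate i a ++ replicate j b → S ↭ replicate i a′ ++ replicate j b′
  from-blocks {S} i j {a} {b} {a′} {b′} a≈ b≈ p =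
    ↭ᴳ.trans (from-map-to S) (↭ᴳ.trans (map-from-↭ p) (↭ᴳ.refl (blocks′ i)))
    where
    blocks′ : ∀ i → Pointwise _≈_ (map from (replicate i a ++ replicate j b))
        (replicate i a′ ++ replicate j b′)
    blocks′ (suc i) = a≈ ∷ blocks′ i
    blocks′ zero = block j
      where
      block : ∀ j → Pointwise _≈_ (map from (replicate j b)) (replicate j b′)
      block zero = []
      block (suc j) = b≈ ∷ block j

  supp≤2 : ∀ {S} i j {a b : A} → map to S ↭ˡ replicate i a ++ replicate j b → length (supp S) ≤ 2
  supp≤2 {S} i j {a} {b} p = subst (_≤ 2) (length-map to (supp S))
    (length-⊆ {ys = a ∷ b ∷ []} (AllPairs.map⁺ (AllPairs.map (λ x≉y e → x≉y (to-injective e))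
        (deduplicate-! decSetoid S))) sub)
    where
    decSetoid : DecSetoid _ _
    decSetoid = record { isDecEquivalence = record { isEquivalence = AbelianGroup.isEquivalence G ;
        _≟_ = _≟ᴳ_ } }
    sub : ∀ {x} → x ∈ˡ map to (supp S) → x ∈ˡ a ∷ b ∷ []
    sub x∈ with y , y∈ , refl ← ∈-map⁻ to x∈
      with ∈-++⁻ (replicate i a) (∈-resp-↭ p (∈-map⁺ to (∈-deduplicate⁻ _≟ᴳ_ S y∈)))
    ... | inj₁ y∈a = here (All.lookup (All.replicate⁺ {P = _≡ a} i refl) y∈a)
    ... | inj₂ y∈b = there (here (All.lookup (All.replicate⁺ {P = _≡ b} j refl) y∈b))

  module _ {S : List Carrier} {r : ℕ} (|S|≡n : length S ≡ n) (1≤r : 1 ≤ r) (r≤n : r ≤ n)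
      (r-sum : 0ᴳ ∈ Σₖ r S)
    (unique : ∀ r′ → 1 ≤ r′ → r′ ≤ n → 0ᴳ ∈ Σₖ r′ S → r′ ≡ r) where

    length-map-to : length (map to S) ≡ n
    length-map-to = trans (length-map to S) |S|≡n

    unique-length : ∀ T R → map to S ↭ˡ T ++ R → F.σ T ≡ 𝟘 → T ≢ [] → length T ≡ r
    unique-length T R p σ≡𝟘 T≢[] = unique (length T) (nonempty T T≢[]) (begin
      length T            ≤⟨ m≤m+n _ (length R) ⟩
      length T + length R ≡⟨ length-++ T ⟨
      length (T ++ R)     ≡⟨ ↭-length p ⟨
      length (map to S)   ≡⟨ length-map-to ⟩
      n                   ∎)
      (map from T , split⇒∣ {S} {T} {R} p , length-map from T , to-injective
          (trans (to-σ (map from T)) (trans (cong F.σ (to-map-from T)) σ≡𝟘)))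
      where
      open ≤-Reasoning
      nonempty : ∀ (T : List A) → T ≢ [] → 1 ≤ length T
      nonempty [] ≢[] = ⊥-elim (≢[] refl)
      nonempty (_ ∷ _) _ = s≤s z≤n

    form : F.Form (map to S) r
    form = let T , T∣S , |T|≡r , σ≈0 = r-sum
               R , p = ∣⇒split {T} {S} T∣S in
      F.form 1≤r (classification {map to T} {R}
        (zeroSum p (trans (sym (to-σ T)) (to-cong σ≈0)) (trans (length-map to T) |T|≡r)))
      where open F.UniqueLength (map to S) length-map-to r 1≤r unique-length

  member : ∀ {g x} k → to x ≡ k ·ᶠ to g → x ∈ ⟨ g ⟩
  member {g} k e = + k , to-injective (trans (to-· k g) (sym e))

  -- `⟨ g ⟩` admits negative multipliers; -(k + 1) is replaced by (k + 1)(s - 1), where s g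
  -- vanishes.
  member⁻ : ∀ {g x s} → 1 ≤ s → s ·ᶠ to g ≡ 𝟘 → x ∈ ⟨ g ⟩ → ∃[ k ] to x ≡ k ·ᶠ to g
  member⁻ {g} 1≤s s·g≡𝟘 (+ k , e) = k , sym (trans (sym (to-· k g)) (to-cong e))
  member⁻ {g} {x} {s} 1≤s s·g≡𝟘 (-[1+ k ] , e) = suc k * (s ∸ 1) , F.⊕-cancelʳ (suc k ·ᶠ to g) _ _
      (begin
    to x ⊕ suc k ·ᶠ to g                                ≡⟨ cong (to x ⊕_) (to-· (suc k) g) ⟨
    to x ⊕ to (suc k · g)                               ≡⟨ to-+ x _ ⟨
    to (x +ᴳ suc k · g)                                 ≡⟨ to-cong
        (≈-trans (∙-cong (≈-sym e) ≈-refl) (inverseˡ _)) ⟩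
    𝟘                                                   ≡⟨ F.multiple-≡𝟘 {to g} {s} (suc k) s·g≡𝟘 ⟨
    (suc k * s) ·ᶠ to g                                 ≡⟨ cong (_·ᶠ to g) (cancel-multiple (suc k)
        s 1≤s) ⟨
    (suc k * (s ∸ 1) + suc k) ·ᶠ to g                   ≡⟨ F.·-homo-+ (to g) (suc k * (s ∸ 1))
        (suc k) ⟩
    (suc k * (s ∸ 1)) ·ᶠ to g ⊕ suc k ·ᶠ to g           ∎)
    where open ≡-Reasoning

  OrderOf : A → ℕ → Set
  OrderOf t s = 1 ≤ s × s ·ᶠ t ≡ 𝟘 × (∀ j → 1 ≤ j → j < s → j ·ᶠ t ≢ 𝟘)

  order-∣ : ∀ {t s} k → OrderOf t s → k ·ᶠ t ≡ 𝟘 → s ℕ.∣ k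
  order-∣ {t} {suc s} k (_ , s·t≡𝟘 , minimal) e = m%n≡0⇒n∣m k (suc s) (remainder (k % suc s) refl)
    where
    remainder : ∀ j → k % suc s ≡ j → k % suc s ≡ 0
    remainder zero e′ = e′
    remainder (suc j) e′ = ⊥-elim (minimal (suc j) (s≤s z≤n) (subst (_< suc s) e′ (m%n<n k (suc s)))
      (trans (cong (_·ᶠ t) (sym e′)) (trans (sym (F.·-% k s·t≡𝟘)) e)))

  ∣+i-+j∣ : ∀ {i j} → i ≤ j → ∣ + i - + j ∣ ≡ j ∸ i
  ∣+i-+j∣ {i} {j} i≤j = trans (cong ∣_∣ ([+m]-[+n]≡m⊖n i j)) (∣⊖∣-≤ i≤j)

  ·-injective-mod : ∀ {t s} i j → OrderOf t s → i ·ᶠ t ≡ j ·ᶠ t → + s ℤ.∣ + i - + j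
  ·-injective-mod {t} {s} i j ord e = ℤ.∣ᵤ⇒∣ (go (≤-total i j))
    where
    difference : ∀ {i j} → i ≤ j → i ·ᶠ t ≡ j ·ᶠ t → s ℕ.∣ j ∸ i
    difference i≤j e = order-∣ _ ord (sym (trans (F.·-difference 𝟘 𝟘 i≤j (cong (𝟘 ⊕_) e))
        (F.⊕-identityˡ _)))
    go : i ≤ j ⊎ j ≤ i → s ℕ.∣ ∣ + i - + j ∣
    go (inj₁ i≤j) = subst (s ℕ.∣_) (sym (∣+i-+j∣ i≤j)) (difference i≤j e)
    go (inj₂ j≤i) = subst (s ℕ.∣_) (sym (trans (∣i-j∣≡∣j-i∣ (+ i) (+ j)) (∣+i-+j∣ j≤i)))
        (difference j≤i (sym e))

  ·-cong-mod : ∀ {t s} i j → s ·ᶠ t ≡ 𝟘 → + s ℤ.∣ + i - + j → i ·ᶠ t ≡ j ·ᶠ t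
  ·-cong-mod {t} {s} i j s·t≡𝟘 d = go (≤-total i j)
    where
    difference : ∀ {i j} → i ≤ j → s ℕ.∣ j ∸ i → i ·ᶠ t ≡ j ·ᶠ t
    difference {i} {j} i≤j (ℕ.divides q e) =
        sym (trans (cong (_·ᶠ t) (sym (trans (cong (λ k → i + k) (sym e)) (m+[n∸m]≡n i≤j))))
      (F.·-+-≡𝟘 {t} {q * s} i (F.multiple-≡𝟘 {t} {s} q s·t≡𝟘)))
    go : i ≤ j ⊎ j ≤ i → i ·ᶠ t ≡ j ·ᶠ t
    go (inj₁ i≤j) = difference i≤j (subst (s ℕ.∣_) (∣+i-+j∣ i≤j) (ℤ.∣⇒∣ᵤ d))
    go (inj₂ j≤i) = sym (difference j≤i (subst (s ℕ.∣_) (trans (∣i-j∣≡∣j-i∣ (+ i) (+ j))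
        (∣+i-+j∣ j≤i)) (ℤ.∣⇒∣ᵤ d)))

  residue : ∀ {s} → 1 ≤ s → ∀ z → ∃[ k ] + s ℤ.∣ + k - z
  residue {s} _ (+ k) = k , AbelianGroup.refl (C s) {+ k}
  residue {s} 1≤s -[1+ k ] = suc k * (s ∸ 1) , ℤ.∣ᵤ⇒∣ (ℕ.divides (suc k) (cancel-multiple (suc k) s
      1≤s))

  ≅-intro : (K : AbelianGroup 0ℓ 0ℓ) (f : Carrier → AbelianGroup.Carrier K) →
    (let module K = AbelianGroup K) →
    (∀ {x y} → x ≈ y → f x K.≈ f y) → (∀ x y → f (x +ᴳ y) K.≈ f x K.∙ f y) →
    (∀ {x y} → f x K.≈ f y → x ≈ y) → (∀ y → ∃[ x ] f x K.≈ y) → G ≅ K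
  ≅-intro K f f-cong homo injective surjective = f , record
    { isGroupMonomorphism = record
      { isGroupHomomorphism = record
        { isMonoidHomomorphism = record
          { isMagmaHomomorphism = record
            { isRelHomomorphism = record { cong = f-cong } ; homo = homo }
          ; ε-homo = ε-homo
          }
        ; ⁻¹-homo = λ x → GroupProperties.inverseˡ-unique (AbelianGroup.group K) _ _
            (K.trans (K.sym (homo (-ᴳ x) x)) (K.trans (f-cong (inverseˡ x)) ε-homo))
        }
      ; injective = injective
      }
    ; surjective = λ y → let x , e = surjective y in x , λ z≈x → K.trans (f-cong z≈x) e
    }
    where
    module K = AbelianGroup K
    ε-homo : f 0ᴳ K.≈ K.ε
    ε-homo = GroupProperties.identityˡ-unique (AbelianGroup.group K) _ _
      (K.trans (K.sym (homo 0ᴳ 0ᴳ)) (f-cong (identityˡ 0ᴳ)))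

  -- Cyclic groups

  module Cyclic {g′ : A} (gen : F.Generates g′) where
    open F.Generates gen

    g : Carrier
    g = from g′

    to-g : to g ≡ g′
    to-g = strictlyInverseˡ g′

    isGenerator : IsGenerator g
    isGenerator x = member (log (to x)) (trans (log-correct (to x)) (cong (log (to x) ·ᶠ_)
        (sym to-g)))

    1≤n : 1 ≤ n
    1≤n = ≤-trans (1≤log 𝟘) (log≤n 𝟘)

    ord : OrderOf g′ n
    ord = 1≤n , n·g≡𝟘 , torsionFree

    to-multiple : ∀ k → to (k · g) ≡ k ·ᶠ g′
    to-multiple k = trans (to-· k g) (cong (k ·ᶠ_) to-g)

    ∉⟨2·g⟩ : ∀ {b} → (∀ i → b ≢ i ·ᶠ 2 ·ᶠ g′) → from b ∉ ⟨ 2 · g ⟩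
    ∉⟨2·g⟩ {b} b∉ b∈ =
      let k , e = member⁻ 1≤n (trans (cong (n ·ᶠ_) (to-multiple 2)) (trans (F.·-assocˡ g′ n 2)
                    (trans (cong (_·ᶠ g′) (*-comm n 2)) (F.multiple-≡𝟘 {g′} {n} 2 n·g≡𝟘)))) b∈
      in b∉ k (trans (sym (strictlyInverseˡ b)) (trans e (cong (k ·ᶠ_) (to-multiple 2))))

    ≅C : G ≅ C n
    -- The logarithm is additive only modulo n, which is the equality of `C n`.
    ≅C = ≅-intro (C n) (λ x → + log (to x))
      (λ x≈y → AbelianGroup.reflexive (C n) (cong (λ z → + log z) (to-cong x≈y)))
      (λ x y → ·-injective-mod (log (to (x +ᴳ y))) (log (to x) + log (to y)) ord
        (trans (sym (log-correct _)) (trans (to-+ x y) (trans (cong₂ _⊕_ (log-correct (to x))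
            (log-correct (to y)))
          (sym (F.·-homo-+ g′ (log (to x)) (log (to y))))))))
      (λ {x} {y} d → to-injective (trans (log-correct (to x))
        (trans (·-cong-mod (log (to x)) (log (to y)) n·g≡𝟘 d) (sym (log-correct (to y))))))
      λ z → let k , d = residue 1≤n z in k · g ,
        AbelianGroup.trans (C n) {+ log (to (k · g))} {+ k} {z} (·-injective-mod (log (to (k · g)))
            k ord
          (trans (sym (log-correct _)) (to-multiple k))) d

  -- The groups of type (2, 2m)

  module NonCyclic {t′ h′ : A} {m : ℕ} (1≤m : 1 ≤ m) (n≡4m : n ≡ 2 * (2 * m))
      (2m·t≡𝟘 : (2 * m) ·ᶠ t′ ≡ 𝟘)
    (minimal : ∀ j → 1 ≤ j → j < 2 * m → j ·ᶠ t′ ≢ 𝟘) (2·h≡𝟘 : 2 ·ᶠ h′ ≡ 𝟘) (h∉⟨t⟩ : ∀ i →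
        h′ ≢ i ·ᶠ t′)
    (coset : ∀ z → ∃[ i ] (z ≡ i ·ᶠ t′ ⊎ z ≡ h′ ⊕ i ·ᶠ t′)) where

    t h : Carrier
    t = from t′
    h = from h′

    to-t : to t ≡ t′
    to-t = strictlyInverseˡ t′

    to-h : to h ≡ h′
    to-h = strictlyInverseˡ h′

    1≤2m : 1 ≤ 2 * m
    1≤2m = ≤-trans 1≤m (m≤m+n m (m + 0))

    ord-t : OrderOf t′ (2 * m)
    ord-t = 1≤2m , 2m·t≡𝟘 , minimal

    ord-h : OrderOf h′ 2
    ord-h = s≤s z≤n , 2·h≡𝟘 , λ
      { 1 _ _ e → h∉⟨t⟩ 0 (trans (sym (F.·-homo-1 h′)) e)
      ; (suc (suc _)) _ (s≤s (s≤s ())) _ }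

    even·h : ∀ k → (k * 2) ·ᶠ h′ ≡ 𝟘
    even·h k = F.multiple-≡𝟘 {h′} {2} k 2·h≡𝟘

    odd·h : ∀ k → (1 + k * 2) ·ᶠ h′ ≡ h′
    odd·h k = trans (cong (h′ ⊕_) (even·h k)) (F.⊕-identityʳ h′)

    -- The orders 2 of h and 2m of t both divide 2m, so the exponent of G is below its order 4m;
    -- hence no element generates.
    killed : ∀ z → (2 * m) ·ᶠ z ≡ 𝟘
    killed z = go (coset z)
      where
      killed-t : ∀ i → (2 * m) ·ᶠ i ·ᶠ t′ ≡ 𝟘
      killed-t i = trans (F.·-assocˡ t′ (2 * m) i) (trans (cong (_·ᶠ t′) (*-comm (2 * m) i))
          (F.multiple-≡𝟘 {t′} {2 * m} i 2m·t≡𝟘))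
      go : ∀ {z} → ∃[ i ] (z ≡ i ·ᶠ t′ ⊎ z ≡ h′ ⊕ i ·ᶠ t′) → (2 * m) ·ᶠ z ≡ 𝟘
      go (i , inj₁ refl) = killed-t i
      go (i , inj₂ refl) = trans (F.·-distrib-⊕ h′ _ (2 * m)) (trans (cong₂ _⊕_
        (trans (cong (_·ᶠ h′) (*-comm 2 m)) (even·h m)) (killed-t i)) (F.⊕-identityˡ 𝟘))

    ¬cyclic : ¬ IsCyclic
    ¬cyclic (g , gen) = <⇒≱ (m<m+n (2 * m) 1≤2m)
        (≤-trans (≤-reflexive (trans (cong (λ k → 2 * m + k) (sym (+-identityʳ (2 * m))))
        (sym n≡4m)))
      (≤-trans (F.order-≥n (trans (cong (_·ᶠ to g) 1+2m∸1) (killed (to g))) multiples)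
          (≤-reflexive 1+2m∸1)))
      where
      1+2m∸1 : suc (2 * m ∸ 1) ≡ 2 * m
      1+2m∸1 = m+[n∸m]≡n 1≤2m
      multiples : ∀ z → ∃[ k ] z ≡ k ·ᶠ to g
      multiples z = let k , e = member⁻ 1≤2m (killed (to g)) (gen (from z)) in k , trans
                          (sym (strictlyInverseˡ z)) e

    member-t⁻ : ∀ {x} → x ∈ ⟨ t ⟩ → ∃[ k ] to x ≡ k ·ᶠ t′
    member-t⁻ x∈ = let k , e = member⁻ 1≤2m (killed (to t)) x∈ in k , trans e (cong (k ·ᶠ_) to-t)

    member-h⁻ : ∀ {x} → x ∈ ⟨ h ⟩ → ∃[ k ] to x ≡ k ·ᶠ h′
    member-h⁻ x∈ = let k , e = member⁻ {s = 2} (s≤s z≤n) (trans (cong (2 ·ᶠ_) to-h) 2·h≡𝟘) x∈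
                         in k , trans e (cong (k ·ᶠ_) to-h)

    hasOrder : ∀ {g g′ s} → to g ≡ g′ → OrderOf g′ s → HasOrder g s
    hasOrder {g} {s = s} refl (1≤s , s·g≡𝟘 , min) = 1≤s , to-injective (trans (to-· s g) s·g≡𝟘) ,
      λ j 0<j e → ≮⇒≥ λ j<s → min j 0<j j<s (trans (sym (to-· j g)) (to-cong e))

    ∉⟨t⟩ : ∀ {x x′} → to x ≡ x′ → (∀ i → x′ ≢ i ·ᶠ t′) → x ∉ ⟨ t ⟩
    ∉⟨t⟩ refl x∉ x∈ = let k , e = member-t⁻ x∈ in x∉ k e

    isDirectSum : IsDirectSum ⟨ h ⟩ ⟨ t ⟩
    isDirectSum = (λ x → decompose (coset (to x))) , λ x x∈h x∈t → trivial (member-h⁻ x∈h)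
        (member-t⁻ x∈t)
      where
      multiple∈ : ∀ i → i · t ∈ ⟨ t ⟩
      multiple∈ i = + i , ≈-refl
      to-multiple : ∀ i → to (i · t) ≡ i ·ᶠ t′
      to-multiple i = trans (to-· i t) (cong (i ·ᶠ_) to-t)
      decompose : ∀ {x} → ∃[ i ] (to x ≡ i ·ᶠ t′ ⊎ to x ≡ h′ ⊕ i ·ᶠ t′) → ∃[ y ] ∃[ z ] y ∈ ⟨ h ⟩ ×
          z ∈ ⟨ t ⟩ × y +ᴳ z ≈ x
      decompose (i , inj₁ e) = 0ᴳ , i · t , (+ 0 , ≈-refl) , multiple∈ i ,
        ≈-trans (identityˡ _) (to-injective (trans (to-multiple i) (sym e)))
      decompose (i , inj₂ e) = h , i · t , (+ 1 , identityʳ h) , multiple∈ i ,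
        to-injective (trans (to-+ h _) (trans (cong₂ _⊕_ to-h (to-multiple i)) (sym e)))
      trivial : ∀ {x} → ∃[ k ] to x ≡ k ·ᶠ h′ → ∃[ i ] to x ≡ i ·ᶠ t′ → x ≈ 0ᴳ
      trivial (k , e) (i , e′) with even-or-odd k
      ... | inj₁ (j , refl) = to-injective (trans e (even·h j))
      ... | inj₂ (j , refl) = ⊥-elim (h∉⟨t⟩ i (trans (sym (odd·h j)) (trans (sym e) e′)))

    coordinates : ∀ z → ∃[ a ] ∃[ i ] z ≡ a ·ᶠ h′ ⊕ i ·ᶠ t′
    coordinates z = go (coset z)
      where
      go : ∀ {z} → ∃[ i ] (z ≡ i ·ᶠ t′ ⊎ z ≡ h′ ⊕ i ·ᶠ t′) → ∃[ a ] ∃[ i ] z ≡ a ·ᶠ h′ ⊕ i ·ᶠ t′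
      go (i , inj₁ e) = 0 , i , trans e (sym (F.⊕-identityˡ _))
      go (i , inj₂ e) = 1 , i , trans e (cong (_⊕ i ·ᶠ t′) (sym (F.·-homo-1 h′)))

    -- Only the parity of the coefficient of h matters, and differing parities would put h into ⟨t⟩.
    coordinates-unique : ∀ {a b} i j → a ·ᶠ h′ ⊕ i ·ᶠ t′ ≡ b ·ᶠ h′ ⊕ j ·ᶠ t′ →
      a ·ᶠ h′ ≡ b ·ᶠ h′ × i ·ᶠ t′ ≡ j ·ᶠ t′
    coordinates-unique {a} {b} i j e = go (even-or-odd a) (even-or-odd b)
      where
      conclude : a ·ᶠ h′ ≡ b ·ᶠ h′ → a ·ᶠ h′ ≡ b ·ᶠ h′ × i ·ᶠ t′ ≡ j ·ᶠ t′
      conclude e′ = e′ , F.⊕-cancelˡ (b ·ᶠ h′) _ _ (trans (cong (_⊕ i ·ᶠ t′) (sym e′)) e)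
      mixed : ∀ i j → h′ ⊕ i ·ᶠ t′ ≡ 𝟘 ⊕ j ·ᶠ t′ → ⊥
      mixed i j e = h∉⟨t⟩ (j + i * (2 * m ∸ 1)) (F.⊕-cancelʳ (i ·ᶠ t′) _ _ (begin
        h′ ⊕ i ·ᶠ t′                              ≡⟨ trans e (F.⊕-identityˡ _) ⟩
        j ·ᶠ t′                                   ≡⟨ F.·-+-≡𝟘 {t′} {i * (2 * m)} j
            (F.multiple-≡𝟘 {t′} {2 * m} i 2m·t≡𝟘) ⟨
        (j + i * (2 * m)) ·ᶠ t′                   ≡⟨ cong (λ k → (j + k) ·ᶠ t′) (cancel-multiple i
            (2 * m) 1≤2m) ⟨
        (j + (i * (2 * m ∸ 1) + i)) ·ᶠ t′         ≡⟨ cong (_·ᶠ t′) (+-assoc j _ i) ⟨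
        (j + i * (2 * m ∸ 1) + i) ·ᶠ t′           ≡⟨ F.·-homo-+ t′ (j + i * (2 * m ∸ 1)) i ⟩
        (j + i * (2 * m ∸ 1)) ·ᶠ t′ ⊕ i ·ᶠ t′     ∎))
        where open ≡-Reasoning
      go : (∃[ k ] a ≡ k * 2) ⊎ (∃[ k ] a ≡ 1 + k * 2) → (∃[ k ] b ≡ k * 2) ⊎
          (∃[ k ] b ≡ 1 + k * 2) →
           a ·ᶠ h′ ≡ b ·ᶠ h′ × i ·ᶠ t′ ≡ j ·ᶠ t′
      go (inj₁ (k , refl)) (inj₁ (l , refl)) = conclude (trans (even·h k) (sym (even·h l)))
      go (inj₂ (k , refl)) (inj₂ (l , refl)) = conclude (trans (odd·h k) (sym (odd·h l)))
      go (inj₁ (k , refl)) (inj₂ (l , refl)) =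
          ⊥-elim (mixed j i (sym (trans (cong (_⊕ i ·ᶠ t′) (sym (even·h k)))
          (trans e (cong (_⊕ j ·ᶠ t′) (odd·h l))))))
      go (inj₂ (k , refl)) (inj₁ (l , refl)) =
          ⊥-elim (mixed i j (trans (cong (_⊕ i ·ᶠ t′) (sym (odd·h k)))
          (trans e (cong (_⊕ j ·ᶠ t′) (even·h l)))))

    ≅C×C : G ≅ (C 2 ×ᴳ C (2 * m))
    ≅C×C = ≅-intro K f f-cong
      (λ x y → coordinates-mod (a (x +ᴳ y)) (a x + a y) (i (x +ᴳ y)) (i x + i y) (begin
        a (x +ᴳ y) ·ᶠ h′ ⊕ i (x +ᴳ y) ·ᶠ t′                        ≡⟨ correct (x +ᴳ y) ⟨
        to (x +ᴳ y)                                                ≡⟨ to-+ x y ⟩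
        to x ⊕ to y                                                ≡⟨ cong₂ _⊕_ (correct x)
            (correct y) ⟩
        (a x ·ᶠ h′ ⊕ i x ·ᶠ t′) ⊕ (a y ·ᶠ h′ ⊕ i y ·ᶠ t′)          ≡⟨ solve 4 (λ p q u w →
            (p ⊙ q) ⊙ (u ⊙ w) ⊜ (p ⊙ u) ⊙ (q ⊙ w)) refl
                                                                        (a x ·ᶠ h′) (i x ·ᶠ t′) (a
                                                                            y ·ᶠ h′) (i y ·ᶠ t′) ⟩
        (a x ·ᶠ h′ ⊕ a y ·ᶠ h′) ⊕ (i x ·ᶠ t′ ⊕ i y ·ᶠ t′)          ≡⟨ cong₂ _⊕_
            (F.·-homo-+ h′ (a x) (a y)) (F.·-homo-+ t′ (i x) (i y)) ⟨
        (a x + a y) ·ᶠ h′ ⊕ (i x + i y) ·ᶠ t′                      ∎))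
      (λ {x} {y} (d , d′) → to-injective (trans (correct x)
          (trans (cong₂ _⊕_ (·-cong-mod (a x) (a y) 2·h≡𝟘 d)
        (·-cong-mod (i x) (i y) 2m·t≡𝟘 d′)) (sym (correct y)))))
      λ (p , q) → let k , d = residue {2} (s≤s z≤n) p
                      l , d′ = residue {2 * m} 1≤2m q
                      x = k · h +ᴳ l · t
                      e , e′ = coordinates-mod (a x) k (i x) l (trans (sym (correct x))
                          (trans (to-+ (k · h) (l · t))
                        (cong₂ _⊕_ (trans (to-· k h) (cong (k ·ᶠ_) to-h)) (trans (to-· l t)
                            (cong (l ·ᶠ_) to-t)))))
                  in x , AbelianGroup.trans (C 2) {+ a x} {+ k} {p} e d , AbelianGroup.trans
                      (C (2 * m)) {+ i x} {+ l} {q} e′ d′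
      where
      open ≡-Reasoning
      open F.⊕-Solver renaming (_⊕_ to _⊙_)
      K = C 2 ×ᴳ C (2 * m)
      a i : Carrier → ℕ
      a x = proj₁ (coordinates (to x))
      i x = proj₁ (proj₂ (coordinates (to x)))
      correct : ∀ x → to x ≡ a x ·ᶠ h′ ⊕ i x ·ᶠ t′
      correct x = proj₂ (proj₂ (coordinates (to x)))
      f : Carrier → AbelianGroup.Carrier K
      f x = + a x , + i x
      f-cong : ∀ {x y} → x ≈ y → AbelianGroup._≈_ K (f x) (f y)
      f-cong x≈y = AbelianGroup.reflexive K (cong (λ z → + proj₁ (coordinates z) , + proj₁
          (proj₂ (coordinates z))) (to-cong x≈y))
      coordinates-mod : ∀ b c j k → b ·ᶠ h′ ⊕ j ·ᶠ t′ ≡ c ·ᶠ h′ ⊕ k ·ᶠ t′ → + 2 ℤ.∣ + b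
          - + c × + (2 * m) ℤ.∣ + j - + k
      coordinates-mod b c j k e = let e₁ , e₂ = coordinates-unique {b} {c} j k e in
        ·-injective-mod b c ord-h e₁ , ·-injective-mod j k ord-t e₂

  cyclic-supp≤2 : ∀ {S r g} → F.CyclicForm (map to S) r g → length (supp S) ≤ 2
  cyclic-supp≤2 (F.form₁ p) = supp≤2 (n ∸ 1) 1 p
  cyclic-supp≤2 (F.form₂ _ p) = supp≤2 (n ∸ 1) 1 p
  cyclic-supp≤2 (F.form₃ _ _ p) = supp≤2 (n ∸ 2) 2 p
  cyclic-supp≤2 (F.form₄ {x} _ _ _ _ p) = supp≤2 (n / 2 + x) (n / 2 ∸ x) p
  cyclic-supp≤2 (F.form₅ {x} _ _ _ _ p) = supp≤2 (n / 2 + x) (n / 2 ∸ x) p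

  noncyclic-supp≤2 : ∀ {S t h} → F.NonCyclicForm (map to S) t h → length (supp S) ≤ 2
  noncyclic-supp≤2 (F.formᴬ₁ _ p) = supp≤2 (n ∸ 1) 1 p
  noncyclic-supp≤2 (F.formᴬ₂ {x} _ _ _ p) = supp≤2 (n / 2 + x) (n / 2 ∸ x) p

theorem3p4 :
    ∀ {c ℓ} (G : AbelianGroup c ℓ) (n : ℕ) (|G|≡n : HasCardinality G n) →
    let open GroupNotions G
        open Sequences G |G|≡n
    in
    (S : List Carrier) → length S ≡ n →
    (r : ℕ) → 1 ≤ r → r ≤ n → 0ᴳ ∈ Σₖ r S →
    (∀ r′ → 1 ≤ r′ → r′ ≤ n → 0ᴳ ∈ Σₖ r′ S → r′ ≡ r) →
    length (supp S) ≤ 2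
    ×
    (¬ IsCyclic →
      ∃[ g ] ∃[ h ] ∃[ m ]
        1 ≤ m × n ≡ 2 * (2 * m) ×
        HasOrder g (2 * m) × HasOrder h 2 × h ∉ ⟨ g ⟩ ×
        IsDirectSum ⟨ h ⟩ ⟨ g ⟩ × G ≅ (C 2 ×ᴳ C (2 * m)) ×
        r ≡ 2 * m ×
        ( (∃[ g′ ] g′ ∉ ⟨ g ⟩ ×
            S ↭ replicate (n ∸ 1) g ++ g′ ∷ [])
        ⊎ (∃[ x ] Odd x × 1 ≤ x × x < n / 2 ×
            S ↭ replicate (n / 2 + x) g ++ replicate (n / 2 ∸ x) (h +ᴳ g))
        ⊎ (∃[ x ] Odd x × 1 ≤ x × x < n / 2 ×
            S ↭ replicate (n / 2 + x) g ++
                replicate (n / 2 ∸ x) (h +ᴳ ((n + 4) / 4) · g))))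
    ×
    (IsCyclic →
      G ≅ C n ×
      ∃[ g ] IsGenerator g ×
        ( (∃[ g′ ] S ↭ replicate (n ∸ 1) g ++ g′ ∷ [])
        ⊎ (∃[ g″ ] g″ ∉ ⟨ 2 · g ⟩ ×
            S ↭ replicate (n ∸ 1) (2 · g) ++ g″ ∷ [])
        ⊎ (Odd n × r ≡ (n + 1) / 2 ×
            S ↭ replicate (n ∸ 2) g ++ replicate 2 (((n + 1) / 2) · g))
        ⊎ (n % 4 ≡ 2 × r ≡ n / 2 ×
            ∃[ x ] Even x × x < n / 2 ×
              S ↭ replicate (n / 2 + x) (2 · g) ++
                  replicate (n / 2 ∸ x) (((n + 4) / 2) · g))
        ⊎ (Even n × r ≡ n / 2 ×
            ∃[ x ] x < n / 2 × Odd (n / 2 ∸ x) ×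
              S ↭ replicate (n / 2 + x) g ++
                  replicate (n / 2 ∸ x) (((n + 2) / 2) · g))))
theorem3p4 G n |G|≡n S |S|≡n r 1≤r r≤n r-sum unique
  with Transport.form G |G|≡n |S|≡n 1≤r r≤n r-sum unique
... | FiniteGroup.cyclic gen cyclicForm =
  cyclic-supp≤2 cyclicForm ,
  (λ ¬cyclic → ⊥-elim (¬cyclic (g , isGenerator))) ,
  λ _ → ≅C , g , isGenerator , (case cyclicForm of λ
    { (F.form₁ p) → inj₁ (_ , from-blocks (n ∸ 1) 1 ≈-refl ≈-refl p)
    ; (F.form₂ b∉ p) → inj₂ (inj₁ (_ , ∉⟨2·g⟩ b∉ , from-blocks (n ∸ 1) 1 (from-· 2 _) ≈-refl p))
    ; (F.form₃ odd r≡ p) → inj₂ (inj₂ (inj₁ (odd , r≡ ,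
        from-blocks (n ∸ 2) 2 ≈-refl (from-· ((n + 1) / 2) _) p)))
    ; (F.form₄ {x} n≡ r≡ even x< p) → inj₂ (inj₂ (inj₂ (inj₁ (n≡ , r≡ , x , even , x< ,
        from-blocks (n / 2 + x) (n / 2 ∸ x) (from-· 2 _) (from-· ((n + 4) / 2) _) p))))
    ; (F.form₅ {x} even r≡ x< odd p) → inj₂ (inj₂ (inj₂ (inj₂ (even , r≡ , x , x< , odd ,
        from-blocks (n / 2 + x) (n / 2 ∸ x) ≈-refl (from-· ((n + 2) / 2) _) p)))) })
  where
  open Transport G |G|≡n
  open Cyclic gen
  open AbelianGroup G using () renaming (refl to ≈-refl)
... | FiniteGroup.noncyclic {m = m} 1≤m n≡4m r≡2m 2m·t≡𝟘 minimal 2·h≡𝟘 h∉ coset noncyclicForm =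
  noncyclic-supp≤2 noncyclicForm ,
  (λ _ → t , h , m , 1≤m , n≡4m , hasOrder to-t ord-t , hasOrder to-h ord-h , ∉⟨t⟩ to-h h∉ ,
    isDirectSum , ≅C×C , r≡2m , (case noncyclicForm of λ
      { (F.formᴬ₁ {b} b∉ p) → inj₁ (_ , ∉⟨t⟩ (strictlyInverseˡ b) b∉ ,
          from-blocks (n ∸ 1) 1 ≈-refl ≈-refl p)
      ; (F.formᴬ₂ {x} odd 1≤x x< p) → inj₂ (inj₁ (x , odd , 1≤x , x< ,
          from-blocks (n / 2 + x) (n / 2 ∸ x) ≈-refl (strictlyInverseʳ _) p)) })) ,
  λ cyclic → ⊥-elim (¬cyclic cyclic)
  where
  open Transport G |G|≡n
  open NonCyclic 1≤m n≡4m 2m·t≡𝟘 minimal 2·h≡𝟘 h∉ coset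
  open Inverse |G|≡n using (strictlyInverseˡ; strictlyInverseʳ)
  open AbelianGroup G using () renaming (refl to ≈-refl)
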